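{- For $n\ge0$ define $$P'_n=\sum_{\sigma\in\mathfrak D_{2n}}x_1^{\mathrm{ereccpeak}'(\sigma)}x_2^{\mathrm{eareccdfall}'(\sigma)}y_1^{\mathrm{eareccval}'(\sigma)}y_2^{\mathrm{ereccdrise}'(\sigma)}u_1^{\mathrm{nrcpeak}'(\sigma)}u_2^{\mathrm{nrcdfall}'(\sigma)}v_1^{\mathrm{nrcval}'(\sigma)}v_2^{\mathrm{nrcdrise}'(\sigma)}w_{\mathrm e}^{\mathrm{evennrfix}(\sigma)}w_{\mathrm o}^{\mathrm{oddnrfix}(\sigma)}z_{\mathrm e}^{\mathrm{evenrar}(\sigma)}z_{\mathrm o}^{\mathrm{oddrar}(\sigma)}$$ $$\times\,p_{ -1}^{\mathrm{ucrosscpeak}'(\sigma)}p_{ -2}^{\mathrm{lcrosscdfall}'(\sigma)}p_{+1}^{\mathrm{lcrosscval}'(\sigma)}p_{+2}^{\mathrm{ucrosscdrise}'(\sigma)}q_{ -1}^{\mathrm{unestcpeak}'(\sigma)}q_{ -2}^{\mathrm{lnestcdfall}'(\sigma)}q_{+1}^{\mathrm{lnestcval}'(\sigma)}q_{+2}^{\mathrm{unestcdrise}'(\sigma)}s_{\mathrm e}^{\mathrm{epsnest}(\sigma)}s_{\mathrm o}^{\mathrm{opsnest}(\sigma)}$$ and let $P_n$ be the polynomial $$P_n=\sum_{\sigma\in\mathfrak D_{2n}}x_1^{\mathrm{eareccpeak}(\sigma)}x_2^{\mathrm{eareccdfall}(\sigma)}y_1^{\mathrm{ereccval}(\sigma)}y_2^{\mathrm{ereccdrise}(\sigma)}u_1^{\mathrm{nrcpeak}(\sigma)}u_2^{\mathrm{nrcdfall}(\sigma)}v_1^{\mathrm{nrcval}(\sigma)}v_2^{\mathrm{nrcdrise}(\sigma)}w_{\mathrm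 e}^{\mathrm{evennrfix}(\sigma)}w_{\mathrm o}^{\mathrm{oddnrfix}(\sigma)}z_{\mathrm e}^{\mathrm{evenrar}(\sigma)}z_{\mathrm o}^{\mathrm{oddrar}(\sigma)}$$ $$\times\,p_{ -1}^{\mathrm{lcrosscpeak}(\sigma)}p_{ -2}^{\mathrm{lcrosscdfall}(\sigma)}p_{+1}^{\mathrm{ucrosscval}(\sigma)}p_{+2}^{\mathrm{ucrosscdrise}(\sigma)}q_{ -1}^{\mathrm{lnestcpeak}(\sigma)}q_{ -2}^{\mathrm{lnestcdfall}(\sigma)}q_{+1}^{\mathrm{unestcval}(\sigma)}q_{+2}^{\mathrm{unestcdrise}(\sigma)}s_{\mathrm e}^{\mathrm{epsnest}(\sigma)}s_{\mathrm o}^{\mathrm{opsnest}(\sigma)}.$$ Then $\sum_{n\ge0}P'_nt^n$ equals the T-type continued fraction with coefficients $\alpha_{2k-1}=\bigl(p_{ -1}^{k-1}x_1+q_{ -1}[k-1]_{p_{ -1},q_{ -1}}u_1\bigr)\bigl(p_{+1}^{k-1}y_1+q_{+1}[k-1]_{p_{+1},q_{+1}}v_1\bigr)$, $\alpha_{2k}=\bigl(p_{ -2}^{k-1}x_2+q_{ -2}[k-1]_{p_{ -2},q_{ -2}}u_2+s_{\mathrm e}^kw_{\mathrm e}\bigr)\bigl(p_{+2}^{k-1}y_2+q_{+2}[k-1]_{p_{+2},q_{+2}}v_2+s_{\mathrm o}^kw_{\mathrm o}\bigr)$ ($k\ge1$), $\delta_1=z_{\mathrm e}z_{\mathrm o}$,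 $\delta_n=0$ ($n\ge2$); consequently $P_n=P'_n$ for all $n\ge0$.
   Context: $\mathfrak D_{2n}$: permutations $\sigma$ of $[2n]$ with $\sigma(2k-1)\ge2k-1$, $\sigma(2k)\le2k$ for all $k\in[n]$. Index $i$ is a cycle peak / valley / double rise / double fall if respectively $\sigma^{ -1}(i)<i>\sigma(i)$ / $\sigma^{ -1}(i)>i<\sigma(i)$ / $\sigma^{ -1}(i)<i<\sigma(i)$ / $\sigma^{ -1}(i)>i>\sigma(i)$. Record: $\sigma(j)<\sigma(i)$ for all $j<i$; antirecord: $\sigma(j)>\sigma(i)$ for all $j>i$; exclusive record = record not antirecord; exclusive antirecord = antirecord not record; record-antirecord = both; neither-record-antirecord = neither. Unprimed record statistics: $\mathrm{eareccpeak},\mathrm{eareccdfall}$ = number of exclusive antirecords that are cycle peaks, resp. cycle double falls; $\mathrm{ereccval},\mathrm{ereccdrise}$ = exclusive records that are cycle valleys, resp. cycle double rises; $\mathrm{nrcpeak},\mathrm{nrcdfall},\mathrm{nrcval},\mathrm{nrcdrise}$ = neither-record-antirecords that are cycle peaks, double falls, valleys, double rises. Primed record statistics: $\mathrm{ereccpeak}'(\sigma)$ (resp. $\mathrm{nrcpeak}'$) = number of cycle peaks $i$ such that $\sigma^{ -1}(i)$ is (resp. is not) a record; $\mathrm{ereccdrise}'$ (resp. $\mathrm{nrcdrise}'$) = cycle double rises $i$ with $\sigma^{ -1}(i)$ a record (resp. not a record); $\mathrm{eareccval}'$ (resp. $\mathrm{nrcval}'$) = cycle valleys $i$ with $\sigma^{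 -1}(i)$ an antirecord (resp. not an antirecord); $\mathrm{eareccdfall}'$ (resp. $\mathrm{nrcdfall}'$) = cycle double falls $i$ with $\sigma^{ -1}(i)$ an antirecord (resp. not). $\mathrm{evennrfix},\mathrm{oddnrfix}$ = even/odd fixed points that are neither-record-antirecords; $\mathrm{evenrar},\mathrm{oddrar}$ = even/odd record-antirecords. Crossing/nesting: $\mathrm{ucross}(j,\sigma)=\#\{(i,k,l):i<j<k<l,k=\sigma(i),l=\sigma(j)\}$, $\mathrm{unest}(j,\sigma)=\#\{(i,k,l):i<j<k<l,k=\sigma(j),l=\sigma(i)\}$, $\mathrm{lcross}(k,\sigma)=\#\{(i,j,l):i<j<k<l,i=\sigma(k),j=\sigma(l)\}$, $\mathrm{lnest}(k,\sigma)=\#\{(i,j,l):i<j<k<l,i=\sigma(l),j=\sigma(k)\}$; $\mathrm{ucross}'(k,\sigma)=\#\{(i,j,l):i<j<k<l,k=\sigma(i),l=\sigma(j)\}$, $\mathrm{unest}'(k,\sigma)=\#\{(i,j,l):i<j<k<l,k=\sigma(j),l=\sigma(i)\}$, $\mathrm{lcross}'(j,\sigma)=\#\{(i,k,l):i<j<k<l,i=\sigma(k),j=\sigma(l)\}$, $\mathrm{lnest}'(j,\sigma)=\#\{(i,k,l):i<j<k<l,i=\sigma(l),j=\sigma(k)\}$. Sums: $\mathrm{ucrosscval}=\sum_{\text{cycle valleys }j}\mathrm{ucross}(j,\sigma)$, $\mathrm{ucrosscdrise}=\sum_{\text{cycle double rises }j}\mathrm{ucross}(j,\sigma)$, $\mathrm{lcrosscpeak}=\sum_{\text{cycle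 peaks }k}\mathrm{lcross}(k,\sigma)$, $\mathrm{lcrosscdfall}=\sum_{\text{cycle double falls }k}\mathrm{lcross}(k,\sigma)$, and similarly the nest versions; $\mathrm{ucrosscpeak}'=\sum_{\text{cycle peaks }k}\mathrm{ucross}'(k,\sigma)$, $\mathrm{unestcpeak}'=\sum_{\text{cycle peaks }k}\mathrm{unest}'(k,\sigma)$, $\mathrm{ucrosscdrise}',\mathrm{unestcdrise}'$ = same sums over cycle double rises, $\mathrm{lcrosscval}',\mathrm{lnestcval}'$ = sums of $\mathrm{lcross}',\mathrm{lnest}'$ over cycle valleys, $\mathrm{lcrosscdfall}',\mathrm{lnestcdfall}'$ = same over cycle double falls. For a fixed point $j$, $\mathrm{psnest}(j,\sigma)=\#\{i<j:\sigma(i)>j\}$; $\mathrm{epsnest},\mathrm{opsnest}$ = sums of psnest over even, resp. odd, fixed points. $[n]_{p,q}=\sum_{j=0}^{n-1}p^jq^{n-1-j}$. T-type continued fraction with coefficients $(\alpha_n),(\delta_n)$: $1/(1-\delta_1t-\alpha_1t/(1-\delta_2t-\alpha_2t/(1-\delta_3t-\cdots)))$. -}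

module Defs where

open import Level using (Level)
open import Data.Bool using (Bool; true; false; if_then_else_; _∧_; _∨_; not)
open import Data.Nat as ℕ using (ℕ; zero; suc; _∸_; _<ᵇ_; _≡ᵇ_; ⌊_/2⌋)
open import Data.List as List using (List; []; _∷_; map; foldr; length; concatMap; upTo)
open import Algebra.Bundles using (CommutativeSemiring)

allB : (ℕ → Bool) → List ℕ → Bool
allB p = foldr (λ x r → p x ∧ r) true

sumℕ : List ℕ → ℕ
sumℕ = foldr ℕ._+_ 0

-- Permutations of [m] = {1,…,m} in one-line notation (lists of ℕ)

range : ℕ → List ℕ
range m = map suc (upTo m)

_≤ᵇ_ : ℕ → ℕ → Bool
a ≤ᵇ b = a <ᵇ suc b

isEven : ℕ → Bool
isEven zero          = true
isEven (suc zero)    = false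
isEven (suc (suc n)) = isEven n

countᵇ : (ℕ → Bool) → List ℕ → ℕ
countᵇ P xs = length (List.filterᵇ P xs)

words : ℕ → ℕ → List (List ℕ)
words m zero      = [] ∷ []
words m (suc len) = concatMap (λ a → map (a ∷_) (words m len)) (range m)

-- a word of length m over [m] is a permutation iff each j ∈ [m] occurs exactly once
isPerm : ℕ → List ℕ → Bool
isPerm m w = allB (λ j → countᵇ (j ≡ᵇ_) w ≡ᵇ 1) (range m)

perms : ℕ → List (List ℕ)
perms m = List.filterᵇ (isPerm m) (words m m)

-- σ(i) for 1 ≤ i ≤ length σ (junk 0 otherwise)
app : List ℕ → ℕ → ℕ
app []      _             = 0
app (x ∷ w) zero          = 0
app (x ∷ w) (suc zero)    = x
app (x ∷ w) (suc (suc i)) = app w (suc i)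

inv : List ℕ → ℕ → ℕ
inv w i = foldr (λ j r → if app w j ≡ᵇ i then j else r) 0 (range (length w))

isD : List ℕ → Bool
isD w = allB (λ i → if isEven i then app w i ≤ᵇ i else i ≤ᵇ app w i) (range (length w))

D : ℕ → List (List ℕ)
D n = List.filterᵇ isD (perms (2 ℕ.* n))

module Stats (σ : List ℕ) where
  m : ℕ
  m = length σ

  s : ℕ → ℕ
  s = app σ

  s⁻¹ : ℕ → ℕ
  s⁻¹ = inv σ

  [m] : List ℕ
  [m] = range m

  rec : ℕ → Bool
  rec i = allB (λ j → not (j <ᵇ i) ∨ (s j <ᵇ s i)) [m]

  arec : ℕ → Bool
  arec i = allB (λ j → not (i <ᵇ j) ∨ (s i <ᵇ s j)) [m]

  erec earec rar nr : ℕ → Bool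
  erec  i = rec i ∧ not (arec i)
  earec i = arec i ∧ not (rec i)
  rar   i = rec i ∧ arec i
  nr    i = not (rec i) ∧ not (arec i)

  cpeak cval cdrise cdfall fix : ℕ → Bool
  cpeak  i = (s⁻¹ i <ᵇ i) ∧ (s i <ᵇ i)
  cval   i = (i <ᵇ s⁻¹ i) ∧ (i <ᵇ s i)
  cdrise i = (s⁻¹ i <ᵇ i) ∧ (i <ᵇ s i)
  cdfall i = (i <ᵇ s⁻¹ i) ∧ (s i <ᵇ i)
  fix    i = s i ≡ᵇ i

  cnt : (ℕ → Bool) → ℕ
  cnt P = countᵇ P [m]

  sumOver : (ℕ → Bool) → (ℕ → ℕ) → ℕ
  sumOver P f = sumℕ (map f (List.filterᵇ P [m]))

  eareccpeak eareccdfall ereccval ereccdrise : ℕ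
  eareccpeak  = cnt (λ i → earec i ∧ cpeak i)
  eareccdfall = cnt (λ i → earec i ∧ cdfall i)
  ereccval    = cnt (λ i → erec i ∧ cval i)
  ereccdrise  = cnt (λ i → erec i ∧ cdrise i)

  nrcpeak nrcdfall nrcval nrcdrise : ℕ
  nrcpeak  = cnt (λ i → nr i ∧ cpeak i)
  nrcdfall = cnt (λ i → nr i ∧ cdfall i)
  nrcval   = cnt (λ i → nr i ∧ cval i)
  nrcdrise = cnt (λ i → nr i ∧ cdrise i)

  ereccpeak' nrcpeak' ereccdrise' nrcdrise' : ℕ
  ereccpeak'  = cnt (λ i → cpeak i ∧ rec (s⁻¹ i))
  nrcpeak'    = cnt (λ i → cpeak i ∧ not (rec (s⁻¹ i)))
  ereccdrise' = cnt (λ i → cdrise i ∧ rec (s⁻¹ i))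
  nrcdrise'   = cnt (λ i → cdrise i ∧ not (rec (s⁻¹ i)))

  eareccval' nrcval' eareccdfall' nrcdfall' : ℕ
  eareccval'   = cnt (λ i → cval i ∧ arec (s⁻¹ i))
  nrcval'      = cnt (λ i → cval i ∧ not (arec (s⁻¹ i)))
  eareccdfall' = cnt (λ i → cdfall i ∧ arec (s⁻¹ i))
  nrcdfall'    = cnt (λ i → cdfall i ∧ not (arec (s⁻¹ i)))

  evennrfix oddnrfix evenrar oddrar : ℕ
  evennrfix = cnt (λ i → fix i ∧ isEven i ∧ nr i)
  oddnrfix  = cnt (λ i → fix i ∧ not (isEven i) ∧ nr i)
  evenrar   = cnt (λ i → isEven i ∧ rar i)
  oddrar    = cnt (λ i → not (isEven i) ∧ rar i)

  -- crossings / nestings; each triple is determined by one free index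
  -- ucross(j) = #{(i,k,l) : i<j<k<l, k=σ(i), l=σ(j)}
  ucross : ℕ → ℕ
  ucross j = cnt (λ i → (i <ᵇ j) ∧ (j <ᵇ s i) ∧ (s i <ᵇ s j))
  -- unest(j) = #{(i,k,l) : i<j<k<l, k=σ(j), l=σ(i)}
  unest : ℕ → ℕ
  unest j = cnt (λ i → (i <ᵇ j) ∧ (j <ᵇ s j) ∧ (s j <ᵇ s i))
  -- lcross(k) = #{(i,j,l) : i<j<k<l, i=σ(k), j=σ(l)}
  lcross : ℕ → ℕ
  lcross k = cnt (λ l → (s k <ᵇ s l) ∧ (s l <ᵇ k) ∧ (k <ᵇ l))
  -- lnest(k) = #{(i,j,l) : i<j<k<l, i=σ(l), j=σ(k)}
  lnest : ℕ → ℕ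
  lnest k = cnt (λ l → (s l <ᵇ s k) ∧ (s k <ᵇ k) ∧ (k <ᵇ l))
  -- ucross'(k) = #{(i,j,l) : i<j<k<l, k=σ(i), l=σ(j)}   (i = σ⁻¹(k))
  ucross' : ℕ → ℕ
  ucross' k = cnt (λ j → (s⁻¹ k <ᵇ j) ∧ (j <ᵇ k) ∧ (k <ᵇ s j))
  -- unest'(k) = #{(i,j,l) : i<j<k<l, k=σ(j), l=σ(i)}   (j = σ⁻¹(k))
  unest' : ℕ → ℕ
  unest' k = cnt (λ i → (i <ᵇ s⁻¹ k) ∧ (s⁻¹ k <ᵇ k) ∧ (k <ᵇ s i))
  -- lcross'(j) = #{(i,k,l) : i<j<k<l, i=σ(k), j=σ(l)}   (l = σ⁻¹(j))
  lcross' : ℕ → ℕ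
  lcross' j = cnt (λ k → (s k <ᵇ j) ∧ (j <ᵇ k) ∧ (k <ᵇ s⁻¹ j))
  -- lnest'(j) = #{(i,k,l) : i<j<k<l, i=σ(l), j=σ(k)}    (k = σ⁻¹(j))
  lnest' : ℕ → ℕ
  lnest' j = cnt (λ l → (s l <ᵇ j) ∧ (j <ᵇ s⁻¹ j) ∧ (s⁻¹ j <ᵇ l))

  ucrosscval ucrosscdrise lcrosscpeak lcrosscdfall : ℕ
  ucrosscval   = sumOver cval ucross
  ucrosscdrise = sumOver cdrise ucross
  lcrosscpeak  = sumOver cpeak lcross
  lcrosscdfall = sumOver cdfall lcross

  unestcval unestcdrise lnestcpeak lnestcdfall : ℕ
  unestcval   = sumOver cval unest
  unestcdrise = sumOver cdrise unest
  lnestcpeak  = sumOver cpeak lnest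
  lnestcdfall = sumOver cdfall lnest

  ucrosscpeak' unestcpeak' ucrosscdrise' unestcdrise' : ℕ
  ucrosscpeak'  = sumOver cpeak ucross'
  unestcpeak'   = sumOver cpeak unest'
  ucrosscdrise' = sumOver cdrise ucross'
  unestcdrise'  = sumOver cdrise unest'

  lcrosscval' lnestcval' lcrosscdfall' lnestcdfall' : ℕ
  lcrosscval'   = sumOver cval lcross'
  lnestcval'    = sumOver cval lnest'
  lcrosscdfall' = sumOver cdfall lcross'
  lnestcdfall'  = sumOver cdfall lnest'

  psnest : ℕ → ℕ
  psnest j = cnt (λ i → (i <ᵇ j) ∧ (j <ᵇ s i))

  epsnest opsnest : ℕ
  epsnest = sumOver (λ j → fix j ∧ isEven j) psnest
  opsnest = sumOver (λ j → fix j ∧ not (isEven j)) psnest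

-- Polynomial identities are stated by evaluation in an arbitrary
-- commutative semiring (equivalent to identity in ℕ[variables]).

record Vars {c ℓ : Level} (R : CommutativeSemiring c ℓ) : Set c where
  open CommutativeSemiring R
  field
    x₁ x₂ y₁ y₂ u₁ u₂ v₁ v₂ wₑ wₒ zₑ zₒ : Carrier
    p₋₁ p₋₂ p₊₁ p₊₂ q₋₁ q₋₂ q₊₁ q₊₂ sₑ sₒ : Carrier

module Poly {c ℓ : Level} (R : CommutativeSemiring c ℓ) where
  open CommutativeSemiring R

  infixr 8 _^_
  _^_ : Carrier → ℕ → Carrier
  a ^ zero  = 1#
  a ^ suc n = a * (a ^ n)

  Σ : List Carrier → Carrier
  Σ = foldr _+_ 0#

  Π : List Carrier → Carrier
  Π = foldr _*_ 1#

  qint : Carrier → Carrier → ℕ → Carrier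
  qint p q n = Σ (map (λ j → (p ^ j) * (q ^ (n ∸ 1 ∸ j))) (upTo n))

  module _ (V : Vars R) where
    open Vars V

    weight' : List ℕ → Carrier
    weight' σ = Π
      ( x₁ ^ ereccpeak' ∷ x₂ ^ eareccdfall' ∷ y₁ ^ eareccval' ∷ y₂ ^ ereccdrise'
      ∷ u₁ ^ nrcpeak' ∷ u₂ ^ nrcdfall' ∷ v₁ ^ nrcval' ∷ v₂ ^ nrcdrise'
      ∷ wₑ ^ evennrfix ∷ wₒ ^ oddnrfix ∷ zₑ ^ evenrar ∷ zₒ ^ oddrar
      ∷ p₋₁ ^ ucrosscpeak' ∷ p₋₂ ^ lcrosscdfall' ∷ p₊₁ ^ lcrosscval' ∷ p₊₂ ^ ucrosscdrise'
      ∷ q₋₁ ^ unestcpeak' ∷ q₋₂ ^ lnestcdfall' ∷ q₊₁ ^ lnestcval' ∷ q₊₂ ^ unestcdrise'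
      ∷ sₑ ^ epsnest ∷ sₒ ^ opsnest ∷ [] )
      where open Stats σ

    weight : List ℕ → Carrier
    weight σ = Π
      ( x₁ ^ eareccpeak ∷ x₂ ^ eareccdfall ∷ y₁ ^ ereccval ∷ y₂ ^ ereccdrise
      ∷ u₁ ^ nrcpeak ∷ u₂ ^ nrcdfall ∷ v₁ ^ nrcval ∷ v₂ ^ nrcdrise
      ∷ wₑ ^ evennrfix ∷ wₒ ^ oddnrfix ∷ zₑ ^ evenrar ∷ zₒ ^ oddrar
      ∷ p₋₁ ^ lcrosscpeak ∷ p₋₂ ^ lcrosscdfall ∷ p₊₁ ^ ucrosscval ∷ p₊₂ ^ ucrosscdrise
      ∷ q₋₁ ^ lnestcpeak ∷ q₋₂ ^ lnestcdfall ∷ q₊₁ ^ unestcval ∷ q₊₂ ^ unestcdrise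
      ∷ sₑ ^ epsnest ∷ sₒ ^ opsnest ∷ [] )
      where open Stats σ

    P' : ℕ → Carrier
    P' n = Σ (map weight' (D n))

    P : ℕ → Carrier
    P n = Σ (map weight (D n))

    αodd : ℕ → Carrier
    αodd k = ((p₋₁ ^ (k ∸ 1)) * x₁ + q₋₁ * qint p₋₁ q₋₁ (k ∸ 1) * u₁)
           * ((p₊₁ ^ (k ∸ 1)) * y₁ + q₊₁ * qint p₊₁ q₊₁ (k ∸ 1) * v₁)

    αeven : ℕ → Carrier
    αeven k = ((p₋₂ ^ (k ∸ 1)) * x₂ + q₋₂ * qint p₋₂ q₋₂ (k ∸ 1) * u₂ + (sₑ ^ k) * wₑ)
            * ((p₊₂ ^ (k ∸ 1)) * y₂ + q₊₂ * qint p₊₂ q₊₂ (k ∸ 1) * v₂ + (sₒ ^ k) * wₒ)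

    -- α_j for j ≥ 1 (α₀ is unused)
    α : ℕ → Carrier
    α j = if isEven j then αeven ⌊ j /2⌋ else αodd ⌊ suc j /2⌋

    δ : ℕ → Carrier
    δ 1 = zₑ * zₒ
    δ _ = 0#

  -- Coefficients of the T-type continued fraction as a formal power series.
  -- F_k = 1 / (1 - δ_k t - α_k t F_{k+1}), equivalently
  -- F_k = 1 + t (δ_k + α_k F_{k+1}) F_k, giving
  -- [t^0] F_k = 1,  [t^{m+1}] F_k = δ_k [t^m]F_k + α_k Σ_{i=0}^m [t^i]F_{k+1} [t^{m-i}]F_k.
  -- cfAux n k j = [t^j] F_k, valid for j ≤ n.
  cfAux : (ℕ → Carrier) → (ℕ → Carrier) → ℕ → ℕ → ℕ → Carrier
  cfAux α δ n       k zero    = 1#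
  cfAux α δ zero    k (suc j) = 0#
  cfAux α δ (suc n) k (suc j) =
    δ k * cfAux α δ n k j
    + α k * Σ (map (λ i → cfAux α δ n (suc k) i * cfAux α δ n k (j ∸ i)) (upTo (suc j)))

  Tfrac : (ℕ → Carrier) → (ℕ → Carrier) → ℕ → Carrier
  Tfrac α δ n = cfAux α δ n 1 n

{-# OPTIONS --safe #-}
-- Call a position i of a permutation π of class D if π(i) ≤ i and of class U if π(i) ≥ i, the
-- class of a fixed point being prescribed, and give the value π(i) the class of i. Once the
-- classes of all positions and values are fixed, π is a pair of independent matchings. Reading
-- the D-part from left to right and choosing π(i) among the open D-values, the numbers of
-- crossings and nestings at i count the open values on either side of the chosen one, so the
-- choices at i contribute a factor that depends only on the number h of open values; the U-part
-- is read from right to left and has the same heights. Hence the weighted sum over π is the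
-- weight of a path. For P take π = σ, where the classes of the positions are given by parity
-- and those of the values are free. For P' take π = σ⁻¹, where it is the classes of the values
-- that are given by parity, and the variables of double rises and double falls change places.
-- Both sums run over the same Dyck paths, whose height generating functions satisfy the
-- recurrence of the T-fraction by first-passage decomposition.
module Submission where

open import Defs
open import Level using (Level)
open import Data.Nat using (ℕ)
open import Data.Product using (_×_)
open import Algebra.Bundles using (CommutativeSemiring)
import Algebra.Properties.CommutativeSemigroup
open import Data.Bool using (Bool; true; false; if_then_else_; _∧_; _∨_; not; T)
open import Data.Bool.Properties using (T-≡; ¬-not; ∧-zeroʳ; ∧-identityʳ)
open import Data.Empty using (⊥-elim)
open import Data.List as List using (List; []; _∷_; _++_; map; concatMap; foldr; length; upTo; applyUpTo)
open import Data.List.Properties using (map-upTo; map-∘; length-map; length-upTo; ≡-dec)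
open import Data.List.Relation.Unary.All using (All; []; _∷_)
open import Data.Maybe using (Maybe; just; nothing)
open import Data.Nat as ℕ using (zero; suc; pred; _≤_; _<_; z≤n; s≤s; _∸_; _<ᵇ_; _≡ᵇ_; ⌊_/2⌋)
import Data.Nat.Properties as ℕₚ
open import Data.Nat.Solver using (module +-*-Solver)
open import Data.Product using (_,_; proj₁; proj₂; ∃-syntax)
open import Data.Sum using (_⊎_; inj₁; inj₂)
open import Function using (_∘_; flip; Equivalence)
open import Relation.Binary.Definitions using (tri<; tri≈; tri>)
open import Relation.Binary.PropositionalEquality as ≡ using (_≡_; _≢_; cong; cong₂; subst)
import Relation.Binary.Reasoning.Setoid
open import Relation.Nullary using (yes; no; does)
open import Relation.Nullary.Decidable using (dec-true; dec-false)


-- The obstacle is that the two matchings are read in opposite directions, while a word is read in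
-- one. The open D-values are passed along as an accumulator; the open U-values at `k` are a
-- function of the tail of the word. At a U-position the tail is therefore fixed before the letter
-- is summed, and the letter ranges over a set that depends on the tail. The size of this set does
-- not: an initial segment contains as many positions as values, so equally many D-arcs and U-arcs
-- cross from k to k+1. This equality holds for admissible tails only, hence it is used as a factor
-- next to a weight that vanishes on all others. The free classes are summed over all bit strings. A
-- permutation of the required parity type fits exactly one of them: a position and its value share
-- a class, so parity on one side determines the other, also at fixed points. The continued fraction
-- is handled through its recurrence, as nothing can be subtracted or inverted in a semiring.

dbl : ℕ → ℕ
dbl zero    = zero
dbl (suc h) = suc (suc (dbl h))

-- Finite sums and convolutions in a commutative semiring.

module Sums {c ℓ} (R : CommutativeSemiring c ℓ) where
  open CommutativeSemiring R hiding (zero)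
  open Poly R using (Σ; cfAux; Tfrac)
  open Relation.Binary.Reasoning.Setoid setoid
  private
    module +S = Algebra.Properties.CommutativeSemigroup +-commutativeSemigroup
    module *S = Algebra.Properties.CommutativeSemigroup *-commutativeSemigroup

  private variable
    A B : Set

  ∑ : List A → (A → Carrier) → Carrier
  ∑ xs f = Σ (map f xs)

  infixr 7 [_]·_
  [_]·_ : Bool → Carrier → Carrier
  [ b ]· x = if b then x else 0#

  ∑-cong : (xs : List A) {f g : A → Carrier} → (∀ x → f x ≈ g x) → ∑ xs f ≈ ∑ xs g
  ∑-cong []       e = refl
  ∑-cong (x ∷ xs) e = +-cong (e x) (∑-cong xs e)

  ∑-zero : (xs : List A) {f : A → Carrier} → (∀ x → f x ≈ 0#) → ∑ xs f ≈ 0#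
  ∑-zero []       e = refl
  ∑-zero (x ∷ xs) e = trans (+-cong (e x) (∑-zero xs e)) (+-identityʳ 0#)

  ∑-+ : (xs : List A) (f g : A → Carrier) → ∑ xs (λ x → f x + g x) ≈ ∑ xs f + ∑ xs g
  ∑-+ []       f g = sym (+-identityʳ 0#)
  ∑-+ (x ∷ xs) f g = trans (+-congˡ (∑-+ xs f g)) (+S.interchange (f x) (g x) _ _)

  ∑-*ˡ : (xs : List A) (a : Carrier) (f : A → Carrier) → a * ∑ xs f ≈ ∑ xs (λ x → a * f x)
  ∑-*ˡ []       a f = zeroʳ a
  ∑-*ˡ (x ∷ xs) a f = trans (distribˡ a _ _) (+-congˡ (∑-*ˡ xs a f))

  ∑-*ʳ : (xs : List A) (a : Carrier) (f : A → Carrier) → ∑ xs f * a ≈ ∑ xs (λ x → f x * a)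
  ∑-*ʳ []       a f = zeroˡ a
  ∑-*ʳ (x ∷ xs) a f = trans (distribʳ a _ _) (+-congˡ (∑-*ʳ xs a f))

  ∑-++ : (xs ys : List A) (f : A → Carrier) → ∑ (xs ++ ys) f ≈ ∑ xs f + ∑ ys f
  ∑-++ []       ys f = sym (+-identityˡ _)
  ∑-++ (x ∷ xs) ys f = trans (+-congˡ (∑-++ xs ys f)) (sym (+-assoc _ _ _))

  ∑-map : (g : B → A) (xs : List B) (f : A → Carrier) → ∑ (map g xs) f ≈ ∑ xs (f ∘ g)
  ∑-map g xs f = reflexive (≡.cong Σ (≡.sym (map-∘ xs)))

  ∑-concatMap : (g : B → List A) (xs : List B) (f : A → Carrier) →
    ∑ (concatMap g xs) f ≈ ∑ xs (λ x → ∑ (g x) f)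
  ∑-concatMap g []       f = refl
  ∑-concatMap g (x ∷ xs) f = trans (∑-++ (g x) (concatMap g xs) f) (+-congˡ (∑-concatMap g xs f))

  ∑-swap : (xs : List A) (ys : List B) (f : A → B → Carrier) →
    ∑ xs (λ x → ∑ ys (f x)) ≈ ∑ ys (λ y → ∑ xs (λ x → f x y))
  ∑-swap []       ys f = sym (∑-zero ys (λ _ → refl))
  ∑-swap (x ∷ xs) ys f = trans (+-congˡ (∑-swap xs ys f)) (sym (∑-+ ys (f x) _))

  ∑-filter : (p : A → Bool) (xs : List A) (f : A → Carrier) →
    ∑ (List.filterᵇ p xs) f ≈ ∑ xs (λ x → [ p x ]· f x)
  ∑-filter p []       f = refl
  ∑-filter p (x ∷ xs) f with p x
  ... | true  = +-congˡ (∑-filter p xs f)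
  ... | false = trans (∑-filter p xs f) (sym (+-identityˡ _))

  ∑-words : (m len : ℕ) (f : List ℕ → Carrier) →
    ∑ (words m (suc len)) f ≈ ∑ (range m) (λ a → ∑ (words m len) (λ w → f (a ∷ w)))
  ∑-words m len f = trans (∑-concatMap (λ a → map (a ∷_) (words m len)) (range m) f)
    (∑-cong (range m) (λ a → ∑-map (a ∷_) (words m len) f))

  -- The Cauchy product of power series, in a form free of truncated subtraction, so that its laws
  -- follow by induction on the index.
  conv : (ℕ → Carrier) → (ℕ → Carrier) → ℕ → Carrier
  conv f g zero    = f 0 * g 0
  conv f g (suc n) = f 0 * g (suc n) + conv (f ∘ suc) g n

  -- Multiplication of a power series by `t`.
  shift : (ℕ → Carrier) → ℕ → Carrier
  shift f zero    = 0#
  shift f (suc n) = f n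

  conv-cong : ∀ {f f′ g g′} n → (∀ i → i ≤ n → f i ≈ f′ i) → (∀ i → i ≤ n → g i ≈ g′ i) →
    conv f g n ≈ conv f′ g′ n
  conv-cong zero    ef eg = *-cong (ef 0 z≤n) (eg 0 z≤n)
  conv-cong (suc n) ef eg = +-cong (*-cong (ef 0 z≤n) (eg (suc n) ℕₚ.≤-refl))
    (conv-cong n (λ i i≤n → ef (suc i) (s≤s i≤n)) (λ i i≤n → eg i (ℕₚ.m≤n⇒m≤1+n i≤n)))

  conv-+ˡ : ∀ f f′ g n → conv (λ i → f i + f′ i) g n ≈ conv f g n + conv f′ g n
  conv-+ˡ f f′ g zero    = distribʳ _ _ _
  conv-+ˡ f f′ g (suc n) = trans (+-cong (distribʳ _ _ _) (conv-+ˡ (f ∘ suc) (f′ ∘ suc) g n))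
    (+S.interchange _ _ _ _)

  conv-*ˡ : ∀ a f g n → conv (λ i → a * f i) g n ≈ a * conv f g n
  conv-*ˡ a f g zero    = *-assoc _ _ _
  conv-*ˡ a f g (suc n) = trans (+-cong (*-assoc _ _ _) (conv-*ˡ a (f ∘ suc) g n)) (sym (distribˡ _ _ _))

  conv-*ʳ : ∀ a f g n → conv f (λ i → a * g i) n ≈ a * conv f g n
  conv-*ʳ a f g zero    = *S.x∙yz≈y∙xz _ _ _
  conv-*ʳ a f g (suc n) = trans (+-cong (*S.x∙yz≈y∙xz _ _ _) (conv-*ʳ a (f ∘ suc) g n)) (sym (distribˡ _ _ _))

  conv-shift : ∀ f g n → conv f (shift g) n ≈ shift (conv f g) n
  conv-shift f g zero          = zeroʳ _
  conv-shift f g (suc zero)    = trans (+-congˡ (zeroʳ _)) (+-identityʳ _)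
  conv-shift f g (suc (suc n)) = +-congˡ (conv-shift (f ∘ suc) g (suc n))

  conv-assoc : ∀ f g h n → conv (conv f g) h n ≈ conv f (conv g h) n
  conv-assoc f g h zero    = *-assoc _ _ _
  conv-assoc f g h (suc n) = begin
    (f 0 * g 0) * h (suc n) + conv (λ i → f 0 * g (suc i) + conv (f ∘ suc) g i) h n
      ≈⟨ +-cong (*-assoc _ _ _) (trans (conv-+ˡ _ _ h n)
           (+-cong (conv-*ˡ (f 0) (g ∘ suc) h n) (conv-assoc (f ∘ suc) g h n))) ⟩
    f 0 * (g 0 * h (suc n)) + (f 0 * conv (g ∘ suc) h n + conv (f ∘ suc) (conv g h) n)
      ≈⟨ sym (+-assoc _ _ _) ⟩
    f 0 * (g 0 * h (suc n)) + f 0 * conv (g ∘ suc) h n + conv (f ∘ suc) (conv g h) n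
      ≈⟨ +-congʳ (sym (distribˡ _ _ _)) ⟩
    f 0 * conv g h (suc n) + conv (f ∘ suc) (conv g h) n ∎

  Σ-conv : ∀ f g j → Σ (map (λ i → f i * g (j ∸ i)) (upTo (suc j))) ≈ conv f g j
  Σ-conv f g j = trans (reflexive (≡.cong Σ (map-upTo _ (suc j)))) (go f j)
    where
    go : ∀ f j → Σ (applyUpTo (λ i → f i * g (j ∸ i)) (suc j)) ≈ conv f g j
    go f zero    = +-identityʳ _
    go f (suc j) = +-congˡ (go (f ∘ suc) j)

  -- T-fractions and Dyck paths.

  module Continued (α δ : ℕ → Carrier) where

    -- The fuel equals the index, so that `coeff 1 n` is `Tfrac α δ n` by definition.
    coeff : ℕ → ℕ → Carrier
    coeff k j = cfAux α δ j k j

    -- Each unfolding spends one unit of fuel and lowers the index by at least one, so every fuel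
    -- not below the index gives the same coefficient.
    cfAux-stable : ∀ n n′ k j → j ≤ n → j ≤ n′ → cfAux α δ n k j ≈ cfAux α δ n′ k j
    cfAux-stable n       n′       k zero    _         _          = refl
    cfAux-stable (suc n) (suc n′) k (suc j) (s≤s j≤n) (s≤s j≤n′) =
      +-cong (*-congˡ (cfAux-stable n n′ k j j≤n j≤n′))
             (*-congˡ (trans (Σ-conv (cfAux α δ n (suc k)) (cfAux α δ n k) j)
               (trans (conv-cong j
                        (λ i i≤j → cfAux-stable n n′ (suc k) i (ℕₚ.≤-trans i≤j j≤n) (ℕₚ.≤-trans i≤j j≤n′))
                        (λ i i≤j → cfAux-stable n n′ k i (ℕₚ.≤-trans i≤j j≤n) (ℕₚ.≤-trans i≤j j≤n′)))
                      (sym (Σ-conv (cfAux α δ n′ (suc k)) (cfAux α δ n′ k) j)))))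

    coeff-suc : ∀ k j → coeff k (suc j) ≈ δ k * coeff k j + α k * conv (coeff (suc k)) (coeff k) j
    coeff-suc k j = +-congˡ (*-congˡ (trans (Σ-conv (cfAux α δ j (suc k)) (cfAux α δ j k) j)
      (conv-cong j (λ i i≤j → cfAux-stable j i (suc k) i i≤j ℕₚ.≤-refl)
                   (λ i i≤j → cfAux-stable j i k i i≤j ℕₚ.≤-refl))))

    -- This is `F_k = 1 + α_k t F_{k+1} F_k` multiplied by `X`: an excursion is empty, or it
    -- consists of an up step, an excursion one level higher, the matching down step and a further
    -- excursion.
    conv-coeff : ∀ k X → δ k ≈ 0# → ∀ n →
      conv (coeff k) X n ≈ X n + α k * shift (conv (coeff (suc k)) (conv (coeff k) X)) n
    conv-coeff k X δ≈0 zero    = trans (*-identityˡ _) (sym (trans (+-congˡ (zeroʳ _)) (+-identityʳ _)))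
    conv-coeff k X δ≈0 (suc n) = +-cong (*-identityˡ _) (begin
      conv (coeff k ∘ suc) X n
        ≈⟨ conv-cong n (λ i _ → trans (coeff-suc k i)
             (trans (+-congʳ (trans (*-congʳ δ≈0) (zeroˡ _))) (+-identityˡ _))) (λ _ _ → refl) ⟩
      conv (λ i → α k * conv (coeff (suc k)) (coeff k) i) X n
        ≈⟨ conv-*ˡ (α k) _ X n ⟩
      α k * conv (conv (coeff (suc k)) (coeff k)) X n
        ≈⟨ *-congˡ (conv-assoc _ _ X n) ⟩
      α k * conv (coeff (suc k)) (conv (coeff k) X) n ∎)

  module Walks (a b c d : ℕ → Carrier) where

    -- An even height h is level 2h of a Dyck path, an odd height h is level 2h + 1;
    -- c 0 * d 0 is the weight of a double level step at the ground.
    evenWalk oddWalk : ℕ → ℕ → Carrier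
    evenWalk zero    zero    = 1#
    evenWalk zero    (suc h) = 0#
    evenWalk (suc n) zero    = b 1 * oddWalk n 0 + c 0 * (d 0 * evenWalk n 0)
    evenWalk (suc n) (suc h) = b (suc (suc h)) * oddWalk n (suc h) + c (suc h) * oddWalk n h
    oddWalk n h = a (suc h) * evenWalk n h + d (suc h) * evenWalk n (suc h)

    module _ (α δ : ℕ → Carrier)
      (α-odd  : ∀ h → α (suc (dbl h)) ≈ a (suc h) * b (suc h))
      (α-even : ∀ h → α (dbl (suc h)) ≈ d (suc h) * c (suc h))
      (δ-1    : δ 1 ≈ d 0 * c 0)
      (δ-2+   : ∀ n → δ (suc (suc n)) ≈ 0#)
      where
      open Continued α δ

      -- First-passage decomposition: a path from a level to the ground is an excursion
      -- above that level, a down step, and a path from the level below.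
      evenGF oddGF : ℕ → ℕ → Carrier
      evenGF zero    = coeff 1
      evenGF (suc h) = λ n → c (suc h) * shift (conv (coeff (suc (dbl (suc h)))) (oddGF h)) n
      oddGF h n = a (suc h) * conv (coeff (dbl (suc h))) (evenGF h) n

      -- If the excursion is empty, the path goes down at once with weight `a (suc h)`. Otherwise
      -- `α (dbl (suc h))` splits into the up step `d (suc h)` and the matching down step
      -- `c (suc h)`; the latter belongs to `evenGF (suc h)`.
      oddGF-step : ∀ n h → oddGF h n ≈ a (suc h) * evenGF h n + d (suc h) * evenGF (suc h) n
      oddGF-step n h = begin
        a′ * conv (coeff (dbl (suc h))) (evenGF h) n
          ≈⟨ *-congˡ (conv-coeff (dbl (suc h)) (evenGF h) (δ-2+ _) n) ⟩
        a′ * (evenGF h n + α (dbl (suc h)) * shift X n)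
          ≈⟨ distribˡ _ _ _ ⟩
        a′ * evenGF h n + a′ * (α (dbl (suc h)) * shift X n)
          ≈⟨ +-congˡ (*-congˡ (trans (*-congʳ (α-even h)) (*-assoc _ _ _))) ⟩
        a′ * evenGF h n + a′ * (d′ * (c′ * shift X n))
          ≈⟨ +-congˡ (trans (*S.x∙yz≈y∙xz _ _ _) (*-congˡ (*S.x∙yz≈y∙xz _ _ _))) ⟩
        a′ * evenGF h n + d′ * (c′ * (a′ * shift X n))
          ≈⟨ +-congˡ (*-congˡ (*-congˡ (shift-scale n))) ⟩
        a′ * evenGF h n + d′ * (c′ * shift (conv (coeff (suc (dbl (suc h)))) (oddGF h)) n) ∎
        where
        a′ = a (suc h)
        c′ = c (suc h)
        d′ = d (suc h)
        X = conv (coeff (suc (dbl (suc h)))) (conv (coeff (dbl (suc h))) (evenGF h))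
        shift-scale : ∀ n → a′ * shift X n ≈ shift (conv (coeff (suc (dbl (suc h)))) (oddGF h)) n
        shift-scale zero    = zeroʳ _
        shift-scale (suc n) = sym (conv-*ʳ a′ _ _ n)

      -- The same expansion at an even level, with the roles of `d` and `c` taken by `b` and `a`.
      -- The power of `t` is spent on leaving an even level, which is why the index drops here and
      -- stays in `oddGF-step`.
      evenGF-step : ∀ n h → evenGF (suc h) (suc n) ≈ b (suc (suc h)) * oddGF (suc h) n + c (suc h) * oddGF h n
      evenGF-step n h = begin
        c′ * conv (coeff k) X n
          ≈⟨ *-congˡ (conv-coeff k X (δ-2+ _) n) ⟩
        c′ * (X n + α k * shift (conv (coeff (suc k)) (conv (coeff k) X)) n)
          ≈⟨ trans (distribˡ _ _ _) (+-comm _ _) ⟩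
        c′ * (α k * shift (conv (coeff (suc k)) (conv (coeff k) X)) n) + c′ * X n
          ≈⟨ +-congʳ (*-congˡ (*-cong (trans (α-odd (suc h)) (*-comm _ _)) (sym (conv-shift _ _ n)))) ⟩
        c′ * (b′ * a′ * conv (coeff (suc k)) (shift (conv (coeff k) X)) n) + c′ * X n
          ≈⟨ +-congʳ (trans (*-congˡ (*-assoc _ _ _)) (trans (*S.x∙yz≈y∙xz _ _ _) (*-congˡ (*S.x∙yz≈y∙xz _ _ _)))) ⟩
        b′ * (a′ * (c′ * conv (coeff (suc k)) (shift (conv (coeff k) X)) n)) + c′ * X n
          ≈⟨ +-congʳ (*-congˡ (*-congˡ (sym (conv-*ʳ c′ _ _ n)))) ⟩
        b′ * oddGF (suc h) n + c′ * X n ∎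
        where
        a′ = a (suc (suc h))
        b′ = b (suc (suc h))
        c′ = c (suc h)
        k = suc (dbl (suc h))
        X = oddGF h

      evenGF-ground : ∀ n → evenGF 0 (suc n) ≈ b 1 * oddGF 0 n + c 0 * (d 0 * evenGF 0 n)
      evenGF-ground n = begin
        coeff 1 (suc n)
          ≈⟨ coeff-suc 1 n ⟩
        δ 1 * coeff 1 n + α 1 * conv (coeff 2) (coeff 1) n
          ≈⟨ +-comm _ _ ⟩
        α 1 * conv (coeff 2) (coeff 1) n + δ 1 * coeff 1 n
          ≈⟨ +-cong (trans (*-congʳ (trans (α-odd 0) (*-comm _ _))) (*-assoc _ _ _))
                    (trans (*-congʳ (trans δ-1 (*-comm _ _))) (*-assoc _ _ _)) ⟩
        b 1 * oddGF 0 n + c 0 * (d 0 * evenGF 0 n) ∎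

      evenWalk≈GF : ∀ n h → evenWalk n h ≈ evenGF h n
      oddWalk≈GF  : ∀ n h → oddWalk n h ≈ oddGF h n
      evenWalk≈GF zero    zero    = refl
      evenWalk≈GF zero    (suc h) = sym (zeroʳ _)
      evenWalk≈GF (suc n) zero    = trans (+-cong (*-congˡ (oddWalk≈GF n 0)) (*-congˡ (*-congˡ (evenWalk≈GF n 0))))
        (sym (evenGF-ground n))
      evenWalk≈GF (suc n) (suc h) = trans (+-cong (*-congˡ (oddWalk≈GF n (suc h))) (*-congˡ (oddWalk≈GF n h)))
        (sym (evenGF-step n h))
      oddWalk≈GF n h = trans (+-cong (*-congˡ (evenWalk≈GF n h)) (*-congˡ (evenWalk≈GF n (suc h))))
        (sym (oddGF-step n h))

      evenWalk≈Tfrac : ∀ n → evenWalk n 0 ≈ Tfrac α δ n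
      evenWalk≈Tfrac n = evenWalk≈GF n 0

-- Boolean tests, intervals and cardinalities of finite sets.

module Counting where
  open ≡ using (refl; sym; trans; module ≡-Reasoning)
  open import Data.Nat using (_+_)

  T⇒true : ∀ {b} → T b → b ≡ true
  T⇒true = Equivalence.to T-≡

  true⇒T : ∀ {b} → b ≡ true → T b
  true⇒T = Equivalence.from T-≡

  true≢false : ∀ {b a} {A : Set a} → b ≡ true → b ≡ false → A
  true≢false refl ()

  bool-ext : ∀ {b c} → (b ≡ true → c ≡ true) → (c ≡ true → b ≡ true) → b ≡ c
  bool-ext {true}  {c}     f g = sym (f refl)
  bool-ext {false} {true}  f g = g refl
  bool-ext {false} {false} f g = refl

  ∧-true : ∀ {b c} → b ∧ c ≡ true → b ≡ true × c ≡ true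
  ∧-true {true} {true} _ = refl , refl

  ∧-intro : ∀ {b c} → b ≡ true → c ≡ true → b ∧ c ≡ true
  ∧-intro refl refl = refl

  not-true : ∀ {b} → not b ≡ true → b ≡ false
  not-true {false} _ = refl

  <ᵇ-true : ∀ {a b} → a < b → (a <ᵇ b) ≡ true
  <ᵇ-true = T⇒true ∘ ℕₚ.<⇒<ᵇ

  <ᵇ-true⁻¹ : ∀ {a b} → (a <ᵇ b) ≡ true → a < b
  <ᵇ-true⁻¹ {a} {b} = ℕₚ.<ᵇ⇒< a b ∘ true⇒T

  <ᵇ-false : ∀ {a b} → b ≤ a → (a <ᵇ b) ≡ false
  <ᵇ-false b≤a = ¬-not (λ e → ℕₚ.<⇒≱ (<ᵇ-true⁻¹ e) b≤a)

  <ᵇ-false⁻¹ : ∀ {a b} → (a <ᵇ b) ≡ false → b ≤ a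
  <ᵇ-false⁻¹ e = ℕₚ.≮⇒≥ (λ a<b → true≢false (<ᵇ-true a<b) e)

  ≤ᵇ-true : ∀ {a b} → a ≤ b → (a ≤ᵇ b) ≡ true
  ≤ᵇ-true a≤b = <ᵇ-true (s≤s a≤b)

  ≤ᵇ-true⁻¹ : ∀ {a b} → (a ≤ᵇ b) ≡ true → a ≤ b
  ≤ᵇ-true⁻¹ e = ℕₚ.≤-pred (<ᵇ-true⁻¹ e)

  ≡ᵇ-true : ∀ {a b} → a ≡ b → (a ≡ᵇ b) ≡ true
  ≡ᵇ-true {a} {b} = T⇒true ∘ ℕₚ.≡⇒≡ᵇ a b

  ≡ᵇ-true⁻¹ : ∀ {a b} → (a ≡ᵇ b) ≡ true → a ≡ b
  ≡ᵇ-true⁻¹ {a} {b} = ℕₚ.≡ᵇ⇒≡ a b ∘ true⇒T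

  ≡ᵇ-false : ∀ {a b} → a ≢ b → (a ≡ᵇ b) ≡ false
  ≡ᵇ-false a≢b = ¬-not (a≢b ∘ ≡ᵇ-true⁻¹)

  ≡ᵇ-false⁻¹ : ∀ {a b} → (a ≡ᵇ b) ≡ false → a ≢ b
  ≡ᵇ-false⁻¹ e a≡b = true≢false (≡ᵇ-true a≡b) e

  bool-cases : ∀ b → b ≡ true ⊎ b ≡ false
  bool-cases true  = inj₁ refl
  bool-cases false = inj₂ refl

  b2n : Bool → ℕ
  b2n b = if b then 1 else 0

  count-∷ : ∀ P x xs → countᵇ P (x ∷ xs) ≡ b2n (P x) + countᵇ P xs
  count-∷ P x xs with P x
  ... | true  = refl
  ... | false = refl

  count-head : ∀ P {b} x xs → P x ≡ b → countᵇ P (x ∷ xs) ≡ b2n b + countᵇ P xs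
  count-head P x xs e = trans (count-∷ P x xs) (cong (λ b → b2n b + countᵇ P xs) e)

  -- A form of `range` with a movable left end, which allows induction in the order in which words
  -- are read.
  interval : ℕ → ℕ → List ℕ
  interval k zero      = []
  interval k (suc len) = k ∷ interval (suc k) len

  range≡interval : ∀ m → range m ≡ interval 1 m
  range≡interval m = trans (map-upTo suc m) (go suc 1 m (λ _ → refl))
    where
    go : ∀ f k len → (∀ i → f i ≡ k + i) → applyUpTo f len ≡ interval k len
    go f k zero      e = refl
    go f k (suc len) e = cong₂ _∷_ (trans (e 0) (ℕₚ.+-identityʳ k))
      (go (f ∘ suc) (suc k) len (λ i → trans (e (suc i)) (ℕₚ.+-suc k i)))

  Pred : Set
  Pred = ℕ → Bool

  InRange : ℕ → ℕ → Set
  InRange m v = 1 ≤ v × v ≤ m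

  count-interval-cong : ∀ {P Q : Pred} k len → (∀ v → k ≤ v → v < k + len → P v ≡ Q v) →
    countᵇ P (interval k len) ≡ countᵇ Q (interval k len)
  count-interval-cong         k zero      e = refl
  count-interval-cong {P} {Q} k (suc len) e = begin
    countᵇ P (k ∷ interval (suc k) len)           ≡⟨ count-∷ P k _ ⟩
    b2n (P k) + countᵇ P (interval (suc k) len)   ≡⟨ cong₂ (λ b n → b2n b + n)
      (e k ℕₚ.≤-refl (ℕₚ.m<m+n k (s≤s z≤n)))
      (count-interval-cong (suc k) len (λ v k<v v< → e v (ℕₚ.<⇒≤ k<v) (subst (v <_) (sym (ℕₚ.+-suc k len)) v<))) ⟩
    b2n (Q k) + countᵇ Q (interval (suc k) len)   ≡⟨ count-∷ Q k _ ⟨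
    countᵇ Q (k ∷ interval (suc k) len)           ∎
    where open ≡-Reasoning

  count-interval-≡ : ∀ v k len → k ≤ v → v < k + len → countᵇ (_≡ᵇ v) (interval k len) ≡ 1
  count-interval-≢ : ∀ v k len → v < k → countᵇ (_≡ᵇ v) (interval k len) ≡ 0
  count-interval-≢ v k zero      v<k = refl
  count-interval-≢ v k (suc len) v<k = trans (count-∷ (_≡ᵇ v) k _)
    (cong₂ (λ b n → b2n b + n) (≡ᵇ-false (ℕₚ.>⇒≢ v<k)) (count-interval-≢ v (suc k) len (ℕₚ.m<n⇒m<1+n v<k)))
  count-interval-≡ v k zero      k≤v v< = ⊥-elim (ℕₚ.<⇒≱ v< (subst (_≤ v) (sym (ℕₚ.+-identityʳ k)) k≤v))
  count-interval-≡ v k (suc len) k≤v v< with k ℕ.≟ v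
  ... | yes refl = trans (count-∷ (_≡ᵇ v) k _)
    (cong₂ (λ b n → b2n b + n) (≡ᵇ-true {v} refl) (count-interval-≢ v (suc k) len ℕₚ.≤-refl))
  ... | no k≢v = trans (count-∷ (_≡ᵇ v) k _)
    (cong₂ (λ b n → b2n b + n) (≡ᵇ-false k≢v)
      (count-interval-≡ v (suc k) len (ℕₚ.≤∧≢⇒< k≤v k≢v) (subst (v <_) (ℕₚ.+-suc k len) v<)))

  count-cong : ∀ {P Q : Pred} m → (∀ v → InRange m v → P v ≡ Q v) → countᵇ P (range m) ≡ countᵇ Q (range m)
  count-cong m e rewrite range≡interval m =
    count-interval-cong 1 m (λ v 1≤v v< → e v (1≤v , ℕₚ.≤-pred v<))

  count-+ : ∀ {P Q S : Pred} → (∀ v → b2n (P v) ≡ b2n (Q v) + b2n (S v)) → ∀ xs →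
    countᵇ P xs ≡ countᵇ Q xs + countᵇ S xs
  count-+             e []       = refl
  count-+ {P} {Q} {S} e (x ∷ xs) = begin
    countᵇ P (x ∷ xs)                                     ≡⟨ count-∷ P x xs ⟩
    b2n (P x) + countᵇ P xs                               ≡⟨ cong₂ _+_ (e x) (count-+ e xs) ⟩
    (b2n (Q x) + b2n (S x)) + (countᵇ Q xs + countᵇ S xs) ≡⟨ +-interchange (b2n (Q x)) _ _ _ ⟩
    (b2n (Q x) + countᵇ Q xs) + (b2n (S x) + countᵇ S xs) ≡⟨ cong₂ _+_ (count-∷ Q x xs) (count-∷ S x xs) ⟨
    countᵇ Q (x ∷ xs) + countᵇ S (x ∷ xs)                 ∎
    where
    open ≡-Reasoning
    open import Algebra.Properties.CommutativeSemigroup ℕₚ.+-commutativeSemigroup renaming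
        (interchange to +-interchange)

  count-≡ : ∀ {m v} → InRange m v → countᵇ (_≡ᵇ v) (range m) ≡ 1
  count-≡ {m} {v} (1≤v , v≤m) rewrite range≡interval m = count-interval-≡ v 1 m 1≤v (s≤s v≤m)

  count-false : ∀ {P : Pred} → (∀ v → P v ≡ false) → ∀ xs → countᵇ P xs ≡ 0
  count-false     e []       = refl
  count-false {P} e (x ∷ xs) = trans (count-∷ P x xs) (cong₂ (λ b n → b2n b + n) (e x) (count-false e xs))

  count-≡0 : ∀ {P : Pred} m → (∀ v → InRange m v → P v ≡ false) → countᵇ P (range m) ≡ 0
  count-≡0 m e = trans (count-cong m e) (count-false (λ _ → refl) (range m))

  add del : ℕ → Pred → Pred
  add k S u = (u ≡ᵇ k) ∨ S u
  del v S u = not (u ≡ᵇ v) ∧ S u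

  addIf : Bool → ℕ → Pred → Pred
  addIf c k S = if c then add k S else S

  count-add : ∀ {m k S} → InRange m k → S k ≡ false → countᵇ (add k S) (range m) ≡ suc (countᵇ S (range m))
  count-add {m} {k} {S} k∈ Sk = trans (count-+ split (range m)) (cong (_+ countᵇ S (range m)) (count-≡ k∈))
    where
    split : ∀ v → b2n (add k S v) ≡ b2n (v ≡ᵇ k) + b2n (S v)
    split v with v ≡ᵇ k in eq
    ... | false = refl
    ... | true rewrite ≡ᵇ-true⁻¹ {v} eq | Sk = refl

  count-del : ∀ {m v S} → InRange m v → S v ≡ true → suc (countᵇ (del v S) (range m)) ≡ countᵇ S (range m)
  count-del {m} {v} {S} v∈ Sv = sym (trans (count-+ split (range m)) (cong (_+ countᵇ (del v S) (range m))
      (count-≡ v∈)))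
    where
    split : ∀ u → b2n (S u) ≡ b2n (u ≡ᵇ v) + b2n (del v S u)
    split u with u ≡ᵇ v in eq
    ... | false = refl
    ... | true rewrite ≡ᵇ-true⁻¹ {u} eq | Sv = refl

  count-pos : ∀ {m v} {S : Pred} → InRange m v → S v ≡ true → 1 ≤ countᵇ S (range m)
  count-pos {m} {v} {S} v∈ Sv = subst (1 ≤_) (count-del {S = S} v∈ Sv) (s≤s z≤n)

  count-0⇒false : ∀ {m v} {S : Pred} → countᵇ S (range m) ≡ 0 → InRange m v → S v ≡ false
  count-0⇒false {m} {v} {S} c0 v∈ = ¬-not (λ Sv → ℕₚ.1+n≰n (subst (1 ≤_) c0 (count-pos {S = S} v∈ Sv)))

  Below : ℕ → Pred → Set
  Below k S = ∀ u → S u ≡ true → 1 ≤ u × u < k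

  below⇒false : ∀ {k S} → Below k S → S k ≡ false
  below⇒false b = ¬-not (λ Sk → ℕₚ.<-irrefl refl (proj₂ (b _ Sk)))

  addIf-below : ∀ c {k S} → 1 ≤ k → Below k S → Below (suc k) (addIf c k S)
  addIf-below false     1≤k b u Su = proj₁ (b u Su) , ℕₚ.m<n⇒m<1+n (proj₂ (b u Su))
  addIf-below true  {k} 1≤k b u Su with u ≡ᵇ k in eq
  ... | true  rewrite ≡ᵇ-true⁻¹ {u} eq = 1≤k , ℕₚ.≤-refl
  ... | false = proj₁ (b u Su) , ℕₚ.m<n⇒m<1+n (proj₂ (b u Su))

  del-below : ∀ v {k S} → Below k S → Below k (del v S)
  del-below v b u e = b u (proj₂ (∧-true e))

  count-addIf : ∀ c {m k S} → InRange m k → S k ≡ false →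
    countᵇ (addIf c k S) (range m) ≡ (if c then suc (countᵇ S (range m)) else countᵇ S (range m))
  count-addIf true  k∈ Sk = count-add k∈ Sk
  count-addIf false k∈ Sk = refl

open Counting

-- Choosing an element of a finite set by its rank.

below above : ℕ → Pred → ℕ → ℕ
below m S v = countᵇ (λ u → S u ∧ (u <ᵇ v)) (range m)
above m S v = countᵇ (λ u → S u ∧ (v <ᵇ u)) (range m)

module Ranks {c ℓ} (R : CommutativeSemiring c ℓ) where
  open CommutativeSemiring R hiding (zero)
  open Poly R using (Σ; _^_; qint)
  open Sums R
  open Relation.Binary.Reasoning.Setoid setoid
  private
    module *S = Algebra.Properties.CommutativeSemigroup *-commutativeSemigroup

  -- The sum of `f a b` over all `a + b = h ∸ 1` for positive `h`: one term for each element of an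
  -- h-set, with `a` elements above it and `b` below.
  ranks : (ℕ → ℕ → Carrier) → ℕ → Carrier
  ranks f zero    = 0#
  ranks f (suc h) = f h 0 + ranks (λ a b → f a (suc b)) h

  ranks-cong : ∀ {f g} → (∀ a b → f a b ≈ g a b) → ∀ h → ranks f h ≈ ranks g h
  ranks-cong e zero    = refl
  ranks-cong e (suc h) = +-cong (e h 0) (ranks-cong (λ a b → e a (suc b)) h)

  ranks-last : ∀ f h → ranks f (suc h) ≈ ranks (λ a b → f (suc a) b) h + f 0 h
  ranks-last f zero    = +-comm _ _
  ranks-last f (suc h) = trans (+-congˡ (ranks-last (λ a b → f a (suc b)) h)) (sym (+-assoc _ _ _))

  ranks-flip : ∀ f h → ranks (flip f) h ≈ ranks f h
  ranks-flip f zero    = refl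
  ranks-flip f (suc h) = trans (+-congˡ (ranks-flip (λ a b → f (suc a) b) h))
    (trans (+-comm _ _) (sym (ranks-last f h)))

  ranks-*ˡ : ∀ x f h → ranks (λ a b → x * f a b) h ≈ x * ranks f h
  ranks-*ˡ x f zero    = sym (zeroʳ x)
  ranks-*ˡ x f (suc h) = trans (+-congˡ (ranks-*ˡ x (λ a b → f a (suc b)) h)) (sym (distribˡ _ _ _))

  ranks≈Σ : ∀ f h → ranks f h ≈ ∑ (upTo h) (λ j → f (h ∸ 1 ∸ j) j)
  ranks≈Σ f h = trans (go f h) (reflexive (cong Σ (≡.sym (map-upTo _ h))))
    where
    go : ∀ f h → ranks f h ≈ Σ (applyUpTo (λ j → f (h ∸ 1 ∸ j) j) h)
    go f zero          = refl
    go f (suc zero)    = refl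
    go f (suc (suc h)) = +-congˡ (go (λ a b → f a (suc b)) (suc h))

  arc : (p q x u : Carrier) → ℕ → ℕ → Carrier
  arc p q x u cross nest = p ^ cross * (q ^ nest * (if nest ≡ᵇ 0 then x else u))

  -- Only the choice without nestings carries `x`. The others share the factor `q * u` and run
  -- through the monomials of the (p,q)-integer; this is the origin of the factors of `αodd` and
  -- `αeven`.
  ranks-arc : ∀ p q x u h → ranks (arc p q x u) (suc h) ≈ p ^ h * x + q * qint p q h * u
  ranks-arc p q x u h = +-cong (*-congˡ (*-identityˡ x)) (begin
    ranks (λ a b → p ^ a * (q * q ^ b * u)) h
      ≈⟨ ranks-cong (λ a b → rearrange (p ^ a) (q ^ b)) h ⟩
    ranks (λ a b → (q * u) * (p ^ a * q ^ b)) h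
      ≈⟨ ranks-*ˡ (q * u) _ h ⟩
    (q * u) * ranks (λ a b → p ^ a * q ^ b) h
      -- Along the sum the exponent of `p` grows in `qint` but falls in `ranks`, hence the flip.
      ≈⟨ *-congˡ (trans (sym (ranks-flip _ h)) (ranks≈Σ _ h)) ⟩
    (q * u) * qint p q h
      ≈⟨ *S.xy∙z≈xz∙y q u _ ⟩
    q * qint p q h * u ∎)
    where
    rearrange : ∀ y z → y * (q * z * u) ≈ (q * u) * (y * z)
    rearrange y z = trans (*-congˡ (*S.xy∙z≈xz∙y q z u)) (*S.x∙yz≈y∙xz y (q * u) z)

  ∑-cong-interval : ∀ {f g} k len → (∀ v → k ≤ v → v < k ℕ.+ len → f v ≈ g v) →
    ∑ (interval k len) f ≈ ∑ (interval k len) g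
  ∑-cong-interval k zero      e = refl
  ∑-cong-interval k (suc len) e = +-cong (e k ℕₚ.≤-refl (ℕₚ.m<m+n k (s≤s z≤n)))
    (∑-cong-interval (suc k) len (λ v k<v v< → e v (ℕₚ.<⇒≤ k<v) (subst (v <_) (≡.sym (ℕₚ.+-suc k len)) v<)))

  ∑-cong-range : ∀ {f g} m → (∀ v → InRange m v → f v ≈ g v) → ∑ (range m) f ≈ ∑ (range m) g
  ∑-cong-range m e rewrite range≡interval m = ∑-cong-interval 1 m (λ v 1≤v v< → e v (1≤v , ℕₚ.≤-pred v<))

  ∑-interval-δ : ∀ k len x f → k ≤ x → x < k ℕ.+ len → (∀ v → k ≤ v → v < k ℕ.+ len → v ≢ x → f v ≈ 0#) →
      ∑ (interval k len) f ≈ f x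
  ∑-interval-δ k zero      x f k≤x x< e = ⊥-elim (ℕₚ.<⇒≱ x< (subst (_≤ x) (≡.sym (ℕₚ.+-identityʳ k)) k≤x))
  ∑-interval-δ k (suc len) x f k≤x x< e with k ℕ.≟ x
  ... | yes ≡.refl = trans (+-congˡ (trans
    (∑-cong-interval (suc k) len (λ v k<v v< → e v (ℕₚ.<⇒≤ k<v) (subst (v <_) (≡.sym (ℕₚ.+-suc k len)) v<)
        (ℕₚ.>⇒≢ k<v))) (∑-zero (interval (suc k) len) (λ _ → refl)))) (+-identityʳ _)
  ... | no k≢x = trans (+-cong (e k ℕₚ.≤-refl (ℕₚ.m<m+n k (s≤s z≤n)) k≢x)
    (∑-interval-δ (suc k) len x f (ℕₚ.≤∧≢⇒< k≤x k≢x) (subst (x <_) (ℕₚ.+-suc k len) x<)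
      (λ v k<v v< → e v (ℕₚ.<⇒≤ k<v) (subst (v <_) (≡.sym (ℕₚ.+-suc k len)) v<)))) (+-identityˡ _)

  ∑-range-δ : ∀ m x f → InRange m x → (∀ v → InRange m v → v ≢ x → f v ≈ 0#) → ∑ (range m) f ≈ f x
  ∑-range-δ m x f (1≤x , x≤m) e rewrite range≡interval m = ∑-interval-δ 1 m x f 1≤x (s≤s x≤m)
    (λ v 1≤v v< → e v (1≤v , ℕₚ.≤-pred v<))

  -- Induction from the left end. A first element of `S` has nothing below it and all the rest above
  -- it; it raises the number below every later element by one, which replaces `f` by its shift in
  -- the second argument.
  rank-sum-interval : ∀ (S : Pred) f k len → let I = interval k len in
    ∑ I (λ v → [ S v ]· f (countᵇ (λ u → S u ∧ (v <ᵇ u)) I) (countᵇ (λ u → S u ∧ (u <ᵇ v)) I))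
      ≈ ranks f (countᵇ S I)
  rank-sum-interval S f k zero      = refl
  rank-sum-interval S f k (suc len) = begin
    ∑ (k ∷ I) (λ v → [ S v ]· f (countᵇ (λ u → S u ∧ (v <ᵇ u)) (k ∷ I)) (countᵇ (λ u → S u ∧ (u <ᵇ v)) (k ∷ I)))
      ≈⟨ +-cong (reflexive (cong₂ (λ a b → [ S k ]· f a b) headAbove headBelow))
           (∑-cong-interval (suc k) len (λ v k<v _ → reflexive
             (cong₂ (λ a b → [ S v ]· f a b) (tailAbove v k<v) (tailBelow v k<v)))) ⟩
    [ S k ]· f (countᵇ S I) 0
      + ∑ I (λ v → [ S v ]· f (countᵇ (λ u → S u ∧ (v <ᵇ u)) I) (b2n (S k) ℕ.+ countᵇ (λ u → S u ∧ (u <ᵇ v)) I))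
      ≈⟨ byHead (S k) ⟩
    ranks f (b2n (S k) ℕ.+ countᵇ S I)
      ≡⟨ cong (ranks f) (count-∷ S k I) ⟨
    ranks f (countᵇ S (k ∷ I)) ∎
    where
    I = interval (suc k) len
    headAbove : countᵇ (λ u → S u ∧ (k <ᵇ u)) (k ∷ I) ≡ countᵇ S I
    headAbove = ≡.trans
      (count-head (λ u → S u ∧ (k <ᵇ u)) k I (≡.trans (cong (S k ∧_) (<ᵇ-false (ℕₚ.≤-refl {k}))) (∧-zeroʳ (S k))))
      (count-interval-cong (suc k) len (λ u k<u _ → ≡.trans (cong (S u ∧_) (<ᵇ-true k<u)) (∧-identityʳ (S u))))
    headBelow : countᵇ (λ u → S u ∧ (u <ᵇ k)) (k ∷ I) ≡ 0
    headBelow = ≡.trans (count-interval-cong {Q = λ _ → false} k (suc len)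
      (λ u k≤u _ → ≡.trans (cong (S u ∧_) (<ᵇ-false k≤u)) (∧-zeroʳ (S u))))
      (count-false (λ _ → ≡.refl) (interval k (suc len)))
    tailAbove : ∀ v → k < v → countᵇ (λ u → S u ∧ (v <ᵇ u)) (k ∷ I) ≡ countᵇ (λ u → S u ∧ (v <ᵇ u)) I
    tailAbove v k<v = count-head (λ u → S u ∧ (v <ᵇ u)) k I
      (≡.trans (cong (S k ∧_) (<ᵇ-false (ℕₚ.<⇒≤ k<v))) (∧-zeroʳ (S k)))
    tailBelow : ∀ v → k < v →
      countᵇ (λ u → S u ∧ (u <ᵇ v)) (k ∷ I) ≡ b2n (S k) ℕ.+ countᵇ (λ u → S u ∧ (u <ᵇ v)) I
    tailBelow v k<v = count-head (λ u → S u ∧ (u <ᵇ v)) k I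
      (≡.trans (cong (S k ∧_) (<ᵇ-true k<v)) (∧-identityʳ (S k)))
    byHead : ∀ b → [ b ]· f (countᵇ S I) 0
      + ∑ I (λ v → [ S v ]· f (countᵇ (λ u → S u ∧ (v <ᵇ u)) I) (b2n b ℕ.+ countᵇ (λ u → S u ∧ (u <ᵇ v)) I))
      ≈ ranks f (b2n b ℕ.+ countᵇ S I)
    byHead true  = +-congˡ (rank-sum-interval S (λ x y → f x (suc y)) (suc k) len)
    byHead false = trans (+-identityˡ _) (rank-sum-interval S f (suc k) len)

  rank-sum : ∀ m (S : Pred) f → ∑ (range m) (λ v → [ S v ]· f (above m S v) (below m S v)) ≈ ranks f
      (countᵇ S (range m))
  rank-sum m S f rewrite range≡interval m = rank-sum-interval S f 1 m

  -- The value `k` adds one choice, the fixed point. The ranks of the other choices do not change,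
  -- because they are counted in `S` and not in `addIf b k S`.
  choice-sum : ∀ m b k S (f : ℕ → ℕ → Carrier) x → InRange m k → S k ≡ false →
    ∑ (range m) (λ v → [ addIf b k S v ]· (if v ≡ᵇ k then x else f (above m S v) (below m S v)))
      ≈ ranks f (countᵇ S (range m)) + [ b ]· x
  choice-sum m b k S f x k∈ Sk = begin
    ∑ (range m) (λ v → [ addIf b k S v ]· (if v ≡ᵇ k then x else g v))
      ≈⟨ ∑-cong (range m) (split b) ⟩
    ∑ (range m) (λ v → [ S v ]· g v + [ b ]· [ v ≡ᵇ k ]· x)
      ≈⟨ ∑-+ (range m) _ _ ⟩
    ∑ (range m) (λ v → [ S v ]· g v) + ∑ (range m) (λ v → [ b ]· [ v ≡ᵇ k ]· x)
      ≈⟨ +-cong (rank-sum m S f) (∑-range-δ m k _ k∈ (λ v _ → off v)) ⟩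
    ranks f (countᵇ S (range m)) + [ b ]· [ k ≡ᵇ k ]· x
      ≡⟨ cong (λ e → ranks f (countᵇ S (range m)) + [ b ]· [ e ]· x) (≡ᵇ-true {k} ≡.refl) ⟩
    ranks f (countᵇ S (range m)) + [ b ]· x ∎
    where
    g : ℕ → Carrier
    g v = f (above m S v) (below m S v)
    []·-0 : ∀ b → [ b ]· 0# ≈ 0#
    []·-0 true  = refl
    []·-0 false = refl
    off : ∀ v → v ≢ k → [ b ]· [ v ≡ᵇ k ]· x ≈ 0#
    off v v≢k = trans (reflexive (cong (λ e → [ b ]· [ e ]· x) (≡ᵇ-false v≢k))) ([]·-0 b)
    split : ∀ b v → [ addIf b k S v ]· (if v ≡ᵇ k then x else g v) ≈ [ S v ]· g v + [ b ]· [ v ≡ᵇ k ]· x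
    split b v with v ≡ᵇ k in eq
    split true  v | true  rewrite eq | ≡.trans (cong S (≡ᵇ-true⁻¹ {v} eq)) Sk = sym (+-identityˡ _)
    split false v | true  rewrite ≡.trans (cong S (≡ᵇ-true⁻¹ {v} eq)) Sk = sym (+-identityˡ _)
    split true  v | false rewrite eq = sym (+-identityʳ _)
    split false v | false = sym (+-identityʳ _)

-- Words that are compatible with prescribed classes.

-- The classes of the position and of the value at consecutive indices; true stands for D.
Classes : Set
Classes = List (Bool × Bool)

-- Unlike the open D-values, which are handed down, these are known only once the rest of the word is read.
openU : ℕ → Classes → List ℕ → Pred
openU k []                   _       = λ _ → false
openU k (_ ∷ _)              []      = λ _ → false
openU k ((true  , cv) ∷ cls) (v ∷ w) = addIf (not cv) k (openU (suc k) cls w)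
openU k ((false , cv) ∷ cls) (v ∷ w) = del v (addIf (not cv) k (openU (suc k) cls w))

module Guard (m : ℕ) where

  card : Pred → ℕ
  card S = countᵇ S (range m)

  -- The condition under which the weight `ev` can be nonzero. Only the D-values are tested for
  -- being used up at the end; that no U-value is left open at the start then follows from
  -- `card-openU`.
  admissible : Pred → ℕ → Classes → List ℕ → Bool
  admissible A k []                   []      = card A ≡ᵇ 0
  admissible A k []                   (_ ∷ _) = false
  admissible A k (_ ∷ _)              []      = false
  admissible A k ((true  , cv) ∷ cls) (v ∷ w) =
    addIf cv k A v ∧ admissible (del v (addIf cv k A)) (suc k) cls w
  admissible A k ((false , cv) ∷ cls) (v ∷ w) =
    addIf (not cv) k (openU (suc k) cls w) v ∧ admissible (addIf cv k A) (suc k) cls w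

  Between : ℕ → Pred → Set
  Between k S = ∀ u → S u ≡ true → k ≤ u × u ≤ m

  addIf-between : ∀ c {k S} → k ≤ m → Between (suc k) S → Between k (addIf c k S)
  addIf-between false     k≤m b u Su = ℕₚ.<⇒≤ (proj₁ (b u Su)) , proj₂ (b u Su)
  addIf-between true  {k} k≤m b u Su with u ≡ᵇ k in eq
  ... | true  rewrite ≡ᵇ-true⁻¹ {u} eq = ℕₚ.≤-refl , k≤m
  ... | false = ℕₚ.<⇒≤ (proj₁ (b u Su)) , proj₂ (b u Su)

  next-length : ∀ {k} {cls : Classes} {c} → k ℕ.+ length (c ∷ cls) ≡ suc m → suc k ℕ.+ length cls ≡ suc m
  next-length {k} {cls} e = ≡.trans (≡.sym (ℕₚ.+-suc k (length cls))) e

  head≤m : ∀ {k} {cls : Classes} {c} → k ℕ.+ length (c ∷ cls) ≡ suc m → k ≤ m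
  head≤m {k} {cls} e = ℕₚ.≤-pred (ℕₚ.≤-trans (s≤s (ℕₚ.m≤m+n k (length cls)))
      (ℕₚ.≤-reflexive (next-length {k} {cls} {true , true} e)))

  openU-between : ∀ k cls w → k ℕ.+ length cls ≡ suc m → Between k (openU k cls w)
  openU-between k []                   w       e u ()
  openU-between k (_ ∷ cls)            []      e u ()
  openU-between k ((true , cv) ∷ cls)  (v ∷ w) e =
    addIf-between (not cv) (head≤m {k} {cls} {true , cv} e) (openU-between (suc k) cls w
        (next-length {k} {cls} {true , cv} e))
  openU-between k ((false , cv) ∷ cls) (v ∷ w) e u Bu =
    addIf-between (not cv) (head≤m {k} {cls} {true , cv} e) (openU-between (suc k) cls w
        (next-length {k} {cls} {true , cv} e))
      u (proj₂ (∧-true Bu))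

  between⇒false : ∀ {k S} → Between (suc k) S → S k ≡ false
  between⇒false {k} {S} b with S k in eq
  ... | true  = ⊥-elim (ℕₚ.<-irrefl ≡.refl (proj₁ (b k eq)))
  ... | false = ≡.refl

  module Step {k : ℕ} {c : Bool × Bool} {cls : Classes} {A : Pred} (1≤k : 1 ≤ k)
      (e : k ℕ.+ length (c ∷ cls) ≡ suc m) (bA : Below k A) where
    e′ : suc k ℕ.+ length cls ≡ suc m
    e′ = next-length {k} {cls} {c} e
    k∈ : InRange m k
    k∈ = 1≤k , head≤m {k} {cls} {c} e
    Ak : A k ≡ false
    Ak = below⇒false bA
    bA₁ : ∀ b → Below (suc k) (addIf b k A)
    bA₁ b = addIf-below b 1≤k bA
    bA₂ : ∀ b v → Below (suc k) (del v (addIf b k A))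
    bA₂ b v = del-below v (bA₁ b)
    A₁-range : ∀ b v → addIf b k A v ≡ true → InRange m v
    A₁-range b v g = proj₁ (bA₁ b v g) , ℕₚ.≤-trans (ℕₚ.≤-pred (proj₂ (bA₁ b v g))) (proj₂ k∈)
    bB : ∀ w → Between (suc k) (openU (suc k) cls w)
    bB w = openU-between (suc k) cls w e′
    Bk : ∀ w → openU (suc k) cls w k ≡ false
    Bk w = between⇒false (bB w)
    B₁-range : ∀ b w v → addIf b k (openU (suc k) cls w) v ≡ true → InRange m v
    B₁-range b w v g = ℕₚ.≤-trans 1≤k (proj₁ r) , proj₂ r
      where r = addIf-between b (proj₂ k∈) (bB w) v g

  -- The remaining indices supply as many positions as values. Their positions take these values
  -- together with `A`, except for the U-values left to earlier positions; hence the latter are as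
  -- many as `A`.
  card-openU : ∀ {A} k cls w → 1 ≤ k → k ℕ.+ length cls ≡ suc m → Below k A →
    admissible A k cls w ≡ true → card (openU k cls w) ≡ card A
  card-openU {A} k [] [] 1≤k e bA ok = ≡.trans (count-false (λ _ → ≡.refl) (range m))
      (≡.sym (≡ᵇ-true⁻¹ {card A} ok))
  card-openU {A} k ((true , cv) ∷ cls) (v ∷ w) 1≤k e bA ok =
    go cv (count-addIf cv k∈ Ak) (count-addIf (not cv) k∈ (Bk w)) (count-del (A₁-range cv v g) g)
      (card-openU (suc k) cls w (s≤s z≤n) e′ (bA₂ cv v) (proj₂ (∧-true ok)))
    where
    open Step {c = true , cv} {cls} 1≤k e bA
    g = proj₁ (∧-true ok)
    go : ∀ cv {a a₁ a₂ b b₁} → a₁ ≡ (if cv then suc a else a) → b₁ ≡ (if not cv then suc b else b) →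
      suc a₂ ≡ a₁ → b ≡ a₂ → b₁ ≡ a
    go true  ≡.refl ≡.refl ≡.refl ≡.refl = ≡.refl
    go false ≡.refl ≡.refl ≡.refl ≡.refl = ≡.refl
  card-openU {A} k ((false , cv) ∷ cls) (v ∷ w) 1≤k e bA ok =
    go cv (count-addIf cv k∈ Ak) (count-addIf (not cv) k∈ (Bk w)) (count-del (B₁-range (not cv) w v g) g)
      (card-openU (suc k) cls w (s≤s z≤n) e′ (bA₁ cv)
          (proj₂ (∧-true {addIf (not cv) k (openU (suc k) cls w) v} ok)))
    where
    open Step {c = false , cv} {cls} 1≤k e bA
    g = proj₁ (∧-true ok)
    go : ∀ cv {a a₁ b b₁ b₂} → a₁ ≡ (if cv then suc a else a) → b₁ ≡ (if not cv then suc b else b) →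
      suc b₂ ≡ b₁ → b ≡ a₁ → b₂ ≡ a
    go true  ≡.refl p ≡.refl ≡.refl = ℕₚ.suc-injective p
    go false ≡.refl p ≡.refl ≡.refl = ℕₚ.suc-injective p

  private
    b2n-addIf : ∀ c {k S} → S k ≡ false → ∀ j → b2n (addIf c k S j) ≡ b2n (S j) ℕ.+ b2n (c ∧ (j ≡ᵇ k))
    b2n-addIf false         Sk j = ≡.sym (ℕₚ.+-identityʳ _)
    b2n-addIf true  {k} {S} Sk j with j ≡ᵇ k in eq
    ... | true rewrite ≡.trans (cong S (≡ᵇ-true⁻¹ {j} eq)) Sk = ≡.refl
    ... | false = ≡.sym (ℕₚ.+-identityʳ _)

    b2n-del : ∀ {v S} → S v ≡ true → ∀ j → b2n (S j) ≡ b2n (j ≡ᵇ v) ℕ.+ b2n (del v S j)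
    b2n-del {v} {S} Sv j with j ≡ᵇ v in eq
    ... | true rewrite ≡.trans (cong S (≡ᵇ-true⁻¹ {j} eq)) Sv = ≡.refl
    ... | false = ≡.refl

    b2n-≤ᵇ : ∀ j k → b2n (k ≤ᵇ j) ≡ b2n (j ≡ᵇ k) ℕ.+ b2n (suc k ≤ᵇ j)
    b2n-≤ᵇ j k with ℕₚ.<-cmp j k
    ... | tri< j<k j≢k _ rewrite <ᵇ-false {k} {suc j} j<k | ≡ᵇ-false j≢k | <ᵇ-false {suc k} {suc j}
        (s≤s (ℕₚ.<⇒≤ j<k)) = ≡.refl
    ... | tri≈ _ ≡.refl _ rewrite <ᵇ-true {j} {suc j} ℕₚ.≤-refl | ≡ᵇ-true {j} ≡.refl | <ᵇ-false {suc j}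
        {suc j} ℕₚ.≤-refl = ≡.refl
    ... | tri> _ j≢k k<j rewrite <ᵇ-true {k} {suc j} (ℕₚ.m<n⇒m<1+n k<j) | ≡ᵇ-false j≢k | <ᵇ-true {suc k}
        {suc j} (s≤s k<j) = ≡.refl

    b2n-not : ∀ c b → b2n b ≡ b2n (c ∧ b) ℕ.+ b2n (not c ∧ b)
    b2n-not true  b = ≡.sym (ℕₚ.+-identityʳ _)
    b2n-not false b = ≡.refl

  -- Bookkeeping for a single value `j`. It is still to be placed if it lies in `A` or has not been
  -- reached yet, and it is missing from `w` exactly when it is a U-value left to an earlier
  -- position. With nothing open at the start, every value occurs once.
  occurrences : ∀ {A j} k cls w → 1 ≤ k → k ℕ.+ length cls ≡ suc m → Below k A → InRange m j →
    admissible A k cls w ≡ true →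
    countᵇ (j ≡ᵇ_) w ℕ.+ b2n (openU k cls w j) ≡ b2n (A j) ℕ.+ b2n (k ≤ᵇ j)
  occurrences {A} {j} k [] [] 1≤k e bA j∈ ok
    rewrite count-0⇒false {S = A} (≡ᵇ-true⁻¹ {card A} ok) j∈
          | <ᵇ-false {k} {suc j} (subst (suc j ≤_) (≡.trans (≡.sym e) (ℕₚ.+-identityʳ k)) (s≤s (proj₂ j∈))) = ≡.refl
  occurrences {A} {j} k ((true , cv) ∷ cls) (v ∷ w) 1≤k e bA j∈ ok =
    go (count-∷ (j ≡ᵇ_) v w) (b2n-addIf cv {S = A} Ak j) (b2n-addIf (not cv) {S = openU (suc k) cls w} (Bk w)
        j) (b2n-del {v} {S = addIf cv k A} g j)
      (b2n-≤ᵇ j k) (b2n-not cv (j ≡ᵇ k))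
      (occurrences (suc k) cls w (s≤s z≤n) e′ (bA₂ cv v) j∈ (proj₂ (∧-true ok)))
    where
    open Step {c = true , cv} {cls} 1≤k e bA
    g = proj₁ (∧-true ok)
    go : ∀ {n n′ a a₁ a₂ b b₁ v k k₁ k₂ l l₁} → n ≡ v ℕ.+ n′ → a₁ ≡ a ℕ.+ k₁ → b₁ ≡ b ℕ.+ k₂ → a₁ ≡ v ℕ.+ a₂ →
      l ≡ k ℕ.+ l₁ → k ≡ k₁ ℕ.+ k₂ → n′ ℕ.+ b ≡ a₂ ℕ.+ l₁ → n ℕ.+ b₁ ≡ a ℕ.+ l
    go {n′ = n′} {a} {a₁} {a₂} {b} {v = v} {k₁ = k₁} {k₂} {l₁ = l₁} ≡.refl p ≡.refl q ≡.refl ≡.refl r = begin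
      v ℕ.+ n′ ℕ.+ (b ℕ.+ k₂)    ≡⟨ solve 4 (λ v n b k → v :+ n :+ (b :+ k) := v :+ (n :+ b) :+ k) ≡.refl v n′
          b k₂ ⟩
      v ℕ.+ (n′ ℕ.+ b) ℕ.+ k₂    ≡⟨ cong (λ x → v ℕ.+ x ℕ.+ k₂) r ⟩
      v ℕ.+ (a₂ ℕ.+ l₁) ℕ.+ k₂    ≡⟨ solve 4 (λ v a l k → v :+ (a :+ l) :+ k := (v :+ a) :+ (k :+ l)) ≡.refl v
          a₂ l₁ k₂ ⟩
      (v ℕ.+ a₂) ℕ.+ (k₂ ℕ.+ l₁)  ≡⟨ cong (ℕ._+ (k₂ ℕ.+ l₁)) (≡.trans (≡.sym q) p) ⟩
      (a ℕ.+ k₁) ℕ.+ (k₂ ℕ.+ l₁)  ≡⟨ solve 4 (λ a k k′ l → (a :+ k) :+ (k′ :+ l) := a :+ (k :+ k′ :+ l))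
          ≡.refl a k₁ k₂ l₁ ⟩
      a ℕ.+ (k₁ ℕ.+ k₂ ℕ.+ l₁)    ∎
      where open ≡.≡-Reasoning
            open +-*-Solver
  occurrences {A} {j} k ((false , cv) ∷ cls) (v ∷ w) 1≤k e bA j∈ ok =
    go (count-∷ (j ≡ᵇ_) v w) (b2n-addIf cv {S = A} Ak j) (b2n-addIf (not cv) {S = openU (suc k) cls w} (Bk w) j)
      (b2n-del {v} {S = addIf (not cv) k (openU (suc k) cls w)} g j)
      (b2n-≤ᵇ j k) (b2n-not cv (j ≡ᵇ k))
      (occurrences (suc k) cls w (s≤s z≤n) e′ (bA₁ cv) j∈
          (proj₂ (∧-true {addIf (not cv) k (openU (suc k) cls w) v} ok)))
    where
    open Step {c = false , cv} {cls} 1≤k e bA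
    g = proj₁ (∧-true ok)
    go : ∀ {n n′ a a₁ b b₁ b₂ v k k₁ k₂ l l₁} → n ≡ v ℕ.+ n′ → a₁ ≡ a ℕ.+ k₁ → b₁ ≡ b ℕ.+ k₂ → b₁ ≡ v ℕ.+ b₂ →
      l ≡ k ℕ.+ l₁ → k ≡ k₁ ℕ.+ k₂ → n′ ℕ.+ b ≡ a₁ ℕ.+ l₁ → n ℕ.+ b₂ ≡ a ℕ.+ l
    go {n′ = n′} {a} {a₁} {b} {b₂ = b₂} {v = v} {k₁ = k₁} {k₂} {l₁ = l₁} ≡.refl ≡.refl p q ≡.refl ≡.refl r = begin
      v ℕ.+ n′ ℕ.+ b₂            ≡⟨ solve 3 (λ v n b → v :+ n :+ b := n :+ (v :+ b)) ≡.refl v n′ b₂ ⟩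
      n′ ℕ.+ (v ℕ.+ b₂)          ≡⟨ cong (n′ ℕ.+_) (≡.trans (≡.sym q) p) ⟩
      n′ ℕ.+ (b ℕ.+ k₂)          ≡⟨ ℕₚ.+-assoc n′ b k₂ ⟨
      n′ ℕ.+ b ℕ.+ k₂            ≡⟨ cong (ℕ._+ k₂) r ⟩
      a ℕ.+ k₁ ℕ.+ l₁ ℕ.+ k₂      ≡⟨ solve 4 (λ a k l k′ → a :+ k :+ l :+ k′ := a :+ (k :+ k′ :+ l)) ≡.refl a
          k₁ l₁ k₂ ⟩
      a ℕ.+ (k₁ ℕ.+ k₂ ℕ.+ l₁)    ∎
      where open ≡.≡-Reasoning
            open +-*-Solver

  -- A fixed point satisfies both inequalities; the condition on `cv` makes its classes as a
  -- position and as a value agree.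
  Placed : Pred → Bool → ℕ → ℕ → Set
  Placed cv true  i v = v ≤ i × cv v ≡ true
  Placed cv false i v = i ≤ v × cv v ≡ false

  classes : Pred → Pred → ℕ → ℕ → Classes
  classes cp cv k zero      = []
  classes cp cv k (suc len) = (cp k , cv k) ∷ classes cp cv (suc k) len

  addIf-class : ∀ {c k} {cv S : Pred} {b} → (∀ u → S u ≡ true → cv u ≡ b) → (c ≡ true → cv k ≡ b) →
    ∀ u → addIf c k S u ≡ true → cv u ≡ b
  addIf-class {false}     h hk u Su = h u Su
  addIf-class {true}  {k} {cv} h hk u Su with u ≡ᵇ k in eq
  ... | true  = ≡.trans (cong cv (≡ᵇ-true⁻¹ {u} eq)) (hk ≡.refl)
  ... | false = h u Su

  openU-class : ∀ cp cv k len w u → openU k (classes cp cv k len) w u ≡ true → cv u ≡ false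
  openU-class cp cv k (suc len) (v ∷ w) u Bu with cp k
  ... | true  = addIf-class (openU-class cp cv (suc k) len w) not-true u Bu
  ... | false = addIf-class (openU-class cp cv (suc k) len w) not-true u (proj₂ (∧-true Bu))
  openU-class cp cv k (suc len) [] u ()

  -- The invariant is that `A` holds only D-values below `k`, while `openU` holds only U-values
  -- beyond it. A letter drawn from either set, or `k` itself, is then on the correct side.
  placed : ∀ {A} cp cv k len w → 1 ≤ k → k ℕ.+ len ≡ suc m → Below k A → (∀ u → A u ≡ true → cv u ≡ true) →
    admissible A k (classes cp cv k len) w ≡ true → ∀ i → i < len → Placed cv (cp (k ℕ.+ i)) (k ℕ.+ i)
        (app w (suc i))
  placed cp cv k (suc len) [] 1≤k e bA cA () i i<
  placed {A} cp cv k (suc len) (v ∷ w) 1≤k e bA cA ok zero    i< rewrite ℕₚ.+-identityʳ k with cp k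
  ... | true  = ℕₚ.≤-pred (proj₂ (addIf-below (cv k) 1≤k bA v (proj₁ (∧-true ok)))) , addIf-class cA (λ c → c)
      v (proj₁ (∧-true ok))
  ... | false = proj₁ (addIf-between (not (cv k))
      (ℕₚ.≤-pred (ℕₚ.≤-trans (s≤s (ℕₚ.m≤m+n k len)) (ℕₚ.≤-reflexive (≡.trans (≡.sym (ℕₚ.+-suc k len)) e))))
                         (openU-between (suc k) (classes cp cv (suc k) len) w
                           (≡.trans (cong (suc k ℕ.+_) (length-classes cp cv (suc k) len))
                               (≡.trans (≡.sym (ℕₚ.+-suc k len)) e))) v (proj₁ (∧-true ok)))
                , addIf-class (openU-class cp cv (suc k) len w) not-true v (proj₁ (∧-true ok))
    where
    length-classes : ∀ cp cv k len → length (classes cp cv k len) ≡ len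
    length-classes cp cv k zero = ≡.refl
    length-classes cp cv k (suc len) = cong suc (length-classes cp cv (suc k) len)
  placed {A} cp cv k (suc len) (v ∷ w) 1≤k e bA cA ok (suc i) (s≤s i<) rewrite ℕₚ.+-suc k i with cp k
  ... | true  = placed cp cv (suc k) len w (s≤s z≤n) (≡.trans (≡.sym (ℕₚ.+-suc k len)) e)
      (del-below v (addIf-below (cv k) 1≤k bA))
                  (λ u Au → addIf-class cA (λ c → c) u (proj₂ (∧-true Au))) (proj₂ (∧-true ok)) i i<
  ... | false = placed cp cv (suc k) len w (s≤s z≤n) (≡.trans (≡.sym (ℕₚ.+-suc k len)) e)
      (addIf-below (cv k) 1≤k bA)
                  (addIf-class cA (λ c → c)) (proj₂
                      (∧-true {addIf (not (cv k)) k (openU (suc k) (classes cp cv (suc k) len) w) v} ok)) i i<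

-- Summing the weights of words by a transfer along a path.

-- arcw cp cv cross nest weighs the arc at a position of class cp whose index as a value has class cv;
-- fixw k h weighs the fixed point k under h arcs.
module Eval {c ℓ} (R : CommutativeSemiring c ℓ)
  (arcw : Bool → Bool → ℕ → ℕ → CommutativeSemiring.Carrier R)
  (fixw : ℕ → ℕ → CommutativeSemiring.Carrier R) (m : ℕ) where
  open CommutativeSemiring R hiding (zero)
  open Sums R
  open Ranks R
  open Guard m
  open Relation.Binary.Reasoning.Setoid setoid

  locD : Bool → ℕ → Pred → ℕ → Carrier
  locD cv k A v = if v ≡ᵇ k then fixw k (card A) else arcw true cv (above m A v) (below m A v)

  locU : Bool → ℕ → Pred → ℕ → Carrier
  locU cv k B v = if v ≡ᵇ k then fixw k (card B) else arcw false cv (below m B v) (above m B v)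

  ev : Pred → ℕ → Classes → List ℕ → Carrier
  ev A k []                   []      = [ card A ≡ᵇ 0 ]· 1#
  ev A k []                   (_ ∷ _) = 0#
  ev A k (_ ∷ _)              []      = 0#
  ev A k ((true  , cv) ∷ cls) (v ∷ w) =
    ([ addIf cv k A v ]· locD cv k A v) * ev (del v (addIf cv k A)) (suc k) cls w
  ev A k ((false , cv) ∷ cls) (v ∷ w) =
    ([ addIf (not cv) k B v ]· locU cv k B v) * ev (addIf cv k A) (suc k) cls w
    where B = openU (suc k) cls w

  -- `h` is the number of open D-values before `k`. A D-position chooses among these; a U-position
  -- chooses among the U-values beyond `k`, which are as many as the D-arcs from k to k+1, namely
  -- `h′`. A step below height 0 has weight zero, as `ranks` is then the empty sum, so the value of
  -- `pred 0` has no effect.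
  Φ : ℕ → ℕ → Classes → Carrier
  Φ h k []                   = [ h ≡ᵇ 0 ]· 1#
  Φ h k ((true  , cv) ∷ cls) =
    (ranks (arcw true cv) h + [ cv ]· fixw k h) * Φ (if cv then h else pred h) (suc k) cls
  Φ h k ((false , cv) ∷ cls) = (ranks (arcw false cv) h′ + [ not cv ]· fixw k h′) * Φ h′ (suc k) cls
    where h′ = if cv then suc h else h

  ev-inadmissible : ∀ A k cls w → admissible A k cls w ≡ false → ev A k cls w ≈ 0#
  ev-inadmissible A k [] []      ok rewrite ok = refl
  ev-inadmissible A k [] (_ ∷ _) ok = refl
  ev-inadmissible A k (_ ∷ _) [] ok = refl
  ev-inadmissible A k ((true , cv) ∷ cls) (v ∷ w) ok with addIf cv k A v
  ... | true  = trans (*-congˡ (ev-inadmissible _ (suc k) cls w ok)) (zeroʳ _)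
  ... | false = zeroˡ _
  ev-inadmissible A k ((false , cv) ∷ cls) (v ∷ w) ok with addIf (not cv) k (openU (suc k) cls w) v
  ... | true  = trans (*-congˡ (ev-inadmissible _ (suc k) cls w ok)) (zeroʳ _)
  ... | false = zeroˡ _

  -- On admissible words the two sets have the same size, on the others both sides vanish. This
  -- frees the factor of a U-position from its dependence on the tail.
  ev-balance : ∀ {A k cls} w (f : ℕ → Carrier) → 1 ≤ k → k ℕ.+ length cls ≡ suc m → Below k A →
    f (card (openU k cls w)) * ev A k cls w ≈ f (card A) * ev A k cls w
  ev-balance {A} {k} {cls} w f 1≤k e bA with admissible A k cls w in ok
  ... | true  = *-congʳ (reflexive (cong f (card-openU k cls w 1≤k e bA ok)))
  ... | false = trans (trans (*-congˡ z) (zeroʳ _)) (sym (trans (*-congˡ z) (zeroʳ _)))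
    where z = ev-inadmissible A k cls w ok

  -- At a D-position the tails are summed first, since their sum depends on the letter only through
  -- the number of values left open. At a U-position the letter is summed first, for a fixed tail,
  -- because the tail determines the open U-values.
  sum-ev : ∀ A k cls → 1 ≤ k → k ℕ.+ length cls ≡ suc m → Below k A →
    ∑ (words m (length cls)) (ev A k cls) ≈ Φ (card A) k cls
  sum-ev A k [] 1≤k e bA = +-identityʳ _
  sum-ev A k ((true , cv) ∷ cls) 1≤k e bA = begin
    ∑ (words m (suc (length cls))) (ev A k ((true , cv) ∷ cls))
      ≈⟨ ∑-words m (length cls) _ ⟩
    ∑ (range m) (λ v → ∑ (words m (length cls)) (λ w → g v * ev (A₂ v) (suc k) cls w))
      ≈⟨ ∑-cong (range m) (λ v → trans (sym (∑-*ˡ (words m (length cls)) (g v) _))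
           (*-congˡ (sum-ev (A₂ v) (suc k) cls (s≤s z≤n) e′ (bA₂ cv v)))) ⟩
    ∑ (range m) (λ v → g v * Φ (card (A₂ v)) (suc k) cls)
      ≈⟨ ∑-cong (range m) height ⟩
    ∑ (range m) (λ v → g v * Φ h′ (suc k) cls)
      ≈⟨ ∑-*ʳ (range m) _ g ⟨
    ∑ (range m) g * Φ h′ (suc k) cls
      ≈⟨ *-congʳ (choice-sum m cv k A (arcw true cv) (fixw k (card A)) k∈ Ak) ⟩
    Φ (card A) k ((true , cv) ∷ cls) ∎
    where
    open Step {c = true , cv} {cls} 1≤k e bA
    A₂ : ℕ → Pred
    A₂ v = del v (addIf cv k A)
    h′ = if cv then card A else pred (card A)
    g : ℕ → Carrier
    g v = [ addIf cv k A v ]· locD cv k A v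
    pred-if : ∀ cv {a b} → b ≡ (if cv then suc a else a) → pred b ≡ (if cv then a else pred a)
    pred-if true  ≡.refl = ≡.refl
    pred-if false ≡.refl = ≡.refl
    height : ∀ v → g v * Φ (card (A₂ v)) (suc k) cls ≈ g v * Φ h′ (suc k) cls
    height v with addIf cv k A v in eq
    ... | true  = *-congˡ (reflexive (cong (λ h → Φ h (suc k) cls)
      (≡.trans (cong pred (count-del {S = addIf cv k A} (A₁-range cv v eq) eq))
          (pred-if cv (count-addIf cv k∈ Ak)))))
    ... | false = trans (zeroˡ _) (sym (zeroˡ _))
  sum-ev A k ((false , cv) ∷ cls) 1≤k e bA = begin
    ∑ (words m (suc (length cls))) (ev A k ((false , cv) ∷ cls))
      ≈⟨ ∑-words m (length cls) _ ⟩
    ∑ (range m) (λ v → ∑ ws (λ w → g w v * ev A₁ (suc k) cls w))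
      ≈⟨ ∑-swap (range m) ws _ ⟩
    ∑ ws (λ w → ∑ (range m) (λ v → g w v * ev A₁ (suc k) cls w))
      ≈⟨ ∑-cong ws (λ w → trans (sym (∑-*ʳ (range m) _ (g w))) (*-congʳ (choices w))) ⟩
    ∑ ws (λ w → f (card (openU (suc k) cls w)) * ev A₁ (suc k) cls w)
      ≈⟨ ∑-cong ws (λ w → ev-balance {cls = cls} w f (s≤s z≤n) e′ (bA₁ cv)) ⟩
    ∑ ws (λ w → f (card A₁) * ev A₁ (suc k) cls w)
      ≈⟨ ∑-*ˡ ws (f (card A₁)) _ ⟨
    f (card A₁) * ∑ ws (ev A₁ (suc k) cls)
      ≈⟨ *-congˡ (sum-ev A₁ (suc k) cls (s≤s z≤n) e′ (bA₁ cv)) ⟩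
    f (card A₁) * Φ (card A₁) (suc k) cls
      ≡⟨ cong (λ h → f h * Φ h (suc k) cls) (count-addIf cv k∈ Ak) ⟩
    Φ (card A) k ((false , cv) ∷ cls) ∎
    where
    open Step {c = false , cv} {cls} 1≤k e bA
    ws = words m (length cls)
    A₁ = addIf cv k A
    f : ℕ → Carrier
    f h = ranks (arcw false cv) h + [ not cv ]· fixw k h
    g : List ℕ → ℕ → Carrier
    g w v = [ addIf (not cv) k (openU (suc k) cls w) v ]· locU cv k (openU (suc k) cls w) v
    choices : ∀ w → ∑ (range m) (g w) ≈ f (card (openU (suc k) cls w))
    choices w = trans (choice-sum m (not cv) k (openU (suc k) cls w) (flip (arcw false cv)) _ k∈ (Bk w))
      (+-congʳ (ranks-flip (arcw false cv) (card (openU (suc k) cls w))))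

-- Permutations, their inverses and the balance of arcs.

module Permutations where
  open ≡ using (refl; sym; trans; module ≡-Reasoning)
  open import Data.Nat using (_+_)

  -- The conditions are confined to 1, ..., m, so the junk values of `app` and `inv` never matter.
  -- Being symmetric in `s` and `t`, the notion serves a permutation and its inverse alike.
  record PermPair (m : ℕ) (s t : ℕ → ℕ) : Set where
    field
      s-range : ∀ {i} → InRange m i → InRange m (s i)
      t-range : ∀ {i} → InRange m i → InRange m (t i)
      t∘s     : ∀ {i} → InRange m i → t (s i) ≡ i
      s∘t     : ∀ {i} → InRange m i → s (t i) ≡ i

    s-injective : ∀ {i j} → InRange m i → InRange m j → s i ≡ s j → i ≡ j
    s-injective i∈ j∈ e = trans (sym (t∘s i∈)) (trans (cong t e) (t∘s j∈))

  flipPair : ∀ {m s t} → PermPair m s t → PermPair m t s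
  flipPair p = record { s-range = t-range ; t-range = s-range ; t∘s = s∘t ; s∘t = t∘s }
    where open PermPair p

  module _ {m s t} (p : PermPair m s t) where
    open PermPair p
    private
      open Sums ℕₚ.+-*-commutativeSemiring
      open Ranks ℕₚ.+-*-commutativeSemiring

      count-∑ : ∀ P xs → countᵇ P xs ≡ ∑ xs (λ x → [ P x ]· 1)
      count-∑ P []       = refl
      count-∑ P (x ∷ xs) = trans (count-∷ P x xs) (cong (b2n (P x) +_) (count-∑ P xs))

      pick : ∀ {b c} → c ≡ true → [ b ∧ c ]· 1 ≡ [ b ]· 1
      pick {true}  refl = refl
      pick {false} refl = refl

      drop : ∀ b {c} → c ≡ false → [ b ∧ c ]· 1 ≡ 0
      drop true  refl = refl
      drop false refl = refl

    -- Double counting of the pairs `(i , j)` with `j = s i` and `Q j`.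
    count-reindex : ∀ (Q : Pred) → countᵇ (Q ∘ s) (range m) ≡ countᵇ Q (range m)
    count-reindex Q = begin
      countᵇ (Q ∘ s) (range m)
        ≡⟨ count-∑ (Q ∘ s) (range m) ⟩
      ∑ (range m) (λ i → [ Q (s i) ]· 1)
        ≡⟨ ∑-cong-range m (λ i i∈ → sym (trans
             (∑-range-δ m (s i) (λ j → [ Q j ∧ (j ≡ᵇ s i) ]· 1) (s-range i∈) (λ j _ j≢ → drop (Q j) (≡ᵇ-false j≢)))
             (pick {Q (s i)} (≡ᵇ-true {s i} refl)))) ⟩
      ∑ (range m) (λ i → ∑ (range m) (λ j → [ Q j ∧ (j ≡ᵇ s i) ]· 1))
        ≡⟨ ∑-swap (range m) (range m) _ ⟩
      ∑ (range m) (λ j → ∑ (range m) (λ i → [ Q j ∧ (j ≡ᵇ s i) ]· 1))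
        ≡⟨ ∑-cong-range m (λ j j∈ → trans (∑-cong-range m (λ i i∈ → cong (λ b → [ Q j ∧ b ]· 1) (solve-for i∈ j∈)))
             (trans (∑-range-δ m (t j) (λ i → [ Q j ∧ (i ≡ᵇ t j) ]· 1) (t-range j∈) (λ i _ i≢ →
                 drop (Q j) (≡ᵇ-false i≢)))
               (pick {Q j} (≡ᵇ-true {t j} refl)))) ⟩
      ∑ (range m) (λ j → [ Q j ]· 1)
        ≡⟨ count-∑ Q (range m) ⟨
      countᵇ Q (range m) ∎
      where
      open ≡-Reasoning
      solve-for : ∀ {i j} → InRange m i → InRange m j → (j ≡ᵇ s i) ≡ (i ≡ᵇ t j)
      solve-for {i} {j} i∈ j∈ = bool-ext
        (λ e → ≡ᵇ-true (sym (trans (cong t (≡ᵇ-true⁻¹ {j} e)) (t∘s i∈))))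
        (λ e → ≡ᵇ-true (sym (trans (cong s (≡ᵇ-true⁻¹ {i} e)) (s∘t j∈))))

    -- Positions below `k` and values below `k` are equally many. Discarding the arcs that stay
    -- below `k` leaves the arcs that cross upward on one side and those that cross downward on the
    -- other.
    arcs-balance : ∀ k →
      countᵇ (λ i → (i <ᵇ k) ∧ (k ≤ᵇ s i)) (range m) ≡ countᵇ (λ i → (k ≤ᵇ i) ∧ (s i <ᵇ k)) (range m)
    arcs-balance k = ℕₚ.+-cancelʳ-≡ (countᵇ both (range m)) _ _ (begin
      countᵇ (λ i → (i <ᵇ k) ∧ (k ≤ᵇ s i)) (range m) + countᵇ both (range m)
        ≡⟨ count-+ (λ i → splitʳ (i <ᵇ k) (s i)) (range m) ⟨
      countᵇ (_<ᵇ k) (range m)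
        ≡⟨ count-reindex (_<ᵇ k) ⟨
      countᵇ (λ i → s i <ᵇ k) (range m)
        ≡⟨ count-+ (λ i → splitˡ (s i <ᵇ k) i) (range m) ⟩
      countᵇ (λ i → (k ≤ᵇ i) ∧ (s i <ᵇ k)) (range m) + countᵇ both (range m) ∎)
      where
      open ≡-Reasoning
      both : Pred
      both i = (i <ᵇ k) ∧ (s i <ᵇ k)
      k≤ᵇ : ∀ j → (k ≤ᵇ j) ≡ not (j <ᵇ k)
      k≤ᵇ j with j <ᵇ k in e
      ... | true  = <ᵇ-false {k} {suc j} (<ᵇ-true⁻¹ e)
      ... | false = <ᵇ-true {k} {suc j} (s≤s (<ᵇ-false⁻¹ {j} e))
      splitʳ : ∀ b j → b2n b ≡ b2n (b ∧ (k ≤ᵇ j)) + b2n (b ∧ (j <ᵇ k))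
      splitʳ b j rewrite k≤ᵇ j with b | j <ᵇ k
      ... | true  | true  = refl
      ... | true  | false = refl
      ... | false | true  = refl
      ... | false | false = refl
      splitˡ : ∀ b j → b2n b ≡ b2n ((k ≤ᵇ j) ∧ b) + b2n ((j <ᵇ k) ∧ b)
      splitˡ b j rewrite k≤ᵇ j with b | j <ᵇ k
      ... | true  | true  = refl
      ... | true  | false = refl
      ... | false | true  = refl
      ... | false | false = refl

  allB-interval : ∀ P k len → allB P (interval k len) ≡ true → ∀ j → k ≤ j → j < k + len → P j ≡ true
  allB-interval P k zero      h j k≤j j< = ⊥-elim (ℕₚ.<⇒≱ j< (subst (_≤ j) (sym (ℕₚ.+-identityʳ k)) k≤j))
  allB-interval P k (suc len) h j k≤j j< with k ℕ.≟ j
  ... | yes refl = proj₁ (∧-true h)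
  ... | no k≢j = allB-interval P (suc k) len (proj₂ (∧-true {P k} h)) j (ℕₚ.≤∧≢⇒< k≤j k≢j)
      (subst (j <_) (ℕₚ.+-suc k len) j<)

  allB-interval⁻ : ∀ P k len → (∀ j → k ≤ j → j < k + len → P j ≡ true) → allB P (interval k len) ≡ true
  allB-interval⁻ P k zero      h = refl
  allB-interval⁻ P k (suc len) h = ∧-intro (h k ℕₚ.≤-refl (ℕₚ.m<m+n k (s≤s z≤n)))
    (allB-interval⁻ P (suc k) len (λ j k<j j< → h j (ℕₚ.<⇒≤ k<j) (subst (j <_) (sym (ℕₚ.+-suc k len)) j<)))

  allB-elim : ∀ {P} m → allB P (range m) ≡ true → ∀ {j} → InRange m j → P j ≡ true
  allB-elim {P} m h {j} (1≤j , j≤m) rewrite range≡interval m = allB-interval P 1 m h j 1≤j (s≤s j≤m)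

  allB-intro : ∀ {P} m → (∀ {j} → InRange m j → P j ≡ true) → allB P (range m) ≡ true
  allB-intro {P} m h rewrite range≡interval m = allB-interval⁻ P 1 m (λ j 1≤j j< → h (1≤j , ℕₚ.≤-pred j<))

  app-All : ∀ {P : ℕ → Set} {w i} → All P w → InRange (length w) i → P (app w i)
  app-All {i = suc zero}    (px ∷ pw) i∈ = px
  app-All {i = suc (suc i)} (px ∷ pw) (_ , s≤s i≤) = app-All pw (s≤s z≤n , i≤)

  find-app : ∀ {j} w → 1 ≤ countᵇ (j ≡ᵇ_) w → ∃[ i ] (InRange (length w) i × app w i ≡ j)
  find-app {j} (x ∷ w) h with j ≡ᵇ x in e
  ... | true  = 1 , (s≤s z≤n , s≤s z≤n) , sym (≡ᵇ-true⁻¹ {j} e)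
  ... | false with find-app w (subst (1 ≤_) (count-head (j ≡ᵇ_) x w e)
      (subst (1 ≤_) (sym (count-head (j ≡ᵇ_) x w e)) h))
  ... | suc i , (1≤i , i≤) , eq = suc (suc i) , (s≤s z≤n , s≤s i≤) , eq

  app-counted : ∀ {j i} w → InRange (length w) i → app w i ≡ j → 1 ≤ countᵇ (j ≡ᵇ_) w
  app-counted {j} {suc zero}    (x ∷ w) i∈ eq =
    subst (1 ≤_) (sym (count-head (j ≡ᵇ_) x w (≡ᵇ-true (sym eq)))) (s≤s z≤n)
  app-counted {j} {suc (suc i)} (x ∷ w) (_ , s≤s i≤) eq =
    subst (1 ≤_) (sym (count-∷ (j ≡ᵇ_) x w)) (ℕₚ.≤-trans (app-counted w (s≤s z≤n , i≤) eq) (ℕₚ.m≤n+m _ _))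

  app-injective : ∀ {j a b} w → countᵇ (j ≡ᵇ_) w ≡ 1 → InRange (length w) a → InRange (length w) b →
    app w a ≡ j → app w b ≡ j → a ≡ b
  app-injective {a = suc zero} {suc zero} (x ∷ w) c a∈ b∈ ea eb = refl
  app-injective {j} {suc zero} {suc (suc b)} (x ∷ w) c a∈ (_ , s≤s b≤) ea eb =
    ⊥-elim (ℕₚ.1+n≰n (subst (1 ≤_) (ℕₚ.suc-injective (trans (sym (count-head (j ≡ᵇ_) x w (≡ᵇ-true (sym ea)))) c))
      (app-counted w (s≤s z≤n , b≤) eb)))
  app-injective {j} {suc (suc a)} {suc zero} (x ∷ w) c (_ , s≤s a≤) b∈ ea eb =
    ⊥-elim (ℕₚ.1+n≰n (subst (1 ≤_) (ℕₚ.suc-injective (trans (sym (count-head (j ≡ᵇ_) x w (≡ᵇ-true (sym eb)))) c))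
      (app-counted w (s≤s z≤n , a≤) ea)))
  app-injective {j} {suc (suc a)} {suc (suc b)} (x ∷ w) c (_ , s≤s a≤) (_ , s≤s b≤) ea eb =
    cong suc (app-injective w c′ (s≤s z≤n , a≤) (s≤s z≤n , b≤) ea eb)
    where
    tail≥1 = app-counted w (s≤s z≤n , a≤) ea
    c′ : countᵇ (j ≡ᵇ_) w ≡ 1
    c′ = ℕₚ.≤-antisym (ℕₚ.≤-trans (ℕₚ.m≤n+m _ (b2n (j ≡ᵇ x)))
        (ℕₚ.≤-reflexive (trans (sym (count-∷ (j ≡ᵇ_) x w)) c))) tail≥1

  -- `inv` returns the first position found and 0 if there is none, so the existence of one position
  -- is all that the search depends on; uniqueness is a matter of `app-injective`.
  inv-spec : ∀ {w i j} → InRange (length w) j → app w j ≡ i → InRange (length w) (inv w i) × app w (inv w i) ≡ i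
  inv-spec {w} {i} {j} (1≤j , j≤) eq rewrite range≡interval (length w) = go 1 (length w) j ℕₚ.≤-refl ℕₚ.≤-refl
      1≤j (s≤s j≤) eq
    where
    search : ℕ → ℕ → ℕ
    search k len = foldr (λ j r → if app w j ≡ᵇ i then j else r) 0 (interval k len)
    go : ∀ k len j → 1 ≤ k → k + len ≤ suc (length w) → k ≤ j → j < k + len → app w j ≡ i →
      InRange (length w) (search k len) × app w (search k len) ≡ i
    go k zero      j 1≤k b k≤j j< eq = ⊥-elim (ℕₚ.<⇒≱ j< (subst (_≤ j) (sym (ℕₚ.+-identityʳ k)) k≤j))
    go k (suc len) j 1≤k b k≤j j< eq with app w k ≡ᵇ i in e
    ... | true = (1≤k , ℕₚ.≤-pred (ℕₚ.≤-trans (s≤s (ℕₚ.m≤m+n k len)) (subst (_≤ suc (length w))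
        (ℕₚ.+-suc k len) b))) , ≡ᵇ-true⁻¹ e
    ... | false = go (suc k) len j (s≤s z≤n) (subst (_≤ suc (length w)) (ℕₚ.+-suc k len) b)
      (ℕₚ.≤∧≢⇒< k≤j (λ { refl → ≡ᵇ-false⁻¹ e eq })) (subst (j <_) (ℕₚ.+-suc k len) j<) eq

  Word : ℕ → List ℕ → Set
  Word m w = length w ≡ m × All (InRange m) w

  permPair : ∀ {m w} → Word m w → isPerm m w ≡ true → PermPair m (app w) (inv w)
  permPair {w = w} (refl , entries) h = record
    { s-range = app-All entries
    ; t-range = λ i∈ → proj₁ (spec i∈)
    ; t∘s     = λ i∈ → app-injective w (once (app-All entries i∈)) (proj₁ (spec (app-All entries i∈))) i∈
                         (proj₂ (spec (app-All entries i∈))) refl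
    ; s∘t     = λ i∈ → proj₂ (spec i∈)
    }
    where
    once : ∀ {j} → InRange (length w) j → countᵇ (j ≡ᵇ_) w ≡ 1
    once j∈ = ≡ᵇ-true⁻¹ (allB-elim (length w) h j∈)
    spec : ∀ {i} → InRange (length w) i → InRange (length w) (inv w i) × app w (inv w i) ≡ i
    spec i∈ with find-app w (ℕₚ.≤-reflexive (sym (once i∈)))
    ... | j , j∈ , eq = inv-spec {w} j∈ eq

  length-range : ∀ m → length (range m) ≡ m
  length-range m = trans (length-map suc (List.upTo m)) (length-upTo m)

  app-map-interval : ∀ f k len i → InRange len (suc i) → app (map f (interval k len)) (suc i) ≡ f (k + i)
  app-map-interval f k (suc len) zero    i∈ = cong f (sym (ℕₚ.+-identityʳ k))
  app-map-interval f k (suc len) (suc i) (_ , s≤s i≤) =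
    trans (app-map-interval f (suc k) len i (s≤s z≤n , i≤)) (cong f (sym (ℕₚ.+-suc k i)))

  app-map-range : ∀ f {m i} → InRange m i → app (map f (range m)) i ≡ f i
  app-map-range f {m} {suc i} i∈ rewrite range≡interval m = app-map-interval f 1 m i i∈

  app-ext : ∀ v w → length v ≡ length w → (∀ {i} → InRange (length v) i → app v i ≡ app w i) → v ≡ w
  app-ext []      []      e h = refl
  app-ext (x ∷ v) (y ∷ w) e h = cong₂ _∷_ (h (s≤s z≤n , s≤s z≤n))
    (app-ext v w (ℕₚ.suc-injective e) (λ { {suc i} (_ , i≤) → h (s≤s z≤n , s≤s i≤) }))

  invWord : ℕ → List ℕ → List ℕ
  invWord m w = map (inv w) (range m)

  count-map : ∀ P (f : ℕ → ℕ) xs → countᵇ P (map f xs) ≡ countᵇ (P ∘ f) xs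
  count-map P f []       = refl
  count-map P f (x ∷ xs) = trans (count-∷ P (f x) (map f xs))
    (trans (cong (b2n (P (f x)) +_) (count-map P f xs)) (sym (count-∷ (P ∘ f) x xs)))

  All-map-range : ∀ {P : ℕ → Set} f m → (∀ {i} → InRange m i → P (f i)) → All P (map f (range m))
  All-map-range {P} f m h rewrite range≡interval m = go 1 m (λ i 1≤i i< → h (1≤i , ℕₚ.≤-pred i<))
    where
    go : ∀ k len → (∀ i → k ≤ i → i < k + len → P (f i)) → All P (map f (interval k len))
    go k zero      h = []
    go k (suc len) h = h k ℕₚ.≤-refl (ℕₚ.m<m+n k (s≤s z≤n)) ∷
      go (suc k) len (λ i k<i i< → h i (ℕₚ.<⇒≤ k<i) (subst (i <_) (sym (ℕₚ.+-suc k len)) i<))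

  module _ {m w} (ww : Word m w) (h : isPerm m w ≡ true) where
    private p = permPair ww h
    open PermPair p

    invWord-word : Word m (invWord m w)
    invWord-word = trans (length-map (inv w) (range m)) (length-range m) , All-map-range (inv w) m t-range

    invWord-isPerm : isPerm m (invWord m w) ≡ true
    invWord-isPerm = allB-intro m λ {j} j∈ → ≡ᵇ-true (trans (count-map (j ≡ᵇ_) (inv w) (range m))
      (trans (count-cong m (λ i i∈ → bool-ext
         (λ e → ≡ᵇ-true (sym (trans (cong (app w) (≡ᵇ-true⁻¹ {j} e)) (s∘t i∈))))
         (λ e → ≡ᵇ-true (sym (trans (cong (inv w) (≡ᵇ-true⁻¹ {i} e)) (t∘s j∈))))))
        (count-≡ (s-range j∈))))

    app-invWord : ∀ {i} → InRange m i → app (invWord m w) i ≡ inv w i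
    app-invWord = app-map-range (inv w)

    inv-invWord : ∀ {i} → InRange m i → inv (invWord m w) i ≡ app w i
    inv-invWord {i} i∈ = trans (sym (s∘t (P′.t-range i∈)))
      (cong (app w) (trans (sym (app-invWord (P′.t-range i∈))) (P′.s∘t i∈)))
      where module P′ = PermPair (permPair invWord-word invWord-isPerm)

    invWord-involutive : invWord m (invWord m w) ≡ w
    invWord-involutive = app-ext _ _ (trans len (sym (proj₁ ww)))
      (λ {i} i∈ → let i∈m = subst (λ n → InRange n i) len i∈ in
        trans (app-map-range (inv (invWord m w)) i∈m) (inv-invWord i∈m))
      where
      len : length (invWord m (invWord m w)) ≡ m
      len = trans (length-map (inv (invWord m w)) (range m)) (length-range m)

  module _ (m : ℕ) where
    open Guard m

    -- At `k = 1` no D-value is open, and by `card-openU` no U-value either, so the balance in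
    -- `occurrences` is 1 for each value.
    admissible⇒isPerm : ∀ cls w → length cls ≡ m → admissible (λ _ → false) 1 cls w ≡ true → isPerm m w ≡ true
    admissible⇒isPerm cls w e ok = allB-intro m λ {j} j∈ → ≡ᵇ-true (begin
      countᵇ (j ≡ᵇ_) w                                ≡⟨ ℕₚ.+-identityʳ _ ⟨
      countᵇ (j ≡ᵇ_) w + 0                            ≡⟨ cong (λ b → countᵇ (j ≡ᵇ_) w + b2n b) (empty j∈) ⟨
      countᵇ (j ≡ᵇ_) w + b2n (openU 1 cls w j)        ≡⟨ occurrences 1 cls w ℕₚ.≤-refl (cong suc e) none j∈ ok ⟩
      b2n (1 ≤ᵇ j)                                    ≡⟨ cong b2n (<ᵇ-true {1} {suc j} (s≤s (proj₁ j∈))) ⟩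
      1                                               ∎)
      where
      open ≡-Reasoning
      none : Below 1 (λ _ → false)
      none u ()
      empty : ∀ {j} → InRange m j → openU 1 cls w j ≡ false
      empty = count-0⇒false {S = openU 1 cls w} (trans (card-openU 1 cls w ℕₚ.≤-refl (cong suc e) none ok)
          (count-false (λ _ → refl) (range m)))

open Permutations

-- The open values of a permutation as the arcs across a gap.

addIf-elim : ∀ c k S v → addIf c k S v ≡ true → (v ≡ k × c ≡ true) ⊎ S v ≡ true
addIf-elim false k S v h = inj₂ h
addIf-elim true  k S v h with v ≡ᵇ k in e
... | true  = inj₁ (≡ᵇ-true⁻¹ e , ≡.refl)
... | false = inj₂ h

addIf-intro : ∀ c k S v → (v ≡ k → c ≡ true) → (v ≢ k → S v ≡ true) → addIf c k S v ≡ true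
addIf-intro false k S v h₁ h₂ with v ℕ.≟ k
... | yes v≡k = true≢false (h₁ v≡k) ≡.refl
... | no  v≢k = h₂ v≢k
addIf-intro true  k S v h₁ h₂ with v ≡ᵇ k in e
... | true  = ≡.refl
... | false = h₂ (≡ᵇ-false⁻¹ e)

addIf-cong : ∀ c k {S S′} v → S v ≡ S′ v → addIf c k S v ≡ addIf c k S′ v
addIf-cong true  k v e = cong ((v ≡ᵇ k) ∨_) e
addIf-cong false k v e = e

del-elim : ∀ x S v → del x S v ≡ true → v ≢ x × S v ≡ true
del-elim x S v h = ≡ᵇ-false⁻¹ (not-true (proj₁ (∧-true h))) , proj₂ (∧-true {not (v ≡ᵇ x)} h)

del-intro : ∀ x S v → v ≢ x → S v ≡ true → del x S v ≡ true
del-intro x S v v≢x h = ∧-intro (cong not (≡ᵇ-false v≢x)) h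

module Closed {m s t} (p : PermPair m s t) (cp cv : Pred)
  (respects : ∀ {i} → InRange m i → Guard.Placed m cv (cp i) i (s i)) where
  open PermPair p
  open Guard m

  -- The downward and the upward arcs across the gap between k-1 and k, recorded by their values. A
  -- strict displacement determines the class, so inequalities alone describe the open D-values and
  -- U-values.
  gapD gapU : ℕ → Pred
  gapD k v = (v <ᵇ k) ∧ (k ≤ᵇ t v)
  gapU k v = (k ≤ᵇ v) ∧ (t v <ᵇ k)

  down : ∀ {i} → InRange m i → cp i ≡ true → s i ≤ i × cv (s i) ≡ true
  down i∈ e = subst (λ b → Placed cv b _ _) e (respects i∈)

  up : ∀ {i} → InRange m i → cp i ≡ false → i ≤ s i × cv (s i) ≡ false
  up i∈ e = subst (λ b → Placed cv b _ _) e (respects i∈)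

  class-t : ∀ {v} → InRange m v → cp (t v) ≡ cv v
  class-t {v} v∈ with cp (t v) in e
  ... | true  = ≡.trans (≡.sym (proj₂ (down (t-range v∈) e))) (cong cv (s∘t v∈))
  ... | false = ≡.trans (≡.sym (proj₂ (up (t-range v∈) e))) (cong cv (s∘t v∈))

  cvD⇒ : ∀ {v} → InRange m v → cv v ≡ true → v ≤ t v
  cvD⇒ v∈ e = subst (_≤ t _) (s∘t v∈) (proj₁ (down (t-range v∈) (≡.trans (class-t v∈) e)))

  cvU⇒ : ∀ {v} → InRange m v → cv v ≡ false → t v ≤ v
  cvU⇒ v∈ e = subst (t _ ≤_) (s∘t v∈) (proj₁ (up (t-range v∈) (≡.trans (class-t v∈) e)))

  -- Strictness matters here and in the next lemma: a fixed value may have either class.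
  cvD⇐ : ∀ {v} → InRange m v → v < t v → cv v ≡ true
  cvD⇐ {v} v∈ v<tv with cv v in e
  ... | true  = ≡.refl
  ... | false = ⊥-elim (ℕₚ.<⇒≱ v<tv (cvU⇒ v∈ e))

  cvU⇐ : ∀ {v} → InRange m v → t v < v → cv v ≡ false
  cvU⇐ {v} v∈ tv<v with cv v in e
  ... | true  = ⊥-elim (ℕₚ.<⇒≱ tv<v (cvD⇒ v∈ e))
  ... | false = ≡.refl

  gapD-elim : ∀ {k v} → gapD k v ≡ true → v < k × k ≤ t v
  gapD-elim {k} {v} h = <ᵇ-true⁻¹ (proj₁ (∧-true h)) , ≤ᵇ-true⁻¹ {k} {t v} (proj₂ (∧-true {v <ᵇ k} h))

  gapU-elim : ∀ {k v} → gapU k v ≡ true → k ≤ v × t v < k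
  gapU-elim {k} {v} h = ≤ᵇ-true⁻¹ {k} {v} (proj₁ (∧-true h)) , <ᵇ-true⁻¹ (proj₂ (∧-true {k ≤ᵇ v} h))

  gapD-intro : ∀ {k v} → v < k → k ≤ t v → gapD k v ≡ true
  gapD-intro a b = ∧-intro (<ᵇ-true a) (≤ᵇ-true b)

  gapU-intro : ∀ {k v} → k ≤ v → t v < k → gapU k v ≡ true
  gapU-intro a b = ∧-intro (≤ᵇ-true a) (<ᵇ-true b)

  t≢ : ∀ {k v} → InRange m v → v ≢ s k → t v ≢ k
  t≢ v∈ v≢ ≡.refl = v≢ (≡.sym (s∘t v∈))

  v≢s : ∀ {k v} → InRange m k → t v ≢ k → v ≢ s k
  v≢s k∈ tv≢ ≡.refl = tv≢ (t∘s k∈)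

  -- This and the next three lemmas match one reading step with a move of the gap by one place: the
  -- value `k` enters if it has the class of the gap, and the value `s k` leaves if the position `k`
  -- has that class.
  gapU-D : ∀ {k v} → InRange m k → InRange m v → cp k ≡ true →
    addIf (not (cv k)) k (gapU (suc k)) v ≡ gapU k v
  gapU-D {k} {v} k∈ v∈ ek = bool-ext fwd bwd
    where
    fwd : addIf (not (cv k)) k (gapU (suc k)) v ≡ true → gapU k v ≡ true
    fwd h with addIf-elim (not (cv k)) k (gapU (suc k)) v h
    ... | inj₁ (≡.refl , nc) = gapU-intro ℕₚ.≤-refl (ℕₚ.≤∧≢⇒< (cvU⇒ k∈ (not-true nc))
            -- A fixed point would here be a D-position that holds a U-value.
            (λ tk≡k → true≢false ek (≡.trans (cong cp (≡.sym tk≡k)) (≡.trans (class-t k∈) (not-true nc)))))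
    ... | inj₂ g = let k<v , tv≤k = gapU-elim {suc k} {v} g in
            gapU-intro (ℕₚ.<⇒≤ k<v) (ℕₚ.≤∧≢⇒< (ℕₚ.≤-pred tv≤k)
              (λ { ≡.refl → ℕₚ.<⇒≱ k<v (subst (_≤ t v) (s∘t v∈) (proj₁ (down k∈ ek))) }))
    bwd : gapU k v ≡ true → addIf (not (cv k)) k (gapU (suc k)) v ≡ true
    bwd h = let k≤v , tv<k = gapU-elim {k} {v} h in addIf-intro (not (cv k)) k (gapU (suc k)) v
      (λ { ≡.refl → cong not (cvU⇐ k∈ tv<k) })
      (λ v≢k → gapU-intro (ℕₚ.≤∧≢⇒< k≤v (v≢k ∘ ≡.sym)) (ℕₚ.m<n⇒m<1+n tv<k))

  gapU-U : ∀ {k v} → InRange m k → InRange m v → cp k ≡ false →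
    del (s k) (addIf (not (cv k)) k (gapU (suc k))) v ≡ gapU k v
  gapU-U {k} {v} k∈ v∈ ek = bool-ext fwd bwd
    where
    S = addIf (not (cv k)) k (gapU (suc k))
    fwd : del (s k) S v ≡ true → gapU k v ≡ true
    fwd h with del-elim (s k) S v h
    ... | v≢ , h′ with addIf-elim (not (cv k)) k (gapU (suc k)) v h′
    ... | inj₁ (≡.refl , nc) = gapU-intro ℕₚ.≤-refl (ℕₚ.≤∧≢⇒< (cvU⇒ k∈ (not-true nc)) (t≢ k∈ v≢))
    ... | inj₂ g = let k<v , tv≤k = gapU-elim {suc k} {v} g in
            gapU-intro (ℕₚ.<⇒≤ k<v) (ℕₚ.≤∧≢⇒< (ℕₚ.≤-pred tv≤k) (t≢ v∈ v≢))
    bwd : gapU k v ≡ true → del (s k) S v ≡ true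
    bwd h = let k≤v , tv<k = gapU-elim {k} {v} h in
      del-intro (s k) S v (v≢s k∈ (ℕₚ.<⇒≢ tv<k)) (addIf-intro (not (cv k)) k (gapU (suc k)) v
        (λ { ≡.refl → cong not (cvU⇐ k∈ tv<k) })
        (λ v≢k → gapU-intro (ℕₚ.≤∧≢⇒< k≤v (v≢k ∘ ≡.sym)) (ℕₚ.m<n⇒m<1+n tv<k)))

  gapD-D : ∀ {k v} → InRange m k → InRange m v → cp k ≡ true →
    del (s k) (addIf (cv k) k (gapD k)) v ≡ gapD (suc k) v
  gapD-D {k} {v} k∈ v∈ ek = bool-ext fwd bwd
    where
    S = addIf (cv k) k (gapD k)
    fwd : del (s k) S v ≡ true → gapD (suc k) v ≡ true
    fwd h with del-elim (s k) S v h
    ... | v≢ , h′ with addIf-elim (cv k) k (gapD k) v h′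
    ... | inj₁ (≡.refl , c) = gapD-intro ℕₚ.≤-refl (ℕₚ.≤∧≢⇒< (cvD⇒ k∈ c) (t≢ k∈ v≢ ∘ ≡.sym))
    ... | inj₂ g = let v<k , k≤tv = gapD-elim {k} {v} g in
            gapD-intro (ℕₚ.m<n⇒m<1+n v<k) (ℕₚ.≤∧≢⇒< k≤tv (t≢ v∈ v≢ ∘ ≡.sym))
    bwd : gapD (suc k) v ≡ true → del (s k) S v ≡ true
    bwd h = let v≤k , k<tv = gapD-elim {suc k} {v} h in
      del-intro (s k) S v (v≢s k∈ (ℕₚ.>⇒≢ k<tv)) (addIf-intro (cv k) k (gapD k) v
        (λ { ≡.refl → cvD⇐ k∈ k<tv })
        (λ v≢k → gapD-intro (ℕₚ.≤∧≢⇒< (ℕₚ.≤-pred v≤k) v≢k) (ℕₚ.<⇒≤ k<tv)))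

  gapD-U : ∀ {k v} → InRange m k → InRange m v → cp k ≡ false →
    addIf (cv k) k (gapD k) v ≡ gapD (suc k) v
  gapD-U {k} {v} k∈ v∈ ek = bool-ext fwd bwd
    where
    fwd : addIf (cv k) k (gapD k) v ≡ true → gapD (suc k) v ≡ true
    fwd h with addIf-elim (cv k) k (gapD k) v h
    ... | inj₁ (≡.refl , c) = gapD-intro ℕₚ.≤-refl (ℕₚ.≤∧≢⇒< (cvD⇒ k∈ c)
            (λ k≡tk → true≢false c (≡.trans (≡.sym (class-t k∈)) (≡.trans (cong cp (≡.sym k≡tk)) ek))))
    ... | inj₂ g = let v<k , k≤tv = gapD-elim {k} {v} g in
            gapD-intro (ℕₚ.m<n⇒m<1+n v<k) (ℕₚ.≤∧≢⇒< k≤tv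
              (λ { ≡.refl → ℕₚ.<⇒≱ v<k (subst (t v ≤_) (s∘t v∈) (proj₁ (up k∈ ek))) }))
    bwd : gapD (suc k) v ≡ true → addIf (cv k) k (gapD k) v ≡ true
    bwd h = let v≤k , k<tv = gapD-elim {suc k} {v} h in addIf-intro (cv k) k (gapD k) v
      (λ { ≡.refl → cvD⇐ k∈ k<tv })
      (λ v≢k → gapD-intro (ℕₚ.≤∧≢⇒< (ℕₚ.≤-pred v≤k) v≢k) (ℕₚ.<⇒≤ k<tv))

  guardD : ∀ {k} → InRange m k → cp k ≡ true → addIf (cv k) k (gapD k) (s k) ≡ true
  guardD {k} k∈ ek = addIf-intro (cv k) k (gapD k) (s k)
    (λ sk≡k → ≡.trans (cong cv (≡.sym sk≡k)) (proj₂ (down k∈ ek)))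
    (λ sk≢k → gapD-intro (ℕₚ.≤∧≢⇒< (proj₁ (down k∈ ek)) sk≢k) (ℕₚ.≤-reflexive (≡.sym (t∘s k∈))))

  guardU : ∀ {k} → InRange m k → cp k ≡ false → addIf (not (cv k)) k (gapU (suc k)) (s k) ≡ true
  guardU {k} k∈ ek = addIf-intro (not (cv k)) k (gapU (suc k)) (s k)
    (λ sk≡k → cong not (≡.trans (cong cv (≡.sym sk≡k)) (proj₂ (up k∈ ek))))
    (λ sk≢k → gapU-intro (ℕₚ.≤∧≢⇒< (proj₁ (up k∈ ek)) (sk≢k ∘ ≡.sym)) (s≤s (ℕₚ.≤-reflexive (t∘s k∈))))

  Suffix : ℕ → ℕ → List ℕ → Set
  Suffix k len w = length w ≡ len × (∀ i → i < len → app w (suc i) ≡ s (k ℕ.+ i))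

  suffix-tail : ∀ {k len v w} → Suffix k (suc len) (v ∷ w) → Suffix (suc k) len w
  suffix-tail {k} (l , h) = ℕₚ.suc-injective l , λ i i< → ≡.trans (h (suc i) (s≤s i<)) (cong s (ℕₚ.+-suc k i))

  suffix-head : ∀ {k len v w} → Suffix k (suc len) (v ∷ w) → v ≡ s k
  suffix-head {k} (_ , h) = ≡.trans (h 0 (s≤s z≤n)) (cong s (ℕₚ.+-identityʳ k))

  k-range : ∀ {k len} → 1 ≤ k → k ℕ.+ suc len ≡ suc m → InRange m k
  k-range {k} {len} 1≤k e = 1≤k , ℕₚ.≤-pred (ℕₚ.≤-trans (s≤s (ℕₚ.m≤m+n k len))
      (ℕₚ.≤-reflexive (≡.trans (≡.sym (ℕₚ.+-suc k len)) e)))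

  openU-gap : ∀ k len w → 1 ≤ k → k ℕ.+ len ≡ suc m → Suffix k len w → ∀ {v} → InRange m v →
    openU k (classes cp cv k len) w v ≡ gapU k v
  openU-gap k zero [] 1≤k e sf {v} v∈ =
    ≡.sym (cong (_∧ (t v <ᵇ k)) (<ᵇ-false {k} {suc v} (subst (suc v ≤_) (≡.trans (≡.sym e) (ℕₚ.+-identityʳ k))
        (s≤s (proj₂ v∈)))))
  openU-gap k (suc len) (x ∷ w) 1≤k e sf {v} v∈
    with cp k in ek | openU-gap (suc k) len w (s≤s z≤n) (≡.trans (≡.sym (ℕₚ.+-suc k len)) e) (suffix-tail {k} sf) v∈
  ... | true  | ih = ≡.trans (addIf-cong (not (cv k)) k v ih) (gapU-D (k-range 1≤k e) v∈ ek)
  ... | false | ih rewrite suffix-head {k} sf =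
    ≡.trans (cong (not (v ≡ᵇ s k) ∧_) (addIf-cong (not (cv k)) k v ih)) (gapU-U (k-range 1≤k e) v∈ ek)

  module _ {c ℓ} (R : CommutativeSemiring c ℓ)
    (arcw : Bool → Bool → ℕ → ℕ → CommutativeSemiring.Carrier R)
    (fixw : ℕ → ℕ → CommutativeSemiring.Carrier R) where
    open CommutativeSemiring R hiding (zero)
    open Poly R using (Π)
    open Sums R
    open Eval R arcw fixw m

    -- A D-position looks at the gap before `i`, a U-position at the gap after it, so the value `i`
    -- itself is never among the open values.
    factor : ℕ → Carrier
    factor i = if cp i then locD (cv i) i (gapD i) (s i) else locU (cv i) i (gapU (suc i)) (s i)

    private
      _≗_ : Pred → Pred → Set
      S ≗ S′ = ∀ {v} → InRange m v → S v ≡ S′ v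

      locD-cong : ∀ {S S′} c k v → S ≗ S′ → locD c k S v ≡ locD c k S′ v
      locD-cong c k v e with v ≡ᵇ k
      ... | true  = cong (fixw k) (count-cong m (λ u u∈ → e u∈))
      ... | false = cong₂ (arcw true c) (count-cong m (λ u u∈ → cong (_∧ (v <ᵇ u)) (e u∈)))
                                        (count-cong m (λ u u∈ → cong (_∧ (u <ᵇ v)) (e u∈)))

      locU-cong : ∀ {S S′} c k v → S ≗ S′ → locU c k S v ≡ locU c k S′ v
      locU-cong c k v e with v ≡ᵇ k
      ... | true  = cong (fixw k) (count-cong m (λ u u∈ → e u∈))
      ... | false = cong₂ (arcw false c) (count-cong m (λ u u∈ → cong (_∧ (u <ᵇ v)) (e u∈)))
                                         (count-cong m (λ u u∈ → cong (_∧ (v <ᵇ u)) (e u∈)))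

      guarded : ∀ {b x y} → b ≡ true → x ≡ y → [ b ]· x ≡ y
      guarded ≡.refl e = e

    -- Once the open sets are gaps they no longer depend on the course of the reading, and the
    -- weight factors over the indices. Agreement of `A` with the gap is asked for on 1, ..., m
    -- only, the range that the counts see.
    ev-closed : ∀ A k len w → 1 ≤ k → k ℕ.+ len ≡ suc m → Suffix k len w → A ≗ gapD k →
      ev A k (classes cp cv k len) w ≈ Π (map factor (interval k len))
    ev-closed A k zero [] 1≤k e sf A≗ = reflexive (cong (λ n → [ n ≡ᵇ 0 ]· 1#) (count-≡0 m closed))
      where
      closed : ∀ v → InRange m v → A v ≡ false
      closed v v∈ with A v in Av
      ... | false = ≡.refl
      ... | true = ⊥-elim (ℕₚ.1+n≰n (subst (_≤ m) (≡.trans (≡.sym (ℕₚ.+-identityʳ k)) e)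
                    (ℕₚ.≤-trans (proj₂ (gapD-elim {k} {v} (≡.trans (≡.sym (A≗ v∈)) Av))) (proj₂ (t-range v∈)))))
    ev-closed A k (suc len) (x ∷ w) 1≤k e sf A≗
      rewrite suffix-head {k} sf with cp k in ek
    ... | true = *-cong
        (reflexive (guarded (≡.trans (addIf-cong (cv k) k (s k) (A≗ (s-range k∈))) (guardD k∈ ek))
                            (locD-cong (cv k) k (s k) A≗)))
        (ev-closed _ (suc k) len w (s≤s z≤n) e′ (suffix-tail {k} sf)
          (λ {v} v∈ → ≡.trans (cong (not (v ≡ᵇ s k) ∧_) (addIf-cong (cv k) k v (A≗ v∈))) (gapD-D k∈ v∈ ek)))
      where
      k∈ = k-range {k} 1≤k e
      e′ = ≡.trans (≡.sym (ℕₚ.+-suc k len)) e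
    ... | false = *-cong
        (reflexive (guarded (≡.trans (addIf-cong (not (cv k)) k (s k) (B≗ (s-range k∈))) (guardU k∈ ek))
                            (locU-cong (cv k) k (s k) B≗)))
        (ev-closed _ (suc k) len w (s≤s z≤n) e′ (suffix-tail {k} sf)
          (λ {v} v∈ → ≡.trans (addIf-cong (cv k) k v (A≗ v∈)) (gapD-U k∈ v∈ ek)))
      where
      k∈ = k-range {k} 1≤k e
      e′ = ≡.trans (≡.sym (ℕₚ.+-suc k len)) e
      B≗ : openU (suc k) (classes cp cv (suc k) len) w ≗ gapU (suc k)
      B≗ = openU-gap (suc k) len w (s≤s z≤n) e′ (suffix-tail {k} sf)

    ev-factors : ∀ w → length w ≡ m → (∀ {i} → InRange m i → app w i ≡ s i) →
      ev (λ _ → false) 1 (classes cp cv 1 m) w ≈ Π (map factor (range m))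
    ev-factors w l h = trans
      (ev-closed (λ _ → false) 1 m w ℕₚ.≤-refl ≡.refl (l , λ i i< → h (s≤s z≤n , i<))
        (λ {v} v∈ → ≡.sym (cong (_∧ (1 ≤ᵇ t v)) (<ᵇ-false {v} {1} (proj₁ v∈)))))
      (reflexive (cong (λ xs → Π (map factor xs)) (≡.sym (range≡interval m))))

-- Records, crossings and nestings in terms of arcs across a gap.

module ArcStatistics where
  open ≡ using (refl; sym; trans; module ≡-Reasoning)

  and3-elim : ∀ a b c d e f → (a <ᵇ b) ∧ (c <ᵇ d) ∧ (e <ᵇ f) ≡ true → a < b × c < d × e < f
  and3-elim a b c d e f h =
    <ᵇ-true⁻¹ (proj₁ (∧-true h)) , <ᵇ-true⁻¹ (proj₁ (∧-true h′)) , <ᵇ-true⁻¹ (proj₂ (∧-true {c <ᵇ d} h′))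
    where h′ = proj₂ (∧-true {a <ᵇ b} h)

  and3-intro : ∀ {a b c d e f} → a < b → c < d → e < f → (a <ᵇ b) ∧ (c <ᵇ d) ∧ (e <ᵇ f) ≡ true
  and3-intro p q r = ∧-intro (<ᵇ-true p) (∧-intro (<ᵇ-true q) (<ᵇ-true r))

  and21-elim : ∀ a b c d e f → ((a <ᵇ b) ∧ (c <ᵇ d)) ∧ (e <ᵇ f) ≡ true → a < b × c < d × e < f
  and21-elim a b c d e f h =
    <ᵇ-true⁻¹ (proj₁ (∧-true h′)) , <ᵇ-true⁻¹ (proj₂ (∧-true {a <ᵇ b} h′)) , <ᵇ-true⁻¹
        (proj₂ (∧-true {(a <ᵇ b) ∧ (c <ᵇ d)} h))
    where h′ = proj₁ (∧-true h)

  and21-intro : ∀ {a b c d e f} → a < b → c < d → e < f → ((a <ᵇ b) ∧ (c <ᵇ d)) ∧ (e <ᵇ f) ≡ true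
  and21-intro p q r = ∧-intro (∧-intro (<ᵇ-true p) (<ᵇ-true q)) (<ᵇ-true r)

  and2-elim : ∀ a b c d → (a <ᵇ b) ∧ (c <ᵇ d) ≡ true → a < b × c < d
  and2-elim a b c d h = <ᵇ-true⁻¹ (proj₁ (∧-true h)) , <ᵇ-true⁻¹ (proj₂ (∧-true {a <ᵇ b} h))

  and2-intro : ∀ {a b c d} → a < b → c < d → (a <ᵇ b) ∧ (c <ᵇ d) ≡ true
  and2-intro p q = ∧-intro (<ᵇ-true p) (<ᵇ-true q)

  allB-count : ∀ {P Q : Pred} m → (∀ {j} → InRange m j → Q j ≡ not (P j)) → allB Q (range m) ≡
      (countᵇ P (range m) ≡ᵇ 0)
  allB-count {P} {Q} m h = bool-ext
    (λ all → ≡ᵇ-true (count-≡0 m (λ j j∈ → not-true (trans (sym (h j∈)) (allB-elim m all j∈)))))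
    (λ none → allB-intro m (λ j∈ → trans (h j∈)
        (cong not (count-0⇒false {S = P} (≡ᵇ-true⁻¹ {countᵇ P (range m)} none) j∈))))

  -- The bridge between the implication that a record has to satisfy and the counterexample that a
  -- nesting statistic counts.
  imp≡not : ∀ {a b P} → (P ≡ true → a ≡ true × b ≡ false) → (a ≡ true → b ≡ false → P ≡ true) → not a ∨ b ≡ not P
  imp≡not {true}  {true}  {true}  f g = proj₂ (f refl)
  imp≡not {true}  {true}  {false} f g = refl
  imp≡not {true}  {false} {true}  f g = refl
  imp≡not {true}  {false} {false} f g = g refl refl
  imp≡not {false} {b}     {true}  f g = sym (proj₁ (f refl))
  imp≡not {false} {b}     {false} f g = refl

  module Facts (σ : List ℕ) (p : PermPair (length σ) (app σ) (inv σ)) where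
    open PermPair p
    open Stats σ using (m; rec; arec; psnest; lcross; lnest; ucross; unest; lcross'; lnest'; ucross'; unest')
    private
      s = app σ
      t = inv σ

      gap : ∀ {a b} → InRange m a → InRange m b → s a ≤ s b → a ≢ b → s a < s b
      gap a∈ b∈ le ne = ℕₚ.≤∧≢⇒< le (ne ∘ s-injective a∈ b∈)

      t-flip : ∀ {a b} → InRange m a → InRange m b → t b ≢ a → s a ≢ b
      t-flip a∈ b∈ ne refl = ne (t∘s a∈)

    -- By the balance of arcs: one arc goes down across the gap before `k`, the one at `k`, so some
    -- earlier position has a value at least `k`, which is larger than `s k`.
    rec-below : ∀ {k} → InRange m k → s k < k → rec k ≡ false
    rec-below {k} k∈ sk<k with rec k in r
    ... | false = refl
    ... | true  = true≢false (∧-intro (≤ᵇ-true (ℕₚ.≤-refl {k})) (<ᵇ-true sk<k)) (count-0⇒false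
      {S = λ i → (k ≤ᵇ i) ∧ (s i <ᵇ k)} (trans (sym (arcs-balance p k)) (count-≡0 m none)) k∈)
      where
      none : ∀ j → InRange m j → (j <ᵇ k) ∧ (k ≤ᵇ s j) ≡ false
      none j j∈ = ¬-not λ h → let j<k , k<sj = and2-elim j k k (suc (s j)) h in
        ℕₚ.<⇒≱ sk<k (ℕₚ.≤-trans (ℕₚ.≤-pred k<sj)
            (ℕₚ.<⇒≤ (<ᵇ-true⁻¹ {s j} {s k} (subst (λ b → not b ∨ (s j <ᵇ s k) ≡ true) (<ᵇ-true j<k)
            (allB-elim m r j∈)))))

    -- The mirror image at the gap after `k`: the upward arc at `k` forces a later position with a
    -- value at most `k`.
    arec-above : ∀ {k} → InRange m k → k < s k → arec k ≡ false
    arec-above {k} k∈ k<sk with arec k in r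
    ... | false = refl
    ... | true  = true≢false (∧-intro (<ᵇ-true (ℕₚ.≤-refl {suc k})) (≤ᵇ-true k<sk)) (count-0⇒false
      {S = λ i → (i <ᵇ suc k) ∧ (suc k ≤ᵇ s i)} (trans (arcs-balance p (suc k)) (count-≡0 m none)) k∈)
      where
      none : ∀ j → InRange m j → (suc k ≤ᵇ j) ∧ (s j <ᵇ suc k) ≡ false
      none j j∈ = ¬-not λ h → let k<j , sj≤k = and2-elim (suc k) (suc j) (s j) (suc k) h in
        ℕₚ.<⇒≱ k<sk (ℕₚ.≤-trans (ℕₚ.<⇒≤ (<ᵇ-true⁻¹ {s k} {s j} (subst (λ b → not b ∨ (s k <ᵇ s j) ≡ true)
            (<ᵇ-true (ℕₚ.≤-pred k<j)) (allB-elim m r j∈)))) (ℕₚ.≤-pred sj≤k))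

    psnest-up : ∀ {k} → InRange m k → s k ≡ k → countᵇ (λ i → (i <ᵇ k) ∧ (k ≤ᵇ s i)) (range m) ≡ psnest k
    psnest-up {k} k∈ fx = count-cong m λ i i∈ → bool-ext
      (λ h → let i<k , k≤si = and2-elim i k k (suc (s i)) h in
         and2-intro i<k (ℕₚ.≤∧≢⇒< (ℕₚ.≤-pred k≤si) (λ k≡si →
             ℕₚ.<⇒≢ i<k (s-injective i∈ k∈ (trans (sym k≡si) (sym fx))))))
      (λ h → let i<k , k<si = and2-elim i k k (s i) h in and2-intro i<k (ℕₚ.m<n⇒m<1+n k<si))

    psnest-down : ∀ {k} → InRange m k → s k ≡ k → countᵇ (λ i → (k <ᵇ i) ∧ (s i <ᵇ k)) (range m) ≡ psnest k
    psnest-down {k} k∈ fx = trans (count-cong m (λ i i∈ → bool-ext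
      (λ h → let k<i , si<k = and2-elim k i (s i) k h in and2-intro (ℕₚ.m<n⇒m<1+n k<i) si<k)
      (λ h → let k≤i , si<k = and2-elim k (suc i) (s i) k h in
         and2-intro (ℕₚ.≤∧≢⇒< (ℕₚ.≤-pred k≤i) (λ { refl → ℕₚ.<⇒≢ si<k fx })) si<k)))
      (trans (sym (arcs-balance p k)) (psnest-up k∈ fx))

    rec-fix : ∀ {k} → InRange m k → s k ≡ k → rec k ≡ (psnest k ≡ᵇ 0)
    rec-fix {k} k∈ fx = allB-count m λ {j} j∈ → imp≡not
      (λ h → let j<k , k<sj = and2-elim j k k (s j) h in
         <ᵇ-true j<k , <ᵇ-false (subst (_≤ s j) (sym fx) (ℕₚ.<⇒≤ k<sj)))
      (λ a b → and2-intro (<ᵇ-true⁻¹ {j} {k} a) (subst (_< s j) fx (gap k∈ j∈ (<ᵇ-false⁻¹ {s j} b)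
          (ℕₚ.>⇒≢ (<ᵇ-true⁻¹ {j} a)))))

    -- By the balance of arcs, `psnest` counts the downward arcs around the fixed point as well. A
    -- fixed point is thus a record exactly when it is an antirecord, and it is never exclusive.
    arec-fix : ∀ {k} → InRange m k → s k ≡ k → arec k ≡ (psnest k ≡ᵇ 0)
    arec-fix {k} k∈ fx = trans (allB-count m λ {j} j∈ → imp≡not
      (λ h → let k<j , sj<k = and2-elim k j (s j) k h in
         <ᵇ-true k<j , <ᵇ-false (subst (s j ≤_) (sym fx) (ℕₚ.<⇒≤ sj<k)))
      (λ a b → and2-intro (<ᵇ-true⁻¹ {k} {j} a) (subst (s j <_) fx (gap j∈ k∈ (<ᵇ-false⁻¹ {s k} b)
          (ℕₚ.>⇒≢ (<ᵇ-true⁻¹ {k} a))))))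
      (cong (_≡ᵇ 0) (psnest-down k∈ fx))

    -- The height that weighs a fixed point is its `psnest`, whichever of the two gaps beside it and
    -- whichever direction of arcs is used. The variant `height-U′` is the one read through the
    -- inverse permutation.
    height-D : ∀ {k} → InRange m k → s k ≡ k → countᵇ (λ v → (v <ᵇ k) ∧ (k ≤ᵇ t v)) (range m) ≡ psnest k
    height-D {k} k∈ fx = trans (sym (count-reindex p (λ v → (v <ᵇ k) ∧ (k ≤ᵇ t v))))
      (trans (count-cong m (λ i i∈ → trans (cong (λ x → (s i <ᵇ k) ∧ (k ≤ᵇ x)) (t∘s i∈)) (bool-ext
         (λ h → let si<k , k≤i = and2-elim (s i) k k (suc i) h in
            and2-intro (ℕₚ.≤∧≢⇒< (ℕₚ.≤-pred k≤i) (λ { refl → ℕₚ.<⇒≢ si<k fx })) si<k)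
         (λ h → let k<i , si<k = and2-elim k i (s i) k h in and2-intro si<k (ℕₚ.m<n⇒m<1+n k<i)))))
       (psnest-down k∈ fx))

    height-U : ∀ {k} → InRange m k → s k ≡ k → countᵇ (λ v → (suc k ≤ᵇ v) ∧ (t v <ᵇ suc k)) (range m) ≡ psnest k
    height-U {k} k∈ fx = trans (sym (count-reindex p (λ v → (suc k ≤ᵇ v) ∧ (t v <ᵇ suc k))))
      (count-cong m (λ i i∈ → trans (cong (λ x → (suc k ≤ᵇ s i) ∧ (x <ᵇ suc k)) (t∘s i∈)) (bool-ext
         (λ h → let k<si , i≤k = and2-elim (suc k) (suc (s i)) i (suc k) h in
            and2-intro (ℕₚ.≤∧≢⇒< (ℕₚ.≤-pred i≤k) (λ { refl → ℕₚ.>⇒≢ (ℕₚ.≤-pred k<si) fx })) (ℕₚ.≤-pred k<si))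
         (λ h → let i<k , k<si = and2-elim i k k (s i) h in and2-intro (s≤s k<si) (ℕₚ.m<n⇒m<1+n i<k)))))

    height-U′ : ∀ {k} → InRange m k → s k ≡ k → countᵇ (λ v → (suc k ≤ᵇ v) ∧ (s v <ᵇ suc k)) (range m) ≡ psnest k
    height-U′ {k} k∈ fx = trans (count-cong m (λ i i∈ → bool-ext
      (λ h → let k<i , si≤k = and2-elim (suc k) (suc i) (s i) (suc k) h in
         and2-intro (ℕₚ.≤-pred k<i) (subst (s i <_) fx (gap i∈ k∈ (subst (s i ≤_) (sym fx) (ℕₚ.≤-pred si≤k))
             (ℕₚ.>⇒≢ (ℕₚ.≤-pred k<i)))))
      (λ h → let k<i , si<k = and2-elim k i (s i) k h in and2-intro (s≤s k<i) (ℕₚ.m<n⇒m<1+n si<k))))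
      (psnest-down k∈ fx)

    module _ {k} (k∈ : InRange m k) (sk<k : s k < k) where

      -- A later value smaller than `s k` is also below `k`, so the counterexamples to an antirecord
      -- are exactly the arcs nested around this one.
      arec-lnest : arec k ≡ (lnest k ≡ᵇ 0)
      arec-lnest = allB-count m λ {l} l∈ → imp≡not
        (λ h → let sl<sk , _ , k<l = and3-elim (s l) (s k) (s k) k k l h in <ᵇ-true k<l , <ᵇ-false (ℕₚ.<⇒≤ sl<sk))
        (λ a b → and3-intro (gap l∈ k∈ (<ᵇ-false⁻¹ {s k} b) (ℕₚ.>⇒≢ (<ᵇ-true⁻¹ {k} a))) sk<k (<ᵇ-true⁻¹ {k} {l} a))

      -- Open sets consist of values, whereas `lcross` counts positions; `count-reindex` passes from
      -- one to the other.
      above-lcross : above m (λ v → (v <ᵇ k) ∧ (k ≤ᵇ t v)) (s k) ≡ lcross k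
      above-lcross = trans (sym (count-reindex p (λ v → ((v <ᵇ k) ∧ (k ≤ᵇ t v)) ∧ (s k <ᵇ v))))
        (count-cong m (λ l l∈ → trans (cong (λ x → ((s l <ᵇ k) ∧ (k ≤ᵇ x)) ∧ (s k <ᵇ s l)) (t∘s l∈)) (bool-ext
          (λ h → let sl<k , k≤l , sk<sl = and21-elim (s l) k k (suc l) (s k) (s l) h in
             and3-intro sk<sl sl<k (ℕₚ.≤∧≢⇒< (ℕₚ.≤-pred k≤l) (λ { refl → ℕₚ.<-irrefl refl sk<sl })))
          (λ h → let sk<sl , sl<k , k<l = and3-elim (s k) (s l) (s l) k k l h in
             and21-intro sl<k (ℕₚ.m<n⇒m<1+n k<l) sk<sl))))

      below-lnest : below m (λ v → (v <ᵇ k) ∧ (k ≤ᵇ t v)) (s k) ≡ lnest k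
      below-lnest = trans (sym (count-reindex p (λ v → ((v <ᵇ k) ∧ (k ≤ᵇ t v)) ∧ (v <ᵇ s k))))
        (count-cong m (λ l l∈ → trans (cong (λ x → ((s l <ᵇ k) ∧ (k ≤ᵇ x)) ∧ (s l <ᵇ s k)) (t∘s l∈)) (bool-ext
          (λ h → let sl<k , k≤l , sl<sk = and21-elim (s l) k k (suc l) (s l) (s k) h in
             and3-intro sl<sk sk<k (ℕₚ.≤∧≢⇒< (ℕₚ.≤-pred k≤l) (λ { refl → ℕₚ.<-irrefl refl sl<sk })))
          (λ h → let sl<sk , _ , k<l = and3-elim (s l) (s k) (s k) k k l h in
             and21-intro (ℕₚ.<-trans sl<sk sk<k) (ℕₚ.m<n⇒m<1+n k<l) sl<sk))))

    module _ {k} (k∈ : InRange m k) (k<sk : k < s k) where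

      rec-unest : rec k ≡ (unest k ≡ᵇ 0)
      rec-unest = allB-count m λ {i} i∈ → imp≡not
        (λ h → let i<k , _ , sk<si = and3-elim i k k (s k) (s k) (s i) h in <ᵇ-true i<k , <ᵇ-false (ℕₚ.<⇒≤ sk<si))
        (λ a b → and3-intro (<ᵇ-true⁻¹ {i} {k} a) k<sk (gap k∈ i∈ (<ᵇ-false⁻¹ {s i} b) (ℕₚ.>⇒≢ (<ᵇ-true⁻¹ {i} a))))

      below-ucross : below m (λ v → (suc k ≤ᵇ v) ∧ (t v <ᵇ suc k)) (s k) ≡ ucross k
      below-ucross = trans (sym (count-reindex p (λ v → ((suc k ≤ᵇ v) ∧ (t v <ᵇ suc k)) ∧ (v <ᵇ s k))))
        (count-cong m (λ i i∈ → trans (cong (λ x → ((suc k ≤ᵇ s i) ∧ (x <ᵇ suc k)) ∧ (s i <ᵇ s k)) (t∘s i∈))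
            (bool-ext
          (λ h → let k<si , i≤k , si<sk = and21-elim (suc k) (suc (s i)) i (suc k) (s i) (s k) h in
             and3-intro (ℕₚ.≤∧≢⇒< (ℕₚ.≤-pred i≤k) (λ { refl → ℕₚ.<-irrefl refl si<sk })) (ℕₚ.≤-pred k<si) si<sk)
          (λ h → let i<k , k<si , si<sk = and3-elim i k k (s i) (s i) (s k) h in
             and21-intro (s≤s k<si) (ℕₚ.m<n⇒m<1+n i<k) si<sk))))

      above-unest : above m (λ v → (suc k ≤ᵇ v) ∧ (t v <ᵇ suc k)) (s k) ≡ unest k
      above-unest = trans (sym (count-reindex p (λ v → ((suc k ≤ᵇ v) ∧ (t v <ᵇ suc k)) ∧ (s k <ᵇ v))))
        (count-cong m (λ i i∈ → trans (cong (λ x → ((suc k ≤ᵇ s i) ∧ (x <ᵇ suc k)) ∧ (s k <ᵇ s i)) (t∘s i∈))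
            (bool-ext
          (λ h → let k<si , i≤k , sk<si = and21-elim (suc k) (suc (s i)) i (suc k) (s k) (s i) h in
             and3-intro (ℕₚ.≤∧≢⇒< (ℕₚ.≤-pred i≤k) (λ { refl → ℕₚ.<-irrefl refl sk<si })) k<sk sk<si)
          (λ h → let i<k , _ , sk<si = and3-elim i k k (s k) (s k) (s i) h in
             and21-intro (s≤s (ℕₚ.<-trans k<sk sk<si)) (ℕₚ.m<n⇒m<1+n i<k) sk<si))))

    module _ {k} (k∈ : InRange m k) (tk<k : t k < k) where

      -- The primed statistics test the record at the position `t k` that carries the value `k`.
      -- Since `s (t k)` is `k`, an earlier larger value is an arc that encloses the arc ending at
      -- `k`.
      rec-unest' : rec (t k) ≡ (unest' k ≡ᵇ 0)
      rec-unest' = allB-count m λ {i} i∈ → imp≡not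
        (λ h → let i<tk , _ , k<si = and3-elim i (t k) (t k) k k (s i) h in
           <ᵇ-true i<tk , <ᵇ-false (subst (_≤ s i) (sym (s∘t k∈)) (ℕₚ.<⇒≤ k<si)))
        (λ a b → and3-intro (<ᵇ-true⁻¹ {i} {t k} a) tk<k
           (subst (_< s i) (s∘t k∈) (gap (t-range k∈) i∈ (<ᵇ-false⁻¹ {s i} b) (ℕₚ.>⇒≢ (<ᵇ-true⁻¹ {i} a)))))

      -- Read through the inverse, open values are positions of σ, so here the two counts are
      -- compared index by index.
      above-ucross' : above m (λ v → (v <ᵇ k) ∧ (k ≤ᵇ s v)) (t k) ≡ ucross' k
      above-ucross' = count-cong m λ j j∈ → bool-ext
        (λ h → let j<k , k≤sj , tk<j = and21-elim j k k (suc (s j)) (t k) j h in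
           and3-intro tk<j j<k (ℕₚ.≤∧≢⇒< (ℕₚ.≤-pred k≤sj) (t-flip j∈ k∈ (ℕₚ.<⇒≢ tk<j) ∘ sym)))
        (λ h → let tk<j , j<k , k<sj = and3-elim (t k) j j k k (s j) h in and21-intro j<k (ℕₚ.m<n⇒m<1+n k<sj) tk<j)

      below-unest' : below m (λ v → (v <ᵇ k) ∧ (k ≤ᵇ s v)) (t k) ≡ unest' k
      below-unest' = count-cong m λ i i∈ → bool-ext
        (λ h → let i<k , k≤si , i<tk = and21-elim i k k (suc (s i)) i (t k) h in
           and3-intro i<tk tk<k (ℕₚ.≤∧≢⇒< (ℕₚ.≤-pred k≤si) (t-flip i∈ k∈ (ℕₚ.>⇒≢ i<tk) ∘ sym)))
        (λ h → let i<tk , _ , k<si = and3-elim i (t k) (t k) k k (s i) h in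
           and21-intro (ℕₚ.<-trans i<tk tk<k) (ℕₚ.m<n⇒m<1+n k<si) i<tk)

    module _ {k} (k∈ : InRange m k) (k<tk : k < t k) where

      arec-lnest' : arec (t k) ≡ (lnest' k ≡ᵇ 0)
      arec-lnest' = allB-count m λ {l} l∈ → imp≡not
        (λ h → let sl<k , _ , tk<l = and3-elim (s l) k k (t k) (t k) l h in
           <ᵇ-true tk<l , <ᵇ-false (subst (s l ≤_) (sym (s∘t k∈)) (ℕₚ.<⇒≤ sl<k)))
        (λ a b → and3-intro
           (subst (s l <_) (s∘t k∈) (gap l∈ (t-range k∈) (<ᵇ-false⁻¹ {s (t k)} b)
               (ℕₚ.>⇒≢ (<ᵇ-true⁻¹ {t k} a)))) k<tk (<ᵇ-true⁻¹ {t k} {l} a))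

      below-lcross' : below m (λ v → (suc k ≤ᵇ v) ∧ (s v <ᵇ suc k)) (t k) ≡ lcross' k
      below-lcross' = count-cong m λ j j∈ → bool-ext
        (λ h → let k<j , sj≤k , j<tk = and21-elim (suc k) (suc j) (s j) (suc k) j (t k) h in
           and3-intro (ℕₚ.≤∧≢⇒< (ℕₚ.≤-pred sj≤k) (t-flip j∈ k∈ (ℕₚ.>⇒≢ j<tk))) (ℕₚ.≤-pred k<j) j<tk)
        (λ h → let sj<k , k<j , j<tk = and3-elim (s j) k k j j (t k) h in and21-intro (s≤s k<j)
            (ℕₚ.m<n⇒m<1+n sj<k) j<tk)

      above-lnest' : above m (λ v → (suc k ≤ᵇ v) ∧ (s v <ᵇ suc k)) (t k) ≡ lnest' k
      above-lnest' = count-cong m λ l l∈ → bool-ext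
        (λ h → let k<l , sl≤k , tk<l = and21-elim (suc k) (suc l) (s l) (suc k) (t k) l h in
           and3-intro (ℕₚ.≤∧≢⇒< (ℕₚ.≤-pred sl≤k) (t-flip l∈ k∈ (ℕₚ.<⇒≢ tk<l))) k<tk tk<l)
        (λ h → let sl<k , _ , tk<l = and3-elim (s l) k k (t k) (t k) l h in
           and21-intro (s≤s (ℕₚ.<-trans k<tk tk<l)) (ℕₚ.m<n⇒m<1+n sl<k) tk<l)

open ArcStatistics

-- Weights as products of local factors.

module Products {c ℓ} (R : CommutativeSemiring c ℓ) where
  open CommutativeSemiring R hiding (zero)
  open Poly R using (Π; _^_)
  private module *S = Algebra.Properties.CommutativeSemigroup *-commutativeSemigroup

  ∏ : {A : Set} → List A → (A → Carrier) → Carrier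
  ∏ xs f = Π (map f xs)

  ∏-cong-interval : ∀ {f g} k len → (∀ v → k ≤ v → v < k ℕ.+ len → f v ≈ g v) →
    ∏ (interval k len) f ≈ ∏ (interval k len) g
  ∏-cong-interval k zero      e = refl
  ∏-cong-interval k (suc len) e = *-cong (e k ℕₚ.≤-refl (ℕₚ.m<m+n k (s≤s z≤n)))
    (∏-cong-interval (suc k) len (λ v k<v v< → e v (ℕₚ.<⇒≤ k<v) (subst (v <_) (≡.sym (ℕₚ.+-suc k len)) v<)))

  ∏-cong-range : ∀ {f g} m → (∀ {v} → InRange m v → f v ≈ g v) → ∏ (range m) f ≈ ∏ (range m) g
  ∏-cong-range m e rewrite range≡interval m = ∏-cong-interval 1 m (λ v 1≤v v< → e (1≤v , ℕₚ.≤-pred v<))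

  ^-+ : ∀ x a b → x ^ (a ℕ.+ b) ≈ x ^ a * x ^ b
  ^-+ x zero    b = sym (*-identityˡ _)
  ^-+ x (suc a) b = trans (*-congˡ (^-+ x a b)) (sym (*-assoc _ _ _))

  -- A factor x ^ s of a weight, where s counts the indices satisfying P or sums f over them.
  data Item : Set c where
    counting : Pred → Carrier → Item
    summing  : Pred → (ℕ → ℕ) → Carrier → Item

  total : List ℕ → Item → Carrier
  total xs (counting P x)  = x ^ countᵇ P xs
  total xs (summing P f x) = x ^ sumℕ (map f (List.filterᵇ P xs))

  opt : Bool → Carrier → Maybe Carrier
  opt b x = if b then just x else nothing

  at : ℕ → Item → Maybe Carrier
  at k (counting P x)  = opt (P k) x
  at k (summing P f x) = opt (P k) (x ^ f k)

  -- Skipping trivial factors lets a product reduce once its conditions are known.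
  Πᵐ : List (Maybe Carrier) → Carrier
  Πᵐ []             = 1#
  Πᵐ (just x ∷ ys)  = x * Πᵐ ys
  Πᵐ (nothing ∷ ys) = Πᵐ ys

  local : List Item → ℕ → Carrier
  local items k = Πᵐ (map (at k) items)

  local-∷ : ∀ i items xs → ∏ xs (local (i ∷ items)) ≈ total xs i * ∏ xs (local items)
  local-∷ (counting P x)  items []       = sym (*-identityʳ _)
  local-∷ (counting P x)  items (k ∷ xs) with P k | local-∷ (counting P x) items xs
  ... | true  | ih = trans (*-congˡ ih) (*S.interchange _ _ _ _)
  ... | false | ih = trans (*-congˡ ih) (*S.x∙yz≈y∙xz _ _ _)
  local-∷ (summing P f x) items []       = sym (*-identityʳ _)
  local-∷ (summing P f x) items (k ∷ xs) with P k | local-∷ (summing P f x) items xs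
  ... | true  | ih = trans (*-congˡ ih) (trans (*S.interchange _ _ _ _) (*-congʳ (sym (^-+ x (f k) _))))
  ... | false | ih = trans (*-congˡ ih) (*S.x∙yz≈y∙xz _ _ _)

  -- All statistics run over the same indices, so the product over the statistics and the product
  -- over the indices can be exchanged.
  Π-total : ∀ items xs → Π (map (total xs) items) ≈ ∏ xs (local items)
  Π-total []          []       = refl
  Π-total []          (k ∷ xs) = trans (Π-total [] xs) (sym (*-identityˡ _))
  Π-total (i ∷ items) xs       = trans (*-congˡ (Π-total items xs)) (sym (local-∷ i items xs))

module LocalWeights {c ℓ} (R : CommutativeSemiring c ℓ) (V : Vars R) where
  open CommutativeSemiring R hiding (zero)
  open Poly R using (_^_)
  open Vars V
  open Ranks R using (arc)
  open Products R
  private module *S = Algebra.Properties.CommutativeSemigroup *-commutativeSemigroup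

  -- For π = σ a D-position moves down and a D-value comes from a larger position. The four clauses
  -- are therefore cycle peaks, double falls, valleys and double rises.
  arcw : Bool → Bool → ℕ → ℕ → Carrier
  arcw true  false = arc p₋₁ q₋₁ x₁ u₁
  arcw true  true  = arc p₋₂ q₋₂ x₂ u₂
  arcw false true  = arc p₊₁ q₊₁ y₁ v₁
  arcw false false = arc p₊₂ q₊₂ y₂ v₂

  -- A fixed point under no arc is a record-antirecord and carries `z`; under any arc it is neither
  -- and carries `w` and its `psnest`.
  fixw : ℕ → ℕ → Carrier
  fixw k h = if isEven k then (if h ≡ᵇ 0 then zₑ else sₑ ^ h * wₑ) else (if h ≡ᵇ 0 then zₒ else sₒ ^ h * wₒ)

  private
    toArc : ∀ {P Q x} → x * (P * (Q * 1#)) ≈ P * (Q * x)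
    toArc = trans (*S.x∙yz≈y∙xz _ _ _) (*-congˡ (trans (*-congˡ (*-identityʳ _)) (*-comm _ _)))

    toFix₀ : ∀ {z} → z * (1# * 1#) ≈ z
    toFix₀ = trans (*-congˡ (*-identityˡ _)) (*-identityʳ _)

    toFix : ∀ {w s} → w * (s * 1#) ≈ s * w
    toFix = trans (*-congˡ (*-identityʳ _)) (*-comm _ _)

  items : List ℕ → List Item
  items σ =
      counting (λ i → earec i ∧ cpeak i) x₁ ∷ counting (λ i → earec i ∧ cdfall i) x₂
    ∷ counting (λ i → erec i ∧ cval i) y₁ ∷ counting (λ i → erec i ∧ cdrise i) y₂
    ∷ counting (λ i → nr i ∧ cpeak i) u₁ ∷ counting (λ i → nr i ∧ cdfall i) u₂
    ∷ counting (λ i → nr i ∧ cval i) v₁ ∷ counting (λ i → nr i ∧ cdrise i) v₂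
    ∷ counting (λ i → fix i ∧ isEven i ∧ nr i) wₑ ∷ counting (λ i → fix i ∧ not (isEven i) ∧ nr i) wₒ
    ∷ counting (λ i → isEven i ∧ rar i) zₑ ∷ counting (λ i → not (isEven i) ∧ rar i) zₒ
    ∷ summing cpeak lcross p₋₁ ∷ summing cdfall lcross p₋₂ ∷ summing cval ucross p₊₁ ∷ summing cdrise ucross p₊₂
    ∷ summing cpeak lnest q₋₁ ∷ summing cdfall lnest q₋₂ ∷ summing cval unest q₊₁ ∷ summing cdrise unest q₊₂
    ∷ summing (λ j → fix j ∧ isEven j) psnest sₑ ∷ summing (λ j → fix j ∧ not (isEven j)) psnest sₒ ∷ []
    where open Stats σ

  items' : List ℕ → List Item
  items' σ =
      counting (λ i → cpeak i ∧ rec (s⁻¹ i)) x₁ ∷ counting (λ i → cdfall i ∧ arec (s⁻¹ i)) x₂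
    ∷ counting (λ i → cval i ∧ arec (s⁻¹ i)) y₁ ∷ counting (λ i → cdrise i ∧ rec (s⁻¹ i)) y₂
    ∷ counting (λ i → cpeak i ∧ not (rec (s⁻¹ i))) u₁ ∷ counting (λ i → cdfall i ∧ not (arec (s⁻¹ i))) u₂
    ∷ counting (λ i → cval i ∧ not (arec (s⁻¹ i))) v₁ ∷ counting (λ i → cdrise i ∧ not (rec (s⁻¹ i))) v₂
    ∷ counting (λ i → fix i ∧ isEven i ∧ nr i) wₑ ∷ counting (λ i → fix i ∧ not (isEven i) ∧ nr i) wₒ
    ∷ counting (λ i → isEven i ∧ rar i) zₑ ∷ counting (λ i → not (isEven i) ∧ rar i) zₒ
    ∷ summing cpeak ucross' p₋₁ ∷ summing cdfall lcross' p₋₂ ∷ summing cval lcross' p₊₁ ∷ summing cdrise ucross' p₊₂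
    ∷ summing cpeak unest' q₋₁ ∷ summing cdfall lnest' q₋₂ ∷ summing cval lnest' q₊₁ ∷ summing cdrise unest' q₊₂
    ∷ summing (λ j → fix j ∧ isEven j) psnest sₑ ∷ summing (λ j → fix j ∧ not (isEven j)) psnest sₒ ∷ []
    where open Stats σ

  weight-local : ∀ σ → Poly.weight R V σ ≈ ∏ (range (length σ)) (local (items σ))
  weight-local σ = Π-total (items σ) (range (length σ))

  weight'-local : ∀ σ → Poly.weight' R V σ ≈ ∏ (range (length σ)) (local (items' σ))
  weight'-local σ = Π-total (items' σ) (range (length σ))

  -- The local products as functions of the truth values of
  -- t k < k, s k < k, k < t k, k < s k, s k = k (with t the inverse of s) and of the record status of k.
  module _ (t<k s<k k<t k<s fx r a e : Bool) (lc ln uc un ps : ℕ) where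
    private
      peak = t<k ∧ s<k
      val = k<t ∧ k<s
      drise = t<k ∧ k<s
      dfall = k<t ∧ s<k
      er = r ∧ not a
      ea = a ∧ not r
      n = not r ∧ not a

    sourceLocal : Carrier
    sourceLocal = Πᵐ
      ( opt (ea ∧ peak) x₁ ∷ opt (ea ∧ dfall) x₂ ∷ opt (er ∧ val) y₁ ∷ opt (er ∧ drise) y₂
      ∷ opt (n ∧ peak) u₁ ∷ opt (n ∧ dfall) u₂ ∷ opt (n ∧ val) v₁ ∷ opt (n ∧ drise) v₂
      ∷ opt (fx ∧ e ∧ n) wₑ ∷ opt (fx ∧ not e ∧ n) wₒ ∷ opt (e ∧ (r ∧ a)) zₑ ∷ opt (not e ∧ (r ∧ a)) zₒ
      ∷ opt peak (p₋₁ ^ lc) ∷ opt dfall (p₋₂ ^ lc) ∷ opt val (p₊₁ ^ uc) ∷ opt drise (p₊₂ ^ uc)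
      ∷ opt peak (q₋₁ ^ ln) ∷ opt dfall (q₋₂ ^ ln) ∷ opt val (q₊₁ ^ un) ∷ opt drise (q₊₂ ^ un)
      ∷ opt (fx ∧ e) (sₑ ^ ps) ∷ opt (fx ∧ not e) (sₒ ^ ps) ∷ [] )

  module _ (t<k s<k k<t k<s fx n ra tr ta e : Bool) (lc ln uc un ps : ℕ) where
    private
      peak = t<k ∧ s<k
      val = k<t ∧ k<s
      drise = t<k ∧ k<s
      dfall = k<t ∧ s<k

    targetLocal : Carrier
    targetLocal = Πᵐ
      ( opt (peak ∧ tr) x₁ ∷ opt (dfall ∧ ta) x₂ ∷ opt (val ∧ ta) y₁ ∷ opt (drise ∧ tr) y₂
      ∷ opt (peak ∧ not tr) u₁ ∷ opt (dfall ∧ not ta) u₂ ∷ opt (val ∧ not ta) v₁ ∷ opt (drise ∧ not tr) v₂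
      ∷ opt (fx ∧ e ∧ n) wₑ ∷ opt (fx ∧ not e ∧ n) wₒ ∷ opt (e ∧ ra) zₑ ∷ opt (not e ∧ ra) zₒ
      ∷ opt peak (p₋₁ ^ uc) ∷ opt dfall (p₋₂ ^ lc) ∷ opt val (p₊₁ ^ lc) ∷ opt drise (p₊₂ ^ uc)
      ∷ opt peak (q₋₁ ^ un) ∷ opt dfall (q₋₂ ^ ln) ∷ opt val (q₊₁ ^ ln) ∷ opt drise (q₊₂ ^ un)
      ∷ opt (fx ∧ e) (sₑ ^ ps) ∷ opt (fx ∧ not e) (sₒ ^ ps) ∷ [] )

  private variable
    t<k s<k k<t k<s fx r a e n ra tr ta : Bool

  -- Once the order of `k`, `s k` and `t k` is known, three factors survive: one record variable and
  -- the powers of `p` and `q`. The parity `e` is split so that the tests for record-antirecords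
  -- reduce.
  source-peak : ∀ lc ln uc un ps → t<k ≡ true → s<k ≡ true → k<t ≡ false → k<s ≡ false → fx ≡ false → r ≡
      false → a ≡ (ln ≡ᵇ 0) →
    sourceLocal t<k s<k k<t k<s fx r a e lc ln uc un ps ≈ arc p₋₁ q₋₁ x₁ u₁ lc ln
  source-peak {e = e} lc ln uc un ps ≡.refl ≡.refl ≡.refl ≡.refl ≡.refl ≡.refl ≡.refl with e | ln
  ... | true  | zero  = toArc
  ... | true  | suc _ = toArc
  ... | false | zero  = toArc
  ... | false | suc _ = toArc

  source-dfall : ∀ lc ln uc un ps → t<k ≡ false → s<k ≡ true → k<t ≡ true → k<s ≡ false → fx ≡ false → r ≡
      false → a ≡ (ln ≡ᵇ 0) →
    sourceLocal t<k s<k k<t k<s fx r a e lc ln uc un ps ≈ arc p₋₂ q₋₂ x₂ u₂ lc ln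
  source-dfall {e = e} lc ln uc un ps ≡.refl ≡.refl ≡.refl ≡.refl ≡.refl ≡.refl ≡.refl with e | ln
  ... | true  | zero  = toArc
  ... | true  | suc _ = toArc
  ... | false | zero  = toArc
  ... | false | suc _ = toArc

  source-val : ∀ lc ln uc un ps → t<k ≡ false → s<k ≡ false → k<t ≡ true → k<s ≡ true → fx ≡ false → a ≡
      false → r ≡ (un ≡ᵇ 0) →
    sourceLocal t<k s<k k<t k<s fx r a e lc ln uc un ps ≈ arc p₊₁ q₊₁ y₁ v₁ uc un
  source-val {e = e} lc ln uc un ps ≡.refl ≡.refl ≡.refl ≡.refl ≡.refl ≡.refl ≡.refl with e | un
  ... | true  | zero  = toArc
  ... | true  | suc _ = toArc
  ... | false | zero  = toArc
  ... | false | suc _ = toArc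

  source-drise : ∀ lc ln uc un ps → t<k ≡ true → s<k ≡ false → k<t ≡ false → k<s ≡ true → fx ≡ false → a ≡
      false → r ≡ (un ≡ᵇ 0) →
    sourceLocal t<k s<k k<t k<s fx r a e lc ln uc un ps ≈ arc p₊₂ q₊₂ y₂ v₂ uc un
  source-drise {e = e} lc ln uc un ps ≡.refl ≡.refl ≡.refl ≡.refl ≡.refl ≡.refl ≡.refl with e | un
  ... | true  | zero  = toArc
  ... | true  | suc _ = toArc
  ... | false | zero  = toArc
  ... | false | suc _ = toArc

  source-fix : ∀ k lc ln uc un ps → e ≡ isEven k →
    t<k ≡ false → s<k ≡ false → k<t ≡ false → k<s ≡ false → fx ≡ true → r ≡ (ps ≡ᵇ 0) → a ≡ (ps ≡ᵇ 0) →
    sourceLocal t<k s<k k<t k<s fx r a e lc ln uc un ps ≈ fixw k ps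
  source-fix k lc ln uc un ps ≡.refl ≡.refl ≡.refl ≡.refl ≡.refl ≡.refl ≡.refl ≡.refl with isEven k | ps
  ... | true  | zero  = toFix₀
  ... | true  | suc _ = toFix
  ... | false | zero  = toFix₀
  ... | false | suc _ = toFix

  target-peak : ∀ lc ln uc un ps → t<k ≡ true → s<k ≡ true → k<t ≡ false → k<s ≡ false → fx ≡ false → ra ≡
      false → tr ≡ (un ≡ᵇ 0) →
    targetLocal t<k s<k k<t k<s fx n ra tr ta e lc ln uc un ps ≈ arc p₋₁ q₋₁ x₁ u₁ uc un
  target-peak {e = e} lc ln uc un ps ≡.refl ≡.refl ≡.refl ≡.refl ≡.refl ≡.refl ≡.refl with e | un
  ... | true  | zero  = toArc
  ... | true  | suc _ = toArc
  ... | false | zero  = toArc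
  ... | false | suc _ = toArc

  target-dfall : ∀ lc ln uc un ps → t<k ≡ false → s<k ≡ true → k<t ≡ true → k<s ≡ false → fx ≡ false → ra ≡
      false → ta ≡ (ln ≡ᵇ 0) →
    targetLocal t<k s<k k<t k<s fx n ra tr ta e lc ln uc un ps ≈ arc p₋₂ q₋₂ x₂ u₂ lc ln
  target-dfall {e = e} lc ln uc un ps ≡.refl ≡.refl ≡.refl ≡.refl ≡.refl ≡.refl ≡.refl with e | ln
  ... | true  | zero  = toArc
  ... | true  | suc _ = toArc
  ... | false | zero  = toArc
  ... | false | suc _ = toArc

  target-val : ∀ lc ln uc un ps → t<k ≡ false → s<k ≡ false → k<t ≡ true → k<s ≡ true → fx ≡ false → ra ≡
      false → ta ≡ (ln ≡ᵇ 0) →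
    targetLocal t<k s<k k<t k<s fx n ra tr ta e lc ln uc un ps ≈ arc p₊₁ q₊₁ y₁ v₁ lc ln
  target-val {e = e} lc ln uc un ps ≡.refl ≡.refl ≡.refl ≡.refl ≡.refl ≡.refl ≡.refl with e | ln
  ... | true  | zero  = toArc
  ... | true  | suc _ = toArc
  ... | false | zero  = toArc
  ... | false | suc _ = toArc

  target-drise : ∀ lc ln uc un ps → t<k ≡ true → s<k ≡ false → k<t ≡ false → k<s ≡ true → fx ≡ false → ra ≡
      false → tr ≡ (un ≡ᵇ 0) →
    targetLocal t<k s<k k<t k<s fx n ra tr ta e lc ln uc un ps ≈ arc p₊₂ q₊₂ y₂ v₂ uc un
  target-drise {e = e} lc ln uc un ps ≡.refl ≡.refl ≡.refl ≡.refl ≡.refl ≡.refl ≡.refl with e | un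
  ... | true  | zero  = toArc
  ... | true  | suc _ = toArc
  ... | false | zero  = toArc
  ... | false | suc _ = toArc

  target-fix : ∀ k lc ln uc un ps → e ≡ isEven k →
    t<k ≡ false → s<k ≡ false → k<t ≡ false → k<s ≡ false → fx ≡ true → n ≡ not (ps ≡ᵇ 0) → ra ≡ (ps ≡ᵇ 0) →
    targetLocal t<k s<k k<t k<s fx n ra tr ta e lc ln uc un ps ≈ fixw k ps
  target-fix k lc ln uc un ps ≡.refl ≡.refl ≡.refl ≡.refl ≡.refl ≡.refl ≡.refl ≡.refl with isEven k | ps
  ... | true  | zero  = toFix₀
  ... | true  | suc _ = toFix
  ... | false | zero  = toFix₀
  ... | false | suc _ = toFix

-- Local factors compared with the factors of the transfer.

module ClosedFactors {m s t} (p : PermPair m s t) (cp cv : Pred)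
  (respects : ∀ {i} → InRange m i → Guard.Placed m cv (cp i) i (s i))
  {c ℓ} (R : CommutativeSemiring c ℓ)
  (arcw : Bool → Bool → ℕ → ℕ → CommutativeSemiring.Carrier R)
  (fixw : ℕ → ℕ → CommutativeSemiring.Carrier R) where
  open Guard m using (card)
  open Closed p cp cv respects public

  factors : ℕ → CommutativeSemiring.Carrier R
  factors = factor R arcw fixw

  factor-D : ∀ {k c x y} → cp k ≡ true → cv k ≡ c → s k ≢ k → above m (gapD k) (s k) ≡ x → below m (gapD k)
      (s k) ≡ y →
    factors k ≡ arcw true c x y
  factor-D {k} e ≡.refl ne ≡.refl ≡.refl rewrite e | ≡ᵇ-false ne = ≡.refl

  factor-U : ∀ {k c x y} → cp k ≡ false → cv k ≡ c → s k ≢ k →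
    below m (gapU (suc k)) (s k) ≡ x → above m (gapU (suc k)) (s k) ≡ y → factors k ≡ arcw false c x y
  factor-U {k} e ≡.refl ne ≡.refl ≡.refl rewrite e | ≡ᵇ-false ne = ≡.refl

  factor-fix : ∀ {k h} → s k ≡ k → card (gapD k) ≡ h → card (gapU (suc k)) ≡ h → factors k ≡ fixw k h
  factor-fix {k} e hD hU with cp k
  ... | true  rewrite ≡ᵇ-true e = cong (fixw k) hD
  ... | false rewrite ≡ᵇ-true e = cong (fixw k) hU

module Orders {m s t} (p : PermPair m s t) where
  open PermPair p

  t-moves : ∀ {k} → InRange m k → s k ≢ k → t k ≢ k
  t-moves k∈ ne e = ne (≡.trans (cong s (≡.sym e)) (s∘t k∈))

  t-fixes : ∀ {k} → InRange m k → s k ≡ k → t k ≡ k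
  t-fixes k∈ e = ≡.trans (cong t (≡.sym e)) (t∘s k∈)

<ᵇ-irrefl : ∀ {a b} → a ≡ b → (a <ᵇ b) ≡ false
<ᵇ-irrefl e = <ᵇ-false (ℕₚ.≤-reflexive (≡.sym e))

<ᵇ-asym : ∀ {a b} → a < b → (b <ᵇ a) ≡ false
<ᵇ-asym a<b = <ᵇ-false (ℕₚ.<⇒≤ a<b)

module _ {c ℓ} (R : CommutativeSemiring c ℓ) where
  open CommutativeSemiring R hiding (zero)
  open Products R using (local)

  module SourceLocal (V : Vars R) (σ : List ℕ) (p : PermPair (length σ) (app σ) (inv σ)) (cp cv : Pred)
    (respects : ∀ {i} → InRange (length σ) i → Guard.Placed (length σ) cv (cp i) i (app σ i)) where
    open LocalWeights R V
    open ClosedFactors p cp cv respects R arcw fixw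
    open Facts σ p
    open Orders p
    open Stats σ using (s; m; psnest; lcross; lnest; ucross; unest)

    local≈factor : ∀ {k} → InRange m k → local (items σ) k ≈ factors k
    local≈factor {k} k∈ with s k ℕ.≟ k
    ... | yes fx = trans
      (source-fix k (lcross k) (lnest k) (ucross k) (unest k) (psnest k) ≡.refl (<ᵇ-irrefl tk) (<ᵇ-irrefl fx)
          (<ᵇ-irrefl (≡.sym tk)) (<ᵇ-irrefl (≡.sym fx)) (≡ᵇ-true fx)
        (rec-fix k∈ fx) (arec-fix k∈ fx))
      (reflexive (≡.sym (factor-fix fx (height-D k∈ fx) (height-U k∈ fx))))
      where tk = t-fixes k∈ fx
    ... | no ne with bool-cases (cp k) | bool-cases (cv k)
    ... | inj₁ ecp | inj₁ ecv = trans
      (source-dfall (lcross k) (lnest k) (ucross k) (unest k) (psnest k) (<ᵇ-asym k<t) (<ᵇ-true s<k)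
          (<ᵇ-true k<t) (<ᵇ-asym s<k) (≡ᵇ-false ne) (rec-below k∈ s<k) (arec-lnest k∈ s<k))
      (reflexive (≡.sym (factor-D ecp ecv ne (above-lcross k∈ s<k) (below-lnest k∈ s<k))))
      where
      s<k = ℕₚ.≤∧≢⇒< (proj₁ (down k∈ ecp)) ne
      k<t = ℕₚ.≤∧≢⇒< (cvD⇒ k∈ ecv) (t-moves k∈ ne ∘ ≡.sym)
    ... | inj₁ ecp | inj₂ ecv = trans
      (source-peak (lcross k) (lnest k) (ucross k) (unest k) (psnest k) (<ᵇ-true t<k) (<ᵇ-true s<k)
          (<ᵇ-asym t<k) (<ᵇ-asym s<k) (≡ᵇ-false ne) (rec-below k∈ s<k) (arec-lnest k∈ s<k))
      (reflexive (≡.sym (factor-D ecp ecv ne (above-lcross k∈ s<k) (below-lnest k∈ s<k))))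
      where
      s<k = ℕₚ.≤∧≢⇒< (proj₁ (down k∈ ecp)) ne
      t<k = ℕₚ.≤∧≢⇒< (cvU⇒ k∈ ecv) (t-moves k∈ ne)
    ... | inj₂ ecp | inj₁ ecv = trans
      (source-val (lcross k) (lnest k) (ucross k) (unest k) (psnest k) (<ᵇ-asym k<t) (<ᵇ-asym k<s)
          (<ᵇ-true k<t) (<ᵇ-true k<s) (≡ᵇ-false ne) (arec-above k∈ k<s) (rec-unest k∈ k<s))
      (reflexive (≡.sym (factor-U ecp ecv ne (below-ucross k∈ k<s) (above-unest k∈ k<s))))
      where
      k<s = ℕₚ.≤∧≢⇒< (proj₁ (up k∈ ecp)) (ne ∘ ≡.sym)
      k<t = ℕₚ.≤∧≢⇒< (cvD⇒ k∈ ecv) (t-moves k∈ ne ∘ ≡.sym)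
    ... | inj₂ ecp | inj₂ ecv = trans
      (source-drise (lcross k) (lnest k) (ucross k) (unest k) (psnest k) (<ᵇ-true t<k) (<ᵇ-asym k<s)
          (<ᵇ-asym t<k) (<ᵇ-true k<s) (≡ᵇ-false ne) (arec-above k∈ k<s) (rec-unest k∈ k<s))
      (reflexive (≡.sym (factor-U ecp ecv ne (below-ucross k∈ k<s) (above-unest k∈ k<s))))
      where
      k<s = ℕₚ.≤∧≢⇒< (proj₁ (up k∈ ecp)) (ne ∘ ≡.sym)
      t<k = ℕₚ.≤∧≢⇒< (cvU⇒ k∈ ecv) (t-moves k∈ ne)

  -- Inverting a permutation exchanges double rises and double falls.
  swapVars : Vars R → Vars R
  swapVars V = record V
    { x₂ = y₂ ; y₂ = x₂ ; u₂ = v₂ ; v₂ = u₂ ; p₋₂ = p₊₂ ; p₊₂ = p₋₂ ; q₋₂ = q₊₂ ; q₊₂ = q₋₂ }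
    where open Vars V

  module TargetLocal (V : Vars R) (σ : List ℕ) (p : PermPair (length σ) (app σ) (inv σ)) (cp cv : Pred)
    (respects : ∀ {i} → InRange (length σ) i → Guard.Placed (length σ) cv (cp i) i (inv σ i)) where
    open LocalWeights R V using (items'; target-fix; target-peak; target-dfall; target-val; target-drise)
    open LocalWeights R (swapVars V) using (arcw; fixw)
    open ClosedFactors (flipPair p) cp cv respects R arcw fixw
    open Facts σ p
    open Orders p
    open Stats σ using (s; m; psnest; lcross'; lnest'; ucross'; unest')

    -- For π = σ⁻¹ a D-position has `t k < k` and a D-value has `k < s k`. Two D-classes thus give a
    -- double rise and two U-classes a double fall, while peaks and valleys keep their clauses of
    -- `arcw`.
    local≈factor : ∀ {k} → InRange m k → local (items' σ) k ≈ factors k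
    local≈factor {k} k∈ with s k ℕ.≟ k
    ... | yes fx = trans
      (target-fix k (lcross' k) (lnest' k) (ucross' k) (unest' k) (psnest k) ≡.refl (<ᵇ-irrefl tk)
          (<ᵇ-irrefl fx) (<ᵇ-irrefl (≡.sym tk)) (<ᵇ-irrefl (≡.sym fx)) (≡ᵇ-true fx)
        nr-fix rar-fix)
      (reflexive (≡.sym (factor-fix tk (psnest-up k∈ fx) (height-U′ k∈ fx))))
      where
      tk = t-fixes k∈ fx
      nr-fix : Stats.nr σ k ≡ not (psnest k ≡ᵇ 0)
      nr-fix rewrite rec-fix k∈ fx | arec-fix k∈ fx with psnest k ≡ᵇ 0
      ... | true  = ≡.refl
      ... | false = ≡.refl
      rar-fix : Stats.rar σ k ≡ (psnest k ≡ᵇ 0)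
      rar-fix rewrite rec-fix k∈ fx | arec-fix k∈ fx with psnest k ≡ᵇ 0
      ... | true  = ≡.refl
      ... | false = ≡.refl
    ... | no ne with bool-cases (cp k) | bool-cases (cv k)
    ... | inj₁ ecp | inj₁ ecv = trans
      (target-drise (lcross' k) (lnest' k) (ucross' k) (unest' k) (psnest k) (<ᵇ-true t<k) (<ᵇ-asym k<s)
          (<ᵇ-asym t<k) (<ᵇ-true k<s) (≡ᵇ-false ne)
        (≡.trans (cong (Stats.rec σ k ∧_) (arec-above k∈ k<s)) (∧-zeroʳ _)) (rec-unest' k∈ t<k))
      (reflexive (≡.sym (factor-D ecp ecv (t-moves k∈ ne) (above-ucross' k∈ t<k) (below-unest' k∈ t<k))))
      where
      t<k = ℕₚ.≤∧≢⇒< (proj₁ (down k∈ ecp)) (t-moves k∈ ne)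
      k<s = ℕₚ.≤∧≢⇒< (cvD⇒ k∈ ecv) (ne ∘ ≡.sym)
    ... | inj₁ ecp | inj₂ ecv = trans
      (target-peak (lcross' k) (lnest' k) (ucross' k) (unest' k) (psnest k) (<ᵇ-true t<k) (<ᵇ-true s<k)
          (<ᵇ-asym t<k) (<ᵇ-asym s<k) (≡ᵇ-false ne)
        (cong (_∧ Stats.arec σ k) (rec-below k∈ s<k)) (rec-unest' k∈ t<k))
      (reflexive (≡.sym (factor-D ecp ecv (t-moves k∈ ne) (above-ucross' k∈ t<k) (below-unest' k∈ t<k))))
      where
      t<k = ℕₚ.≤∧≢⇒< (proj₁ (down k∈ ecp)) (t-moves k∈ ne)
      s<k = ℕₚ.≤∧≢⇒< (cvU⇒ k∈ ecv) ne
    ... | inj₂ ecp | inj₁ ecv = trans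
      (target-val (lcross' k) (lnest' k) (ucross' k) (unest' k) (psnest k) (<ᵇ-asym k<t) (<ᵇ-asym k<s)
          (<ᵇ-true k<t) (<ᵇ-true k<s) (≡ᵇ-false ne)
        (≡.trans (cong (Stats.rec σ k ∧_) (arec-above k∈ k<s)) (∧-zeroʳ _)) (arec-lnest' k∈ k<t))
      (reflexive (≡.sym (factor-U ecp ecv (t-moves k∈ ne) (below-lcross' k∈ k<t) (above-lnest' k∈ k<t))))
      where
      k<t = ℕₚ.≤∧≢⇒< (proj₁ (up k∈ ecp)) (t-moves k∈ ne ∘ ≡.sym)
      k<s = ℕₚ.≤∧≢⇒< (cvD⇒ k∈ ecv) (ne ∘ ≡.sym)
    ... | inj₂ ecp | inj₂ ecv = trans
      (target-dfall (lcross' k) (lnest' k) (ucross' k) (unest' k) (psnest k) (<ᵇ-asym k<t) (<ᵇ-true s<k)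
          (<ᵇ-true k<t) (<ᵇ-asym s<k) (≡ᵇ-false ne)
        (cong (_∧ Stats.arec σ k) (rec-below k∈ s<k)) (arec-lnest' k∈ k<t))
      (reflexive (≡.sym (factor-U ecp ecv (t-moves k∈ ne) (below-lcross' k∈ k<t) (above-lnest' k∈ k<t))))
      where
      k<t = ℕₚ.≤∧≢⇒< (proj₁ (up k∈ ecp)) (t-moves k∈ ne ∘ ≡.sym)
      s<k = ℕₚ.≤∧≢⇒< (cvU⇒ k∈ ecv) ne

-- Strings of free classes.

bools : ℕ → List (List Bool)
bools zero    = [] ∷ []
bools (suc n) = concatMap (λ b → map (b ∷_) (bools n)) (true ∷ false ∷ [])

-- positions are counted from 1, as in app
bit : List Bool → ℕ → Bool
bit []       _             = false
bit (b ∷ bs) zero          = false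
bit (b ∷ bs) (suc zero)    = b
bit (b ∷ bs) (suc (suc i)) = bit bs (suc i)

bit-ext : ∀ bs cs → length bs ≡ length cs → (∀ {i} → InRange (length bs) i → bit bs i ≡ bit cs i) → bs ≡ cs
bit-ext []       []       e h = ≡.refl
bit-ext (x ∷ bs) (y ∷ cs) e h = cong₂ _∷_ (h (s≤s z≤n , s≤s z≤n))
  (bit-ext bs cs (ℕₚ.suc-injective e) (λ { {suc i} (_ , i≤) → h (s≤s z≤n , s≤s i≤) }))

bit-map-interval : ∀ f k len i → i < len → bit (map f (interval k len)) (suc i) ≡ f (k ℕ.+ i)
bit-map-interval f k (suc len) zero    i< = cong f (≡.sym (ℕₚ.+-identityʳ k))
bit-map-interval f k (suc len) (suc i) (s≤s i<) =
  ≡.trans (bit-map-interval f (suc k) len i i<) (cong f (≡.sym (ℕₚ.+-suc k i)))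

bit-map-range : ∀ f {m i} → InRange m i → bit (map f (range m)) i ≡ f i
bit-map-range f {m} {suc i} (_ , i<) rewrite range≡interval m = bit-map-interval f 1 m i i<

none : Pred
none _ = false

-- In σ⁻¹ the value `v` sits at position σ(v), which is at least `v` for odd `v`; so the odd values
-- are the D-values.
isOdd : ℕ → Bool
isOdd = not ∘ isEven

mapBits : (ℕ → Bool) → ℕ → List Bool
mapBits f m = map f (range m)

length-mapBits : ∀ f m → length (mapBits f m) ≡ m
length-mapBits f m = ≡.trans (length-map f (range m)) (length-range m)

-- `mk` decides which coordinate is fixed by parity: the class of the position for σ, the class of
-- the value for σ⁻¹.
pairing : (Bool → Bool → Bool × Bool) → Pred → ℕ → List Bool → Classes
pairing mk par k []       = []
pairing mk par k (b ∷ bs) = mk (par k) b ∷ pairing mk par (suc k) bs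

length-pairing : ∀ mk par k bs → length (pairing mk par k bs) ≡ length bs
length-pairing mk par k []       = ≡.refl
length-pairing mk par k (b ∷ bs) = cong suc (length-pairing mk par (suc k) bs)

module _ (m : ℕ) where
  open Guard m

  pairing-positions : ∀ par f k bs → (∀ i → i < length bs → bit bs (suc i) ≡ f (k ℕ.+ i)) →
    pairing _,_ par k bs ≡ classes par f k (length bs)
  pairing-positions par f k []       h = ≡.refl
  pairing-positions par f k (b ∷ bs) h = cong₂ _∷_
    (cong (par k ,_) (≡.trans (h 0 (s≤s z≤n)) (cong f (ℕₚ.+-identityʳ k))))
    (pairing-positions par f (suc k) bs (λ i i< → ≡.trans (h (suc i) (s≤s i<)) (cong f (ℕₚ.+-suc k i))))

  pairing-values : ∀ par f k bs → (∀ i → i < length bs → bit bs (suc i) ≡ f (k ℕ.+ i)) →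
    pairing (flip _,_) par k bs ≡ classes f par k (length bs)
  pairing-values par f k []       h = ≡.refl
  pairing-values par f k (b ∷ bs) h = cong₂ _∷_
    (cong (_, par k) (≡.trans (h 0 (s≤s z≤n)) (cong f (ℕₚ.+-identityʳ k))))
    (pairing-values par f (suc k) bs (λ i i< → ≡.trans (h (suc i) (s≤s i<)) (cong f (ℕₚ.+-suc k i))))

  placed-class : ∀ {cv : Pred} c {i v} → Placed cv c i v → cv v ≡ c
  placed-class true  = proj₂
  placed-class false = proj₂

  placed-all : ∀ cp cv w → admissible none 1 (classes cp cv 1 m) w ≡ true → ∀ {i} → InRange m i →
      Placed cv (cp i) i (app w i)
  placed-all cp cv w ok {suc i} (_ , i<) = placed cp cv 1 m w ℕₚ.≤-refl ≡.refl (λ u ()) (λ u ()) ok i i<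

  module _ {w : List ℕ} (ww : Word m w) where

    dTest : ℕ → Bool
    dTest i = if isEven i then app w i ≤ᵇ i else i ≤ᵇ app w i

    isD-elim : isD w ≡ true → ∀ {i} → InRange m i → dTest i ≡ true
    isD-elim h = allB-elim m (≡.trans (cong (allB dTest ∘ range) (≡.sym (proj₁ ww))) h)

    isD-intro : (∀ {i} → InRange m i → dTest i ≡ true) → isD w ≡ true
    isD-intro h = ≡.trans (cong (allB dTest ∘ range) (proj₁ ww)) (allB-intro m h)

  -- Admissibility puts every letter on the side demanded by the parity of its position, which is
  -- the condition `isD`. As a value shares the class of its position, the free string can only
  -- record the parities of the preimages.
  source-determined : ∀ {w bs} → Word m w → length bs ≡ m → admissible none 1 (pairing _,_ isEven 1 bs) w ≡ true →
    isPerm m w ∧ isD w ≡ true × bs ≡ mapBits (isEven ∘ inv w) m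
  source-determined {w} {bs} ww lb ok = ∧-intro perm (isD-intro ww down-up) ,
    bit-ext bs _ (≡.trans lb (≡.sym (length-mapBits _ m))) (λ {i} i∈ →
      let i∈m = subst (λ n → InRange n i) lb i∈ in ≡.trans
        (≡.trans (cong (bit bs) (≡.sym (s∘t i∈m))) (placed-class (isEven (inv w i)) (pl (t-range i∈m))))
        (≡.sym (bit-map-range (isEven ∘ inv w) i∈m)))
    where
    cls≡ : pairing _,_ isEven 1 bs ≡ classes isEven (bit bs) 1 m
    cls≡ = ≡.trans (pairing-positions isEven (bit bs) 1 bs (λ _ _ → ≡.refl)) (cong (classes isEven (bit bs) 1) lb)
    perm : isPerm m w ≡ true
    perm = admissible⇒isPerm m (pairing _,_ isEven 1 bs) w (≡.trans (length-pairing _,_ isEven 1 bs) lb) ok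
    open PermPair (permPair ww perm)
    pl : ∀ {i} → InRange m i → Placed (bit bs) (isEven i) i (app w i)
    pl = placed-all isEven (bit bs) w (subst (λ c → admissible none 1 c w ≡ true) cls≡ ok)
    down-up : ∀ {i} → InRange m i → (if isEven i then app w i ≤ᵇ i else i ≤ᵇ app w i) ≡ true
    down-up {i} i∈ with isEven i | pl i∈
    ... | true  | le , _ = ≤ᵇ-true le
    ... | false | le , _ = ≤ᵇ-true le

  -- Here parity constrains the values, which is the condition `isD` on the inverse word; a position
  -- takes its class from its value.
  target-determined : ∀ {w bs} → Word m w → length bs ≡ m → admissible none 1 (pairing (flip _,_) isOdd 1 bs)
      w ≡ true →
    isPerm m w ∧ isD (invWord m w) ≡ true × bs ≡ mapBits (isOdd ∘ app w) m
  target-determined {w} {bs} ww lb ok = ∧-intro perm (isD-intro (invWord-word ww perm) down-up) ,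
    bit-ext bs _ (≡.trans lb (≡.sym (length-mapBits _ m))) (λ {i} i∈ →
      let i∈m = subst (λ n → InRange n i) lb i∈ in ≡.trans
        (≡.sym (placed-class (bit bs i) (pl i∈m))) (≡.sym (bit-map-range (isOdd ∘ app w) i∈m)))
    where
    cls≡ : pairing (flip _,_) isOdd 1 bs ≡ classes (bit bs) isOdd 1 m
    cls≡ = ≡.trans (pairing-values isOdd (bit bs) 1 bs (λ _ _ → ≡.refl)) (cong (classes (bit bs) isOdd 1) lb)
    perm : isPerm m w ≡ true
    perm = admissible⇒isPerm m (pairing (flip _,_) isOdd 1 bs) w
        (≡.trans (length-pairing (flip _,_) isOdd 1 bs) lb) ok
    open PermPair (permPair ww perm)
    pl : ∀ {i} → InRange m i → Placed isOdd (bit bs i) i (app w i)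
    pl = placed-all (bit bs) isOdd w (subst (λ c → admissible none 1 c w ≡ true) cls≡ ok)
    down-up : ∀ {i} → InRange m i →
      (if isEven i then app (invWord m w) i ≤ᵇ i else i ≤ᵇ app (invWord m w) i) ≡ true
    down-up {i} i∈ rewrite app-invWord ww perm i∈
      with bit bs (inv w i) | subst (Placed isOdd (bit bs (inv w i)) (inv w i)) (s∘t i∈) (pl (t-range i∈))
    ... | true  | le , od rewrite not-true od = ≤ᵇ-true le
    ... | false | le , ev with isEven i
    ...   | true = ≤ᵇ-true le

-- From sums over permutations to sums over class strings.

module ClassSums {c ℓ} (R : CommutativeSemiring c ℓ) where
  open CommutativeSemiring R hiding (zero)
  open Sums R
  open Ranks R
  open Products R
  open Relation.Binary.Reasoning.Setoid setoid

  ∑-cong-words : ∀ m len {f g : List ℕ → Carrier} → (∀ w → length w ≡ len → All (InRange m) w → f w ≈ g w) →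
    ∑ (words m len) f ≈ ∑ (words m len) g
  ∑-cong-words m zero      e = +-congʳ (e [] ≡.refl [])
  ∑-cong-words m (suc len) e = trans (∑-words m len _) (trans
    (∑-cong-range m (λ a a∈ → ∑-cong-words m len (λ w l as → e (a ∷ w) (cong suc l) (a∈ ∷ as))))
    (sym (∑-words m len _)))

  ∑-words-δ : ∀ m len w* (f : List ℕ → Carrier) → length w* ≡ len → All (InRange m) w* →
    (∀ w → length w ≡ len → All (InRange m) w → w ≢ w* → f w ≈ 0#) → ∑ (words m len) f ≈ f w*
  ∑-words-δ m zero      []       f l as off = +-identityʳ _
  ∑-words-δ m (suc len) (a ∷ w*) f l (a∈ ∷ as) off = trans (∑-words m len f) (trans
    (∑-range-δ m a (λ b → ∑ (words m len) (λ w → f (b ∷ w))) a∈ (λ b b∈ b≢a → trans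
      (∑-cong-words m len (λ w lw ws → off (b ∷ w) (cong suc lw) (b∈ ∷ ws) (λ { ≡.refl → b≢a ≡.refl })))
      (∑-zero (words m len) (λ _ → refl))))
    (∑-words-δ m len w* (λ w → f (a ∷ w)) (ℕₚ.suc-injective l) as
      (λ w lw ws ne → off (a ∷ w) (cong suc lw) (a∈ ∷ ws) (λ { ≡.refl → ne ≡.refl }))))

  ∑-bools : ∀ n (f : List Bool → Carrier) → ∑ (bools (suc n)) f ≈ ∑ (bools n) (λ bs → f (true ∷ bs) + f
      (false ∷ bs))
  ∑-bools n f = trans (∑-concatMap (λ b → map (b ∷_) (bools n)) (true ∷ false ∷ []) f) (trans
    (+-cong (∑-map (true ∷_) (bools n) f) (trans (+-identityʳ _) (∑-map (false ∷_) (bools n) f)))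
    (sym (∑-+ (bools n) _ _)))

  ∑-cong-bools : ∀ n {f g : List Bool → Carrier} → (∀ bs → length bs ≡ n → f bs ≈ g bs) → ∑ (bools n) f ≈ ∑
      (bools n) g
  ∑-cong-bools zero    e = +-congʳ (e [] ≡.refl)
  ∑-cong-bools (suc n) e = trans (∑-bools n _) (trans
    (∑-cong-bools n (λ bs l → +-cong (e (true ∷ bs) (cong suc l)) (e (false ∷ bs) (cong suc l))))
    (sym (∑-bools n _)))

  ∑-bools-δ : ∀ n bs* (f : List Bool → Carrier) → length bs* ≡ n → (∀ bs → length bs ≡ n → bs ≢ bs* → f bs ≈ 0#) →
    ∑ (bools n) f ≈ f bs*
  ∑-bools-δ zero    []           f l off = +-identityʳ _
  ∑-bools-δ (suc n) (true ∷ bs*) f l off = trans (∑-bools n f) (trans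
    (∑-cong-bools n (λ bs lb → trans (+-congˡ (off (false ∷ bs) (cong suc lb) λ ())) (+-identityʳ _)))
    (∑-bools-δ n bs* (f ∘ (true ∷_)) (ℕₚ.suc-injective l)
      (λ bs lb ne → off (true ∷ bs) (cong suc lb) (λ { ≡.refl → ne ≡.refl }))))
  ∑-bools-δ (suc n) (false ∷ bs*) f l off = trans (∑-bools n f) (trans
    (∑-cong-bools n (λ bs lb → trans (+-congʳ (off (true ∷ bs) (cong suc lb) λ ())) (+-identityˡ _)))
    (∑-bools-δ n bs* (f ∘ (false ∷_)) (ℕₚ.suc-injective l)
      (λ bs lb ne → off (false ∷ bs) (cong suc lb) (λ { ≡.refl → ne ≡.refl }))))

  private
    infix 4 _==_
    _==_ : List ℕ → List ℕ → Bool
    v == w = does (≡-dec ℕ._≟_ v w)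

    ==-refl : ∀ {v w} → v ≡ w → (v == w) ≡ true
    ==-refl {v} {w} e = dec-true (≡-dec ℕ._≟_ v w) e

    ==-≢ : ∀ {v w} → v ≢ w → (v == w) ≡ false
    ==-≢ {v} {w} e = dec-false (≡-dec ℕ._≟_ v w) e

    vanish : ∀ {b x} → b ≡ false → [ b ]· x ≈ 0#
    vanish ≡.refl = refl

    keep : ∀ {b x} → b ≡ true → [ b ]· x ≈ x
    keep ≡.refl = refl

  -- The kernel `K` is supported on the pairs of a permutation and its inverse. Summing it by rows
  -- and by columns replaces a permutation by its inverse without any reordering of lists.
  sum-inverse : ∀ m (f : List ℕ → Carrier) →
    ∑ (words m m) (λ w → [ isPerm m w ]· f w) ≈ ∑ (words m m) (λ w → [ isPerm m w ]· f (invWord m w))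
  sum-inverse m f = begin
    ∑ (words m m) (λ σ → [ isPerm m σ ]· f σ)
      ≈⟨ ∑-cong-words m m (λ σ l as → sym (rowSum σ (l , as))) ⟩
    ∑ (words m m) (λ σ → ∑ (words m m) (λ τ → K σ τ))
      ≈⟨ ∑-swap (words m m) (words m m) K ⟩
    ∑ (words m m) (λ τ → ∑ (words m m) (λ σ → K σ τ))
      ≈⟨ ∑-cong-words m m (λ τ l as → columnSum τ (l , as)) ⟩
    ∑ (words m m) (λ τ → [ isPerm m τ ]· f (invWord m τ)) ∎
    where
    K : List ℕ → List ℕ → Carrier
    K σ τ = [ isPerm m σ ]· [ τ == invWord m σ ]· f σ
    rowSum : ∀ σ → Word m σ → ∑ (words m m) (K σ) ≈ [ isPerm m σ ]· f σ
    rowSum σ ww with isPerm m σ in e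
    ... | false = ∑-zero (words m m) (λ _ → refl)
    ... | true  = trans
      (∑-words-δ m m (invWord m σ) _ (proj₁ (invWord-word ww e)) (proj₂ (invWord-word ww e))
        (λ τ _ _ ne → vanish (==-≢ ne)))
      (keep (==-refl {invWord m σ} ≡.refl))
    columnSum : ∀ τ → Word m τ → ∑ (words m m) (λ σ → K σ τ) ≈ [ isPerm m τ ]· f (invWord m τ)
    columnSum τ ww with bool-cases (isPerm m τ)
    ... | inj₁ e = trans
      (∑-words-δ m m (invWord m τ) (λ σ → K σ τ) (proj₁ (invWord-word ww e)) (proj₂ (invWord-word ww e)) off)
      (trans (keep (invWord-isPerm ww e)) (trans (keep (==-refl (≡.sym (invWord-involutive ww e)))) (sym (keep e))))
      where
      off : ∀ σ → length σ ≡ m → All (InRange m) σ → σ ≢ invWord m τ → K σ τ ≈ 0#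
      off σ l as ne with isPerm m σ in eσ
      ... | false = refl
      ... | true  = vanish (==-≢ {τ} {invWord m σ} (λ { ≡.refl → ne (≡.sym (invWord-involutive (l , as) eσ)) }))
    ... | inj₂ e = trans (trans (∑-cong-words m m (λ σ l as → off σ (l , as))) (∑-zero (words m m) (λ _ → refl)))
      (sym (vanish e))
      where
      off : ∀ σ → Word m σ → K σ τ ≈ 0#
      off σ ww′ with isPerm m σ in eσ
      ... | false = refl
      ... | true  = vanish (==-≢ {τ} {invWord m σ} (λ { ≡.refl → true≢false (invWord-isPerm ww′ eσ) e }))

  module _ (arcw : Bool → Bool → ℕ → ℕ → Carrier) (fixw : ℕ → ℕ → Carrier) (m : ℕ) where
    open Guard m
    open Eval R arcw fixw m

    -- A nonzero term needs an admissible string; by `det` it exists only for a good word and is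
    -- then `bs*`, whose weight is given by `val`.
    sum-over-classes : ∀ (cls : List Bool → Classes) w bs* good x → length bs* ≡ m →
      (∀ bs → length bs ≡ m → admissible none 1 (cls bs) w ≡ true → good ≡ true × bs ≡ bs*) →
      (good ≡ true → ev none 1 (cls bs*) w ≈ x) →
      ∑ (bools m) (λ bs → ev none 1 (cls bs) w) ≈ [ good ]· x
    sum-over-classes cls w bs* false x l det val = trans
      (∑-cong-bools m (λ bs lb → off bs lb)) (∑-zero (bools m) (λ _ → refl))
      where
      off : ∀ bs → length bs ≡ m → ev none 1 (cls bs) w ≈ 0#
      off bs lb with bool-cases (admissible none 1 (cls bs) w)
      ... | inj₁ ok = true≢false (proj₁ (det bs lb ok)) ≡.refl
      ... | inj₂ ko = ev-inadmissible none 1 (cls bs) w ko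
    sum-over-classes cls w bs* true x l det val = trans (∑-bools-δ m bs* _ l off) (val ≡.refl)
      where
      off : ∀ bs → length bs ≡ m → bs ≢ bs* → ev none 1 (cls bs) w ≈ 0#
      off bs lb ne with bool-cases (admissible none 1 (cls bs) w)
      ... | inj₁ ok = ⊥-elim (ne (proj₂ (det bs lb ok)))
      ... | inj₂ ko = ev-inadmissible none 1 (cls bs) w ko

    sum-classes-words : ∀ (cls : List Bool → Classes) → (∀ bs → length (cls bs) ≡ length bs) →
      ∑ (words m m) (λ w → ∑ (bools m) (λ bs → ev none 1 (cls bs) w)) ≈ ∑ (bools m) (λ bs → Φ 0 1 (cls bs))
    sum-classes-words cls lc = trans (∑-swap (words m m) (bools m) _)
      (∑-cong-bools m (λ bs lb → let l = ≡.trans (lc bs) lb in trans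
        (reflexive (cong (λ n → ∑ (words m n) (ev none 1 (cls bs))) (≡.sym l)))
        (trans (sum-ev none 1 (cls bs) ℕₚ.≤-refl (cong suc l) (λ u ()))
          (reflexive (cong (λ h → Φ h 1 (cls bs)) (count-false (λ _ → ≡.refl) (range m)))))))

  module _ (V : Vars R) where
    open Vars V
    open Poly R using (weight; weight'; P; P'; α; δ)
    private
      module LS = LocalWeights R V
      module LT = LocalWeights R (swapVars R V)

    source-value : ∀ {m w} → Word m w → isPerm m w ∧ isD w ≡ true →
      Eval.ev R LS.arcw LS.fixw m none 1 (pairing _,_ isEven 1 (mapBits (isEven ∘ inv w) m)) w ≈ weight V w
    source-value {w = w} ww@(≡.refl , _) good = begin
      ev none 1 (pairing _,_ isEven 1 (mapBits f m)) w
        ≡⟨ cong (λ cls → ev none 1 cls w) cls≡ ⟩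
      ev none 1 (classes isEven f 1 m) w
        ≈⟨ Closed.ev-factors p isEven f respects R LS.arcw LS.fixw w ≡.refl (λ _ → ≡.refl) ⟩
      ∏ (range m) (Closed.factor p isEven f respects R LS.arcw LS.fixw)
        ≈⟨ ∏-cong-range m (λ k∈ → sym (SourceLocal.local≈factor R V w p isEven f respects k∈)) ⟩
      ∏ (range m) (local (LS.items w))
        ≈⟨ LS.weight-local w ⟨
      weight V w ∎
      where
      m = length w
      f = isEven ∘ inv w
      open Guard m
      open Eval R LS.arcw LS.fixw m
      p = permPair ww (proj₁ (∧-true good))
      open PermPair p
      cls≡ : pairing _,_ isEven 1 (mapBits f m) ≡ classes isEven f 1 m
      cls≡ = ≡.trans (pairing-positions m isEven f 1 (mapBits f m)
        (λ i i< → bit-map-range f (s≤s z≤n , subst (suc i ≤_) (length-mapBits f m) i<)))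
        (cong (classes isEven f 1) (length-mapBits f m))
      respects : ∀ {i} → InRange m i → Placed f (isEven i) i (app w i)
      respects {i} i∈ with isEven i in e | isD-elim m ww (proj₂ (∧-true {isPerm m w} good)) i∈
      ... | true  | le = ≤ᵇ-true⁻¹ {app w i} {i} le , ≡.trans (cong isEven (t∘s i∈)) e
      ... | false | le = ≤ᵇ-true⁻¹ {i} {app w i} le , ≡.trans (cong isEven (t∘s i∈)) e

    target-value : ∀ {m τ} → Word m τ → isPerm m τ ∧ isD (invWord m τ) ≡ true →
      Eval.ev R LT.arcw LT.fixw m none 1 (pairing (flip _,_) isOdd 1 (mapBits (isOdd ∘ app τ) m)) τ ≈ weight'
          V (invWord m τ)
    target-value {m} {τ} ww good = go (invWord m τ) (invWord-word ww perm) (invWord-isPerm ww perm)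
        (proj₂ (∧-true {isPerm m τ} good)) (inv-invWord ww perm)
      where
      perm = proj₁ (∧-true good)
      -- Stated for a variable `σ` so that `length σ ≡ m` can be matched; the length of
      -- `invWord m τ` itself mentions `m`.
      go : ∀ σ → Word m σ → isPerm m σ ≡ true → isD σ ≡ true → (∀ {i} → InRange m i → inv σ i ≡ app τ i) →
        Eval.ev R LT.arcw LT.fixw m none 1 (pairing (flip _,_) isOdd 1 (mapBits (isOdd ∘ app τ) m)) τ ≈ weight' V σ
      go σ wσ@(≡.refl , _) permσ dσ inv≡ = begin
        ev none 1 (pairing (flip _,_) isOdd 1 (mapBits (isOdd ∘ app τ) m)) τ
          ≡⟨ cong (λ cls → ev none 1 cls τ) cls≡ ⟩
        ev none 1 (classes f isOdd 1 m) τ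
          ≈⟨ Closed.ev-factors (flipPair p) f isOdd respects R LT.arcw LT.fixw τ (proj₁ ww) (≡.sym ∘ inv≡) ⟩
        ∏ (range m) (Closed.factor (flipPair p) f isOdd respects R LT.arcw LT.fixw)
          ≈⟨ ∏-cong-range m (λ k∈ → sym (TargetLocal.local≈factor R V σ p f isOdd respects k∈)) ⟩
        ∏ (range m) (local (LS.items' σ))
          ≈⟨ LS.weight'-local σ ⟨
        weight' V σ ∎
        where
        f = isOdd ∘ inv σ
        open Guard m
        open Eval R LT.arcw LT.fixw m
        p = permPair wσ permσ
        open PermPair p
        cls≡ : pairing (flip _,_) isOdd 1 (mapBits (isOdd ∘ app τ) m) ≡ classes f isOdd 1 m
        cls≡ = ≡.trans (pairing-values m isOdd f 1 (mapBits (isOdd ∘ app τ) m)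
          (λ i i< → let i∈ = s≤s z≤n , subst (suc i ≤_) (length-mapBits (isOdd ∘ app τ) m) i< in
            ≡.trans (bit-map-range (isOdd ∘ app τ) i∈) (cong isOdd (≡.sym (inv≡ i∈)))))
          (cong (classes f isOdd 1) (length-mapBits (isOdd ∘ app τ) m))
        respects : ∀ {i} → InRange m i → Placed isOdd (f i) i (inv σ i)
        respects {i} i∈ with isEven (inv σ i) in e | isD-elim m wσ dσ (t-range i∈)
        ... | true  | le = subst (_≤ inv σ i) (s∘t i∈) (≤ᵇ-true⁻¹ {app σ (inv σ i)} {inv σ i} le) , cong not e
        ... | false | le = subst (inv σ i ≤_) (s∘t i∈) (≤ᵇ-true⁻¹ {inv σ i} {app σ (inv σ i)} le) , cong not e

    private
      []·-∧ : ∀ a b {x} → [ a ]· [ b ]· x ≈ [ a ∧ b ]· x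
      []·-∧ true  b = refl
      []·-∧ false b = refl

      ∑-D : ∀ n f → ∑ (D n) f ≈ ∑ (words (2 ℕ.* n) (2 ℕ.* n)) (λ w → [ isPerm (2 ℕ.* n) w ]· [ isD w ]· f w)
      ∑-D n f = trans (∑-filter isD (perms m) f) (∑-filter (isPerm m) (words m m) _)
        where m = 2 ℕ.* n

    P≈Φ : ∀ n → P V n ≈ ∑ (bools (2 ℕ.* n)) (λ bs → Eval.Φ R LS.arcw LS.fixw (2 ℕ.* n) 0 1
        (pairing _,_ isEven 1 bs))
    P≈Φ n = begin
      ∑ (D n) (weight V)
        ≈⟨ ∑-D n (weight V) ⟩
      ∑ (words m m) (λ w → [ isPerm m w ]· [ isD w ]· weight V w)
        ≈⟨ ∑-cong-words m m (λ w l as → trans ([]·-∧ (isPerm m w) (isD w))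
             (sym (sum-over-classes LS.arcw LS.fixw m (pairing _,_ isEven 1) w _ _ _ (length-mapBits _ m)
               (λ bs lb → source-determined m (l , as) lb) (source-value (l , as))))) ⟩
      ∑ (words m m) (λ w → ∑ (bools m) (λ bs → Eval.ev R LS.arcw LS.fixw m none 1 (pairing _,_ isEven 1 bs) w))
        ≈⟨ sum-classes-words LS.arcw LS.fixw m (pairing _,_ isEven 1) (length-pairing _,_ isEven 1) ⟩
      ∑ (bools m) (λ bs → Eval.Φ R LS.arcw LS.fixw m 0 1 (pairing _,_ isEven 1 bs)) ∎
      where m = 2 ℕ.* n

    P'≈Φ : ∀ n → P' V n ≈ ∑ (bools (2 ℕ.* n)) (λ bs → Eval.Φ R LT.arcw LT.fixw (2 ℕ.* n) 0 1
        (pairing (flip _,_) isOdd 1 bs))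
    P'≈Φ n = begin
      ∑ (D n) (weight' V)
        ≈⟨ ∑-D n (weight' V) ⟩
      ∑ (words m m) (λ w → [ isPerm m w ]· [ isD w ]· weight' V w)
        -- From here on the word summed over is the inverse of the permutation whose weight is
        -- taken.
        ≈⟨ sum-inverse m _ ⟩
      ∑ (words m m) (λ w → [ isPerm m w ]· [ isD (invWord m w) ]· weight' V (invWord m w))
        ≈⟨ ∑-cong-words m m (λ w l as → trans ([]·-∧ (isPerm m w) (isD (invWord m w)))
             (sym (sum-over-classes LT.arcw LT.fixw m (pairing (flip _,_) isOdd 1) w _ _ _ (length-mapBits _ m)
               (λ bs lb → target-determined m (l , as) lb) (target-value (l , as))))) ⟩
      ∑ (words m m) (λ w → ∑ (bools m) (λ bs → Eval.ev R LT.arcw LT.fixw m none 1 (pairing (flip _,_) isOdd 1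
          bs) w))
        ≈⟨ sum-classes-words LT.arcw LT.fixw m (pairing (flip _,_) isOdd 1) (length-pairing (flip _,_) isOdd 1) ⟩
      ∑ (bools m) (λ bs → Eval.Φ R LT.arcw LT.fixw m 0 1 (pairing (flip _,_) isOdd 1 bs)) ∎
      where m = 2 ℕ.* n

-- From class strings to paths and the continued fraction.

isEven-suc : ∀ k → isEven (suc k) ≡ not (isEven k)
isEven-suc zero          = ≡.refl
isEven-suc (suc zero)    = ≡.refl
isEven-suc (suc (suc k)) = isEven-suc k

isEven-dbl : ∀ h → isEven (dbl h) ≡ true
isEven-dbl zero    = ≡.refl
isEven-dbl (suc h) = isEven-dbl h

half-dbl : ∀ h → ⌊ dbl h /2⌋ ≡ h
half-dbl zero    = ≡.refl
half-dbl (suc h) = cong suc (half-dbl h)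

-- The strings have length `2 * n`, but an induction by pairs of indices needs a double that exposes
-- two successors at once.
dbl≡2* : ∀ n → dbl n ≡ 2 ℕ.* n
dbl≡2* zero    = ≡.refl
dbl≡2* (suc n) = cong suc (≡.trans (cong suc (dbl≡2* n)) (≡.sym (ℕₚ.+-suc n (n ℕ.+ 0))))

module WalkSums {c ℓ} (R : CommutativeSemiring c ℓ) where
  open CommutativeSemiring R hiding (zero)
  open Poly R using (_^_; Tfrac)
  open Sums R
  open Ranks R
  open ClassSums R
  open Relation.Binary.Reasoning.Setoid setoid

  module _ (a b c d : ℕ → Carrier) (a-0 : a 0 ≈ 0#) (X : ℕ → ℕ → List Bool → Carrier)
    (X-end  : ∀ h k → X h k [] ≈ [ h ≡ᵇ 0 ]· 1#)
    (X-odd  : ∀ h k bs → isEven k ≡ false → X h k (true ∷ bs) + X h k (false ∷ bs) ≈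
                b (suc h) * X (suc h) (suc k) bs + c h * X h (suc k) bs)
    (X-even : ∀ h k bs → isEven k ≡ true → X h k (true ∷ bs) + X h k (false ∷ bs) ≈
                a h * X (pred h) (suc k) bs + d h * X h (suc k) bs) where
    open Walks a b c d

    private
      step : ∀ n h k y y′ h₁ h₂ →
        (∀ bs → X h k (true ∷ bs) + X h k (false ∷ bs) ≈ y * X h₁ (suc k) bs + y′ * X h₂ (suc k) bs) →
        ∑ (bools (suc n)) (X h k) ≈ y * ∑ (bools n) (X h₁ (suc k)) + y′ * ∑ (bools n) (X h₂ (suc k))
      step n h k y y′ h₁ h₂ e = trans (∑-bools n (X h k)) (trans (∑-cong (bools n) e)
        (trans (∑-+ (bools n) _ _) (sym (+-cong (∑-*ˡ (bools n) y _) (∑-*ˡ (bools n) y′ _)))))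

    -- Both path sums obey the recursions `X-odd` and `X-even`, so a single induction serves `P` and
    -- `P'`. One letter is the choice between two steps, and two letters form one unit of `n`.
    sum≈evenWalk : ∀ n h k → isEven k ≡ false → ∑ (bools (dbl n)) (X h k) ≈ evenWalk n h
    sum-even     : ∀ n h k → isEven k ≡ true → ∑ (bools (suc (dbl n))) (X h k) ≈
                     a h * evenWalk n (pred h) + d h * evenWalk n h
    sum≈evenWalk zero    zero    k e = trans (+-identityʳ _) (X-end 0 k)
    sum≈evenWalk zero    (suc h) k e = trans (+-identityʳ _) (X-end (suc h) k)
    sum≈evenWalk (suc n) h k e = trans
      (step (suc (dbl n)) h k (b (suc h)) (c h) (suc h) h (λ bs → X-odd h k bs e))
      (trans (+-cong (*-congˡ (sum-even n (suc h) (suc k) e′)) (*-congˡ (sum-even n h (suc k) e′))) (byHeight h))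
      where
      e′ : isEven (suc k) ≡ true
      e′ = ≡.trans (isEven-suc k) (cong not e)
      byHeight : ∀ h → b (suc h) * oddWalk n h + c h * (a h * evenWalk n (pred h) + d h * evenWalk n h) ≈
          evenWalk (suc n) h
      -- At height 0 the step down has weight `a 0`, which vanishes; what remains after the step
      -- `c 0` is the other half of the double level step.
      byHeight zero    = +-congˡ (*-congˡ (trans (+-congʳ (trans (*-congʳ a-0) (zeroˡ _))) (+-identityˡ _)))
      byHeight (suc h) = refl
    sum-even n h k e = trans
      (step (dbl n) h k (a h) (d h) (pred h) h (λ bs → X-even h k bs e))
      (+-cong (*-congˡ (sum≈evenWalk n (pred h) (suc k) e′)) (*-congˡ (sum≈evenWalk n h (suc k) e′)))
      where
      e′ : isEven (suc k) ≡ false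
      e′ = ≡.trans (isEven-suc k) (cong not e)

  module _ (V : Vars R) where
    open Vars V
    open Poly R using (P; P'; α; δ)
    private
      module LS = LocalWeights R V
      module LT = LocalWeights R (swapVars R V)

    evenFix oddFix : ℕ → Carrier
    evenFix h = if h ≡ᵇ 0 then zₑ else sₑ ^ h * wₑ
    oddFix  h = if h ≡ᵇ 0 then zₒ else sₒ ^ h * wₒ

    -- Peaks lower the height, valleys raise it; double rises and odd fixed points keep it at odd
    -- indices, double falls and even fixed points keep it at even ones.
    a b c′ d : ℕ → Carrier
    a  h = ranks (LS.arcw true false) h
    b  h = ranks (LS.arcw false true) h
    c′ h = ranks (LS.arcw false false) h + oddFix h
    d  h = ranks (LS.arcw true true) h + evenFix h

    open Walks a b c′ d

    source-walk : ∀ m n → ∑ (bools (dbl n)) (λ bs → Eval.Φ R LS.arcw LS.fixw m 0 1 (pairing _,_ isEven 1 bs))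
        ≈ evenWalk n 0
    source-walk m n = sum≈evenWalk a b c′ d refl X (λ _ _ → refl) X-odd X-even n 0 1 ≡.refl
      where
      X : ℕ → ℕ → List Bool → Carrier
      X h k bs = Eval.Φ R LS.arcw LS.fixw m h k (pairing _,_ isEven k bs)
      X-odd : ∀ h k bs → isEven k ≡ false → X h k (true ∷ bs) + X h k (false ∷ bs) ≈
                b (suc h) * X (suc h) (suc k) bs + c′ h * X h (suc k) bs
      -- The first rewrite lets `Φ` reduce on the class of the position; the parity inside `fixw`
      -- comes to light only then.
      X-odd h k bs e rewrite e | e = +-congʳ (*-congʳ (+-identityʳ _))
      X-even : ∀ h k bs → isEven k ≡ true → X h k (true ∷ bs) + X h k (false ∷ bs) ≈
                a h * X (pred h) (suc k) bs + d h * X h (suc k) bs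
      X-even h k bs e rewrite e | e = trans (+-comm _ _) (+-congʳ (*-congʳ (+-identityʳ _)))

    -- The free letter is now the class of the position. At an odd index D is a double rise or a
    -- fixed point and U a valley, at an even one D is a peak and U a double fall or a fixed point.
    -- The two choices come in the opposite order to `source-walk`, with the same weights.
    target-walk : ∀ m n → ∑ (bools (dbl n)) (λ bs → Eval.Φ R LT.arcw LT.fixw m 0 1 (pairing (flip _,_) isOdd 1
        bs)) ≈ evenWalk n 0
    target-walk m n = sum≈evenWalk a b c′ d refl X (λ _ _ → refl) X-odd X-even n 0 1 ≡.refl
      where
      X : ℕ → ℕ → List Bool → Carrier
      X h k bs = Eval.Φ R LT.arcw LT.fixw m h k (pairing (flip _,_) isOdd k bs)
      X-odd : ∀ h k bs → isEven k ≡ false → X h k (true ∷ bs) + X h k (false ∷ bs) ≈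
                b (suc h) * X (suc h) (suc k) bs + c′ h * X h (suc k) bs
      X-odd h k bs e rewrite e = trans (+-comm _ _) (+-congʳ (*-congʳ (+-identityʳ _)))
      X-even : ∀ h k bs → isEven k ≡ true → X h k (true ∷ bs) + X h k (false ∷ bs) ≈
                a h * X (pred h) (suc k) bs + d h * X h (suc k) bs
      X-even h k bs e rewrite e = +-congʳ (*-congʳ (+-identityʳ _))

    α-odd : ∀ h → α V (suc (dbl h)) ≈ a (suc h) * b (suc h)
    α-odd h rewrite ≡.trans (isEven-suc (dbl h)) (cong not (isEven-dbl h)) | half-dbl h =
      sym (*-cong (ranks-arc p₋₁ q₋₁ x₁ u₁ h) (ranks-arc p₊₁ q₊₁ y₁ v₁ h))

    α-even : ∀ h → α V (dbl (suc h)) ≈ d (suc h) * c′ (suc h)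
    α-even h rewrite isEven-dbl h | half-dbl h =
      sym (*-cong (+-congʳ (ranks-arc p₋₂ q₋₂ x₂ u₂ h)) (+-congʳ (ranks-arc p₊₂ q₊₂ y₂ v₂ h)))

    evenWalk≈CF : ∀ n → evenWalk n 0 ≈ Tfrac (α V) (δ V) n
    evenWalk≈CF = evenWalk≈Tfrac (α V) (δ V) α-odd α-even
      -- At height 0 `ranks` is the empty sum, which leaves `zₑ` and `zₒ` for the double level step.
      (sym (*-cong (+-identityˡ _) (+-identityˡ _))) (λ _ → refl)

    P≈walk : ∀ n → P V n ≈ evenWalk n 0
    P≈walk n = trans (P≈Φ V n) (trans
      (reflexive (cong (λ m → ∑ (bools m) (λ bs → Eval.Φ R LS.arcw LS.fixw (2 ℕ.* n) 0 1
          (pairing _,_ isEven 1 bs))) (≡.sym (dbl≡2* n))))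
      (source-walk (2 ℕ.* n) n))

    P'≈walk : ∀ n → P' V n ≈ evenWalk n 0
    P'≈walk n = trans (P'≈Φ V n) (trans
      (reflexive (cong (λ m → ∑ (bools m) (λ bs → Eval.Φ R LT.arcw LT.fixw (2 ℕ.* n) 0 1
          (pairing (flip _,_) isOdd 1 bs))) (≡.sym (dbl≡2* n))))
      (target-walk (2 ℕ.* n) n))

theorem3p13 : {c ℓ : Level} (R : CommutativeSemiring c ℓ) (V : Vars R) (n : ℕ) →
    CommutativeSemiring._≈_ R (Poly.P' R V n) (Poly.Tfrac R (Poly.α R V) (Poly.δ R V) n)
    × CommutativeSemiring._≈_ R (Poly.P R V n) (Poly.P' R V n)
theorem3p13 R V n = trans (P'≈walk V n) (evenWalk≈CF V n) , trans (P≈walk V n) (sym (P'≈walk V n))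
  where
  open CommutativeSemiring R using (trans; sym)
  open WalkSums R
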